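{- Suppose $f\in\mathbb{Z}[x]$ has an irreducible factor of degree $\ge 2$, i.e. $f(x)$ is not a product of linear polynomials (over $\mathbb{Q}$). Then $$N\log N\ \ll\ \log L_f(N)\ \ll\ N\log N ,$$ where $L_f(N):=\operatorname{lcm}\{f(n): n=1,\dots,N\}$.
   Context: For a polynomial $f\in\mathbb{Z}[x]$ with integer coefficients, $L_f(N)$ denotes the least common multiple of the values $f(1),\dots,f(N)$ of $f$ at the first $N$ positive integers. The statement concerns the growth of $\log L_f(N)$ as $N\to\infty$: the notation $A(N)\ll B(N)$ means that $A(N)\le C\,B(N)$ for all sufficiently large $N$, with a constant $C>0$ that may depend on $f$.
   Formalization: The polynomial f is assumed nonzero, and zero values f(n) = 0 are left out of the lcm, since for example f = (x-1)(x^2+1) would otherwise give L_f(N) = 0 with undefined logarithm; if f has no positive integer root, L_f(N) is unchanged. -}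

module Defs where

open import Algebra.Bundles using (CommutativeRing; RawSemiring)
import Algebra.Definitions.RawSemiring as RawSemiringDefinitions
open import Data.Integer.Base as ℤ using (ℤ; +_; ∣_∣)
import Data.Integer.Properties as ℤ
open import Data.List.Base using (List; []; _∷_; map; foldr; filter; applyUpTo)
open import Data.Nat.Base as ℕ using (ℕ; zero; suc)
import Data.Nat.Properties as ℕ
open import Data.Nat.LCM using (lcm)
open import Data.Product.Base using (Σ-syntax; ∃-syntax; _×_; _,_)
open import Data.Rational.Base
  using (ℚ; 0ℚ; 1ℚ; _+_; _*_; _-_; -_; _/_; _<_; _≤_; NonNegative; Positive)
import Data.Rational.Properties as ℚ
import Data.Rational.Unnormalised.Base as ℚᵘ
import Data.Rational.Unnormalised.Properties as ℚᵘ
open import Level using (0ℓ)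
open import Relation.Binary.PropositionalEquality using (_≡_; refl; sym; trans; cong; cong₂; subst)
open import Relation.Nullary using (¬_)
open import Relation.Nullary.Decidable using (¬?)

-- A polynomial is its list of coefficients, constant term first.  Trailing
-- zeros are allowed, so equality is coefficientwise equality _≈ₚ_.

module Polynomial (R : CommutativeRing 0ℓ 0ℓ) where

  private module R = CommutativeRing R

  infix  4 _≈ₚ_
  infixl 6 _+ₚ_
  infixl 7 _*ₚ_

  Poly : Set
  Poly = List R.Carrier

  coeff : Poly → ℕ → R.Carrier
  coeff []      _       = R.0#
  coeff (a ∷ p) zero    = a
  coeff (a ∷ p) (suc i) = coeff p i

  _≈ₚ_ : Poly → Poly → Set
  p ≈ₚ q = ∀ i → coeff p i R.≈ coeff q i

  0ₚ : Poly
  0ₚ = []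

  1ₚ : Poly
  1ₚ = R.1# ∷ []

  _+ₚ_ : Poly → Poly → Poly
  []      +ₚ q       = q
  (a ∷ p) +ₚ []      = a ∷ p
  (a ∷ p) +ₚ (b ∷ q) = (a R.+ b) ∷ (p +ₚ q)

  -- (a + x p) q = a q + x (p q)
  _*ₚ_ : Poly → Poly → Poly
  []      *ₚ q = []
  (a ∷ p) *ₚ q = map (a R.*_) q +ₚ (R.0# ∷ (p *ₚ q))

  eval : Poly → R.Carrier → R.Carrier
  eval []      x = R.0#
  eval (a ∷ p) x = a R.+ x R.* eval p x

  -- The zero polynomial has no degree.
  HasDegree : Poly → ℕ → Set
  HasDegree p d = (¬ coeff p d R.≈ R.0#) × (∀ i → d ℕ.< i → coeff p i R.≈ R.0#)

  polyRawSemiring : RawSemiring 0ℓ 0ℓ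
  polyRawSemiring = record
    { Carrier = Poly
    ; _≈_     = _≈ₚ_
    ; _+_     = _+ₚ_
    ; _*_     = _*ₚ_
    ; 0#      = 0ₚ
    ; 1#      = 1ₚ
    }

  open RawSemiringDefinitions polyRawSemiring public using (_∣_; Irreducible)

module ℤ[x] = Polynomial ℤ.+-*-commutativeRing
module ℚ[x] = Polynomial ℚ.+-*-commutativeRing

toℚ[x] : ℤ[x].Poly → ℚ[x].Poly
toℚ[x] = map (λ a → a / 1)

-- Zero values are left out: a factor of degree ≥ 2 does not prevent f from
-- also having positive integer roots, and a single zero value would make the
-- lcm 0, whose logarithm is undefined.  If f has no positive integer root this
-- is exactly lcm { f(n) : n = 1, …, N }.

L : ℤ[x].Poly → ℕ → ℕ
L f N = foldr lcm 1 (filter (λ v → ¬? (v ℕ.≟ 0)) (applyUpTo (λ i → ∣ ℤ[x].eval f (+ suc i) ∣) N))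

-- A real number x is given by its open lower cut { r ∈ ℚ : r < x }.

record ℝ : Set₁ where
  field
    Below     : ℚ → Set
    inhabited : ∃[ r ] Below r
    bounded   : ∃[ b ] (∀ r → Below r → r < b)
    downward  : ∀ {r s} → r < s → Below s → Below r
    rounded   : ∀ {r} → Below r → ∃[ s ] (r < s × Below s)

open ℝ public

private
  p-1<p : ∀ p → p - 1ℚ < p
  p-1<p p = subst (p - 1ℚ <_) (ℚ.+-identityʳ p) (ℚ.+-monoʳ-< p (ℚ.negative⁻¹ (- 1ℚ)))

infix  4 _≤ᴿ_ _≪_
infixl 7 _·_

_≤ᴿ_ : ℝ → ℝ → Set
x ≤ᴿ y = ∀ r → Below x r → Below y r

-- r < c x iff r < c s for some rational s < x; this is also right for c = 0,
-- where the condition reads r < 0.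

_·_ : (c : ℚ) .{{_ : NonNegative c}} → ℝ → ℝ
c · x = record
  { Below     = λ r → ∃[ s ] (Below x s × r < c * s)
  ; inhabited = let s , s<x = inhabited x in c * s - 1ℚ , s , s<x , p-1<p (c * s)
  ; bounded   = let b , x<b = bounded x in
      c * b , λ { r (s , s<x , r<cs) →
        ℚ.<-≤-trans r<cs (ℚ.*-monoˡ-≤-nonNeg c (ℚ.<⇒≤ (x<b s s<x))) }
  ; downward  = λ { r<t (s , s<x , t<cs) → s , s<x , ℚ.<-trans r<t t<cs }
  ; rounded   = λ { (s , s<x , r<cs) →
      let t , r<t , t<cs = ℚ.<-dense r<cs in t , r<t , s , s<x , t<cs }
  }

-- reciprocals m k = 1/(m+1) + 1/(m+2) + ⋯ + 1/(m+k)

reciprocals : ℕ → ℕ → ℚ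
reciprocals m zero    = 0ℚ
reciprocals m (suc k) = reciprocals m k + + 1 / suc (m ℕ.+ k)

-- The lower Riemann sum of ∫₁ⁿ dt/t with mesh 1/m, where m = suc m′:
-- Σ_{1 ≤ i ≤ m(n-1)} (1/m) · 1/(1 + i/m).

lowerSum : ℕ → ℕ → ℚ
lowerSum n m′ = reciprocals (suc m′) (suc m′ ℕ.* (n ℕ.∸ 1))

private

  reciprocals≤ : ∀ m′ k → reciprocals (suc m′) k ≤ + k / suc m′
  reciprocals≤ m′ zero    = ℚ.≤-reflexive (sym (ℚ.fromℚᵘ-cong {ℚᵘ.mkℚᵘ (+ 0) m′} {ℚᵘ.0ℚᵘ} (ℚᵘ.*≡* refl)))
  reciprocals≤ m′ (suc k) = ℚ.≤-trans (ℚ.+-mono-≤ (reciprocals≤ m′ k) term≤) (ℚ.≤-reflexive add)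
    where
    term≤ : + 1 / suc (suc m′ ℕ.+ k) ≤ + 1 / suc m′
    term≤ = ℚ.toℚᵘ-cancel-≤
      (ℚᵘ.≤-respʳ-≃ (ℚᵘ.≃-sym (ℚ.toℚᵘ-fromℚᵘ (ℚᵘ.mkℚᵘ (+ 1) m′)))
      (ℚᵘ.≤-respˡ-≃ (ℚᵘ.≃-sym (ℚ.toℚᵘ-fromℚᵘ (ℚᵘ.mkℚᵘ (+ 1) (suc m′ ℕ.+ k))))
      (ℚᵘ.*≤* (ℤ.*-monoˡ-≤-nonNeg (+ 1) (ℤ.+≤+ (ℕ.m≤n⇒m≤1+n (ℕ.m≤m+n (suc m′) k)))))))

    addᵘ : ℚᵘ.mkℚᵘ (+ k) m′ ℚᵘ.+ ℚᵘ.mkℚᵘ (+ 1) m′ ℚᵘ.≃ ℚᵘ.mkℚᵘ (+ suc k) m′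
    addᵘ = ℚᵘ.*≡* (trans (cong (ℤ._* s) (sym (ℤ.*-distribʳ-+ s (+ k) (+ 1))))
             (trans (ℤ.*-assoc (+ k ℤ.+ + 1) s s)
               (cong₂ ℤ._*_ (cong +_ (ℕ.+-comm k 1)) (sym (ℤ.pos-* (suc m′) (suc m′))))))
      where s = + suc m′

    add : + k / suc m′ + + 1 / suc m′ ≡ + suc k / suc m′
    add = ℚ.toℚᵘ-injective
      (ℚᵘ.≃-trans (ℚ.toℚᵘ-homo-+ (+ k / suc m′) (+ 1 / suc m′))
      (ℚᵘ.≃-trans (ℚᵘ.+-cong (ℚ.toℚᵘ-fromℚᵘ (ℚᵘ.mkℚᵘ (+ k) m′)) (ℚ.toℚᵘ-fromℚᵘ (ℚᵘ.mkℚᵘ (+ 1) m′)))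
      (ℚᵘ.≃-trans addᵘ (ℚᵘ.≃-sym (ℚ.toℚᵘ-fromℚᵘ (ℚᵘ.mkℚᵘ (+ suc k) m′))))))

  lowerSum≤ : ∀ n m′ → lowerSum n m′ ≤ + (n ℕ.∸ 1) / 1
  lowerSum≤ n m′ = ℚ.≤-trans (reciprocals≤ m′ (suc m′ ℕ.* (n ℕ.∸ 1)))
    (ℚ.≤-reflexive (ℚ.fromℚᵘ-cong {ℚᵘ.mkℚᵘ (+ (suc m′ ℕ.* (n ℕ.∸ 1))) m′} {ℚᵘ.mkℚᵘ (+ (n ℕ.∸ 1)) 0}
      (ℚᵘ.*≡* (trans (ℤ.*-identityʳ _)
        (trans (ℤ.pos-* (suc m′) (n ℕ.∸ 1)) (ℤ.*-comm (+ suc m′) (+ (n ℕ.∸ 1))))))))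

-- The natural logarithm log n = ∫₁ⁿ dt/t of an integer n ≥ 1, as the supremum
-- of the lower Riemann sums (log 0 takes the junk value 0).

log : ℕ → ℝ
log n = record
  { Below     = λ r → ∃[ m ] (r < lowerSum n m)
  ; inhabited = lowerSum n 0 - 1ℚ , 0 , p-1<p (lowerSum n 0)
  ; bounded   = + (n ℕ.∸ 1) / 1 , λ { r (m , r<) → ℚ.<-≤-trans r< (lowerSum≤ n m) }
  ; downward  = λ { r<s (m , s<) → m , ℚ.<-trans r<s s< }
  ; rounded   = λ { (m , r<) → let s , r<s , s< = ℚ.<-dense r< in s , r<s , m , s< }
  }

NlogN : ℕ → ℝ
NlogN N = _·_ (+ N / 1) {{ℚ.normalize-nonNeg N 1}} (log N)

-- Since the rationals are dense, it makes no difference that the implied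
-- constant is taken to be rational.

_≪_ : (ℕ → ℝ) → (ℕ → ℝ) → Set
A ≪ B = Σ[ C ∈ ℚ ] Σ[ C>0 ∈ Positive C ] ∃[ N₀ ] (∀ N → N₀ ℕ.≤ N →
  A N ≤ᴿ _·_ C {{ℚ.pos⇒nonNeg C {{C>0}}}} (B N))

-- Let g be the irreducible factor, with integer coefficients and of degree d.  The product of the
-- |g(n)| for n ≤ N is about N ^ (d N), and what a prime p > N contributes to it is at most d times
-- what p contributes to the lcm, as g has at most d roots mod p ^ k.  So it suffices that the primes
-- p ≤ N contribute at most (d − δ) N log N to the logarithm of the product, that is, that
-- Σ ρ(p) log p / p ≤ (d − δ) log N, with ρ(p) the number of roots of g mod p.  The prime ideal theorem
-- is avoided as follows.  The form F(u, v) = v ^ d g(u / v) has no nontrivial zero, because d ≥ 2.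
-- Take the points (x, y) of an M × M box with M² of order N.  For every root r of g mod p,
-- Cauchy–Schwarz gives M⁴ / p pairs of points with x − r y ≡ x′ − r y′ mod p, and then p divides
-- F(x − x′, y − y′).  The product of these values over all pairs is at most (B M ^ d) ^ (M⁴), so
-- Σ ρ(p) log p / p ≤ d log M + O(1) = (d / 2) log N + O(1).

module Submission where

open import Defs
open import Data.List.Base using ([]; _∷_; length; map; List; filter; foldr; applyUpTo)
open import Data.List.Membership.Propositional using (_∈_)
open import Data.List.Membership.Propositional.Properties using (∈-applyUpTo⁺; ∈-applyUpTo⁻)
open import Data.List.Properties using (length-map; map-∘; map-cong; map-id; length-applyUpTo)
open import Data.List.Relation.Unary.All as All using (All; []; _∷_)
import Data.List.Relation.Unary.All.Properties as All
open import Data.List.Relation.Unary.AllPairs as AllPairs using (AllPairs; []; _∷_)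
import Data.List.Relation.Unary.AllPairs.Properties as AllPairs
open import Data.List.Relation.Unary.Any using (here; there)
open import Data.Nat.Primality using (Prime; euclidsLemma; prime⇒nonTrivial; prime⇒nonZero)
open import Data.Product.Base using (_×_; _,_; Σ-syntax; ∃-syntax; proj₁; proj₂)
open import Data.Sum.Base using (inj₁; inj₂; _⊎_)
open import Level using (0ℓ)
open import Relation.Binary.PropositionalEquality using (_≡_; refl; sym; trans; cong; cong₂; subst; subst₂; _≢_; module ≡-Reasoning)
open import Relation.Nullary.Decidable using (Dec; yes; no; does; _×-dec_; from-yes; ¬?)
open import Relation.Nullary.Negation using (¬_; contradiction)

-- The losses of the box argument must stay below the factor 2 that it gains. Rounding `N / p` up
-- costs 5/4 if `4 * p ≤ N`, and the diagonal pairs cost 36/35 if `9 * N ≤ M * M`; the product is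
-- 9/7, so the primes up to N / 4 take at most 9/14 of d N log N, up to lower order. A prime above N
-- / 4 divides at most 4 d values, so the lcm pays for it. The powers p ^ k with k ≥ 2 cost about 2
-- d N Σ 1 / p² beyond what the lcm pays, which is small only if the primes up to some b are
-- missing. So g is replaced by h (x) = g (q x) / g (0), whose values no prime up to b divides; b is
-- also taken beyond the primes that divide the leading coefficient or a substitute for the
-- discriminant. In the end N is rescaled by q. Logarithms enter only at the end. The local
-- inequality, cleared of denominators, holds at every prime, so it is a divisibility P ^ m ∣ W ^ (9
-- N) · E ^ m · L ^ (5 d m), where P is the product of the values of h, W that of the forms over all
-- pairs, and E the allowance for higher powers. Comparing sizes gives N ^ N ≤ L ^ C.

-- Finite sums, products and counts.

module Sums where

  open import Data.Bool.Base using (if_then_else_)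
  open import Data.Nat.Base
  open import Data.Nat.Divisibility using (_∣_; ∣-trans; n∣m*n; m∣m*n)
  open import Data.Nat.DivMod using (_/_; _%_; m≡m%n+[m/n]*n; m%n<n)
  open import Data.Nat.Properties
  open import Data.Nat.Tactic.RingSolver using (solve-∀)

  Σ< : ℕ → (ℕ → ℕ) → ℕ
  Σ< zero    f = 0
  Σ< (suc n) f = Σ< n f + f n

  Π< : ℕ → (ℕ → ℕ) → ℕ
  Π< zero    f = 1
  Π< (suc n) f = Π< n f * f n

  ⟦_⟧ : ∀ {P : Set} → Dec P → ℕ
  ⟦ d ⟧ = if does d then 1 else 0

  ⟦⟧-yes : ∀ {P : Set} (d : Dec P) → P → ⟦ d ⟧ ≡ 1
  ⟦⟧-yes (yes _) _ = refl
  ⟦⟧-yes (no ¬p) p = contradiction p ¬p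

  ⟦⟧-no : ∀ {P : Set} (d : Dec P) → ¬ P → ⟦ d ⟧ ≡ 0
  ⟦⟧-no (yes p) ¬p = contradiction p ¬p
  ⟦⟧-no (no _)  _  = refl

  ⟦⟧≤1 : ∀ {P : Set} (d : Dec P) → ⟦ d ⟧ ≤ 1
  ⟦⟧≤1 (yes _) = ≤-refl
  ⟦⟧≤1 (no _)  = z≤n

  ⟦⟧-mono : ∀ {P Q : Set} (d : Dec P) (e : Dec Q) → (P → Q) → ⟦ d ⟧ ≤ ⟦ e ⟧
  ⟦⟧-mono (yes p) e f = ≤-reflexive (sym (⟦⟧-yes e (f p)))
  ⟦⟧-mono (no _)  e f = z≤n

  ⟦⟧-cong : ∀ {P Q : Set} (d : Dec P) (e : Dec Q) → (P → Q) → (Q → P) → ⟦ d ⟧ ≡ ⟦ e ⟧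
  ⟦⟧-cong d e f g = ≤-antisym (⟦⟧-mono d e f) (⟦⟧-mono e d g)

  Σ-cong : ∀ n {f g} → (∀ i → i < n → f i ≡ g i) → Σ< n f ≡ Σ< n g
  Σ-cong zero    h = refl
  Σ-cong (suc n) h = cong₂ _+_ (Σ-cong n (λ i i<n → h i (m<n⇒m<1+n i<n))) (h n ≤-refl)

  Σ-mono : ∀ n {f g} → (∀ i → i < n → f i ≤ g i) → Σ< n f ≤ Σ< n g
  Σ-mono zero    h = z≤n
  Σ-mono (suc n) h = +-mono-≤ (Σ-mono n (λ i i<n → h i (m<n⇒m<1+n i<n))) (h n ≤-refl)

  Σ-+ : ∀ n f g → Σ< n (λ i → f i + g i) ≡ Σ< n f + Σ< n g
  Σ-+ zero    f g = refl
  Σ-+ (suc n) f g rewrite Σ-+ n f g = lemma (Σ< n f) (Σ< n g) (f n) (g n)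
    where
    lemma : ∀ a b c d → a + b + (c + d) ≡ a + c + (b + d)
    lemma = solve-∀

  Σ-*ˡ : ∀ n c f → Σ< n (λ i → c * f i) ≡ c * Σ< n f
  Σ-*ˡ zero    c f = sym (*-zeroʳ c)
  Σ-*ˡ (suc n) c f rewrite Σ-*ˡ n c f = sym (*-distribˡ-+ c (Σ< n f) (f n))

  Σ-const : ∀ n c → Σ< n (λ _ → c) ≡ n * c
  Σ-const zero    c = refl
  Σ-const (suc n) c rewrite Σ-const n c = +-comm (n * c) c

  Σ-zero : ∀ n {f} → (∀ i → i < n → f i ≡ 0) → Σ< n f ≡ 0
  Σ-zero n h = trans (Σ-cong n h) (trans (Σ-const n 0) (*-zeroʳ n))

  Σ-swap : ∀ m n (f : ℕ → ℕ → ℕ) → Σ< m (λ i → Σ< n (f i)) ≡ Σ< n (λ j → Σ< m (λ i → f i j))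
  Σ-swap zero    n f = sym (Σ-zero n (λ _ _ → refl))
  Σ-swap (suc m) n f rewrite Σ-swap m n f = sym (Σ-+ n (λ j → Σ< m (λ i → f i j)) (f m))

  Σ-split : ∀ m n f → Σ< (m + n) f ≡ Σ< m f + Σ< n (λ i → f (m + i))
  Σ-split m zero    f rewrite +-identityʳ m = sym (+-identityʳ _)
  Σ-split m (suc n) f rewrite +-suc m n | Σ-split m n f = +-assoc (Σ< m f) _ _

  Σ-head : ∀ n f → Σ< (suc n) f ≡ f 0 + Σ< n (λ i → f (suc i))
  Σ-head n f = Σ-split 1 n f

  Σ-term : ∀ n f i → i < n → f i ≤ Σ< n f
  Σ-term (suc n) f i i<1+n with m≤n⇒m<n∨m≡n (s≤s⁻¹ i<1+n)
  ... | inj₁ i<n  = ≤-trans (Σ-term n f i i<n) (m≤m+n _ (f n))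
  ... | inj₂ refl = m≤n+m (f n) _

  Σ-monoˡ : ∀ {m n} f → m ≤ n → Σ< m f ≤ Σ< n f
  Σ-monoˡ {m} {n} f m≤n = subst (λ n → Σ< m f ≤ Σ< n f) (m+[n∸m]≡n m≤n)
    (subst (Σ< m f ≤_) (sym (Σ-split m (n ∸ m) f)) (m≤m+n _ _))

  Σ-delta : ∀ n k (g : ℕ → ℕ) → k < n → Σ< n (λ c → ⟦ k ≟ c ⟧ * g c) ≡ g k
  Σ-delta (suc n) k g k<1+n with m≤n⇒m<n∨m≡n (s≤s⁻¹ k<1+n)
  ... | inj₁ k<n rewrite Σ-delta n k g k<n | ⟦⟧-no (k ≟ n) (<⇒≢ k<n) = +-identityʳ (g k)
  ... | inj₂ refl rewrite Σ-zero n {λ c → ⟦ k ≟ c ⟧ * g c} (λ c c<n → cong (_* g c) (⟦⟧-no (k ≟ c) (>⇒≢ c<n)))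
                        | ⟦⟧-yes (k ≟ k) refl = +-identityʳ (g k)

  Π-nonZero : ∀ n {f} → (∀ i → i < n → NonZero (f i)) → NonZero (Π< n f)
  Π-nonZero zero    h = _
  Π-nonZero (suc n) h = m*n≢0 _ _ {{Π-nonZero n (λ i i<n → h i (m<n⇒m<1+n i<n))}} {{h n ≤-refl}}

  Π-mono : ∀ n {f g} → (∀ i → i < n → f i ≤ g i) → Π< n f ≤ Π< n g
  Π-mono zero    h = ≤-refl
  Π-mono (suc n) h = *-mono-≤ (Π-mono n (λ i i<n → h i (m<n⇒m<1+n i<n))) (h n ≤-refl)

  Π-const : ∀ n c → Π< n (λ _ → c) ≡ c ^ n
  Π-const zero    c = refl
  Π-const (suc n) c rewrite Π-const n c = *-comm (c ^ n) c

  Π-≤ : ∀ n {f} B → (∀ i → i < n → f i ≤ B) → Π< n f ≤ B ^ n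
  Π-≤ n B h = ≤-trans (Π-mono n h) (≤-reflexive (Π-const n B))

  Π-* : ∀ n f g → Π< n (λ i → f i * g i) ≡ Π< n f * Π< n g
  Π-* zero    f g = refl
  Π-* (suc n) f g rewrite Π-* n f g = lemma (Π< n f) (Π< n g) (f n) (g n)
    where
    lemma : ∀ a b c d → a * b * (c * d) ≡ a * c * (b * d)
    lemma = solve-∀

  Π-^ : ∀ n f k → Π< n (λ i → f i ^ k) ≡ Π< n f ^ k
  Π-^ n f zero    = trans (Π-const n 1) (^-zeroˡ n)
  Π-^ n f (suc k) = trans (Π-* n f (λ i → f i ^ k)) (cong (Π< n f *_) (Π-^ n f k))

  Π-exponent : ∀ n b e → Π< n (λ i → b ^ e i) ≡ b ^ Σ< n e
  Π-exponent zero    b e = refl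
  Π-exponent (suc n) b e rewrite Π-exponent n b e = sym (^-distribˡ-+-* b (Σ< n e) (e n))

  ∣Π : ∀ n f i → i < n → f i ∣ Π< n f
  ∣Π (suc n) f i i<1+n with m≤n⇒m<n∨m≡n (s≤s⁻¹ i<1+n)
  ... | inj₁ i<n  = ∣-trans (∣Π n f i i<n) (m∣m*n (f n))
  ... | inj₂ refl = n∣m*n (Π< n f)

  elements : ∀ n {P : ℕ → Set} (P? : ∀ i → Dec (P i)) →
    ∃[ xs ] (length xs ≡ Σ< n (λ i → ⟦ P? i ⟧) × All P xs × All (_< n) xs × AllPairs _>_ xs)
  elements zero    P? = [] , refl , [] , [] , []
  elements (suc n) P? with elements n P? | P? n
  ... | xs , len , ps , <n , ord | yes p =
    n ∷ xs , trans (cong suc len) (+-comm 1 _) , p ∷ ps , ≤-refl ∷ All.map m<n⇒m<1+n <n , <n ∷ ord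
  ... | xs , len , ps , <n , ord | no _  =
    xs , trans len (sym (+-identityʳ _)) , ps , All.map m<n⇒m<1+n <n , ord

  -- Counting is passed to lists because the bound on the number of roots is an induction on a list
  -- of distinct roots; the descending order records the distinctness.
  count≤ : ∀ n {P : ℕ → Set} (P? : ∀ i → Dec (P i)) c →
    (∀ xs → All P xs → All (_< n) xs → AllPairs _>_ xs → length xs ≤ c) →
    Σ< n (λ i → ⟦ P? i ⟧) ≤ c
  count≤ n P? c h with elements n P?
  ... | xs , len , ps , <n , ord = subst (_≤ c) len (h xs ps <n ord)

  -- The last window may be incomplete; it accounts for the extra `c`.
  Σ-windows : ∀ s .{{_ : NonZero s}} c f → (∀ a → Σ< s (λ i → f (a + i)) ≤ c) →
    ∀ n → Σ< n f ≤ c * (n / s) + c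
  Σ-windows s c f h n = begin
    Σ< n f                              ≡⟨ cong (λ n → Σ< n f) (trans (m≡m%n+[m/n]*n n s) (+-comm (n % s) _)) ⟩
    Σ< (n / s * s + n % s) f            ≡⟨ Σ-split (n / s * s) (n % s) f ⟩
    Σ< (n / s * s) f + Σ< (n % s) (λ i → f (n / s * s + i))
      ≤⟨ +-mono-≤ (blocks (n / s)) (≤-trans (Σ-monoˡ (λ i → f (n / s * s + i)) (<⇒≤ (m%n<n n s))) (h (n / s * s))) ⟩
    c * (n / s) + c ∎
    where
    open ≤-Reasoning
    blocks : ∀ q → Σ< (q * s) f ≤ c * q
    blocks zero    = z≤n
    blocks (suc q) = begin
      Σ< (s + q * s) f                           ≡⟨ cong (λ n → Σ< n f) (+-comm s (q * s)) ⟩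
      Σ< (q * s + s) f                           ≡⟨ Σ-split (q * s) s f ⟩
      Σ< (q * s) f + Σ< s (λ i → f (q * s + i))  ≤⟨ +-mono-≤ (blocks q) (h (q * s)) ⟩
      c * q + c                                  ≡⟨ trans (+-comm (c * q) c) (sym (*-suc c q)) ⟩
      c * suc q ∎

  Σ-periodic : ∀ s f → (∀ i → f (i + s) ≡ f i) → ∀ a → Σ< s (λ i → f (a + i)) ≡ Σ< s f
  Σ-periodic s f per zero    = refl
  Σ-periodic s f per (suc a) = trans (+-cancelˡ-≡ (f a) _ _ shift) (Σ-periodic s f per a)
    where
    g : ℕ → ℕ
    g i = f (a + i)
    shift : f a + Σ< s (λ i → f (suc a + i)) ≡ f a + Σ< s (λ i → f (a + i))
    shift = begin
      f a + Σ< s (λ i → f (suc (a + i)))      ≡⟨ cong₂ _+_ (cong f (sym (+-identityʳ a))) (Σ-cong s (λ i _ → cong f (sym (+-suc a i)))) ⟩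
      g 0 + Σ< s (λ i → g (suc i))            ≡⟨ Σ-head s g ⟨
      Σ< s g + f (a + s)                      ≡⟨ cong (Σ< s g +_) (per a) ⟩
      Σ< s g + f a                            ≡⟨ +-comm (Σ< s g) (f a) ⟩
      f a + Σ< s g ∎
      where open ≡-Reasoning

  2ab≤a²+b² : ∀ a b → 2 * (a * b) ≤ a * a + b * b
  2ab≤a²+b² a b with ≤-total a b
  ... | inj₁ a≤b = subst (λ b → 2 * (a * b) ≤ a * a + b * b) (m+[n∸m]≡n a≤b)
                     (subst (2 * (a * (a + k)) ≤_) (lemma a k) (m≤m+n _ (k * k)))
    where
    k = b ∸ a
    lemma : ∀ a k → 2 * (a * (a + k)) + k * k ≡ a * a + (a + k) * (a + k)
    lemma = solve-∀
  ... | inj₂ b≤a = subst (λ a → 2 * (a * b) ≤ a * a + b * b) (m+[n∸m]≡n b≤a)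
                     (subst (2 * ((b + k) * b) ≤_) (lemma b k) (m≤m+n _ (k * k)))
    where
    k = a ∸ b
    lemma : ∀ b k → 2 * ((b + k) * b) + k * k ≡ (b + k) * (b + k) + b * b
    lemma = solve-∀

  -- Cauchy–Schwarz for the sizes of the classes of κ.
  n²≤p*coincidences : ∀ n p .{{_ : NonZero p}} (κ : ℕ → ℕ) → (∀ i → κ i < p) →
    n * n ≤ p * Σ< n (λ i → Σ< n (λ j → ⟦ κ j ≟ κ i ⟧))
  n²≤p*coincidences n p κ κ<p = *-cancelˡ-≤ p (+-cancelʳ-≤ (p * (n * n)) _ _ (begin
    p * (n * n) + p * (n * n)                              ≡⟨ rearrange p n ⟩
    2 * (n * p) * n                                        ≡⟨ cong (2 * (n * p) *_) total ⟩
    2 * (n * p) * Σ< p s                                   ≡⟨ Σ-*ˡ p (2 * (n * p)) s ⟨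
    Σ< p (λ c → 2 * (n * p) * s c)                         ≤⟨ Σ-mono p (λ c _ → amgm (s c)) ⟩
    Σ< p (λ c → p * p * (s c * s c) + n * n)               ≡⟨ Σ-+ p (λ c → p * p * (s c * s c)) (λ _ → n * n) ⟩
    Σ< p (λ c → p * p * (s c * s c)) + Σ< p (λ _ → n * n)  ≡⟨ cong₂ _+_ (Σ-*ˡ p (p * p) (λ c → s c * s c)) (Σ-const p (n * n)) ⟩
    p * p * Σ< p (λ c → s c * s c) + p * (n * n)           ≡⟨ cong (λ x → p * p * x + p * (n * n)) squares ⟨
    p * p * coincidences + p * (n * n)                     ≡⟨ cong (_+ p * (n * n)) (*-assoc p p coincidences) ⟩
    p * (p * coincidences) + p * (n * n) ∎))
    where
    open ≤-Reasoning
    coincidences = Σ< n (λ i → Σ< n (λ j → ⟦ κ j ≟ κ i ⟧))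
    s : ℕ → ℕ
    s c = Σ< n (λ j → ⟦ κ j ≟ c ⟧)
    byClass : ∀ (g : ℕ → ℕ) → Σ< n (λ i → g (κ i)) ≡ Σ< p (λ c → g c * s c)
    byClass g = trans (Σ-cong n (λ i _ → sym (Σ-delta p (κ i) g (κ<p i))))
      (trans (Σ-swap n p _)
        (Σ-cong p (λ c _ → trans (Σ-cong n (λ i _ → *-comm ⟦ κ i ≟ c ⟧ (g c))) (Σ-*ˡ n (g c) (λ j → ⟦ κ j ≟ c ⟧)))))
    squares : coincidences ≡ Σ< p (λ c → s c * s c)
    squares = byClass s
    total : n ≡ Σ< p s
    total = trans (sym (trans (Σ-const n 1) (*-identityʳ n)))
      (trans (byClass (λ _ → 1)) (Σ-cong p (λ c _ → +-identityʳ (s c))))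
    rearrange : ∀ p n → p * (n * n) + p * (n * n) ≡ 2 * (n * p) * n
    rearrange = solve-∀
    -- This is (p x - n)² ≥ 0, centred at the mean size n / p of a class. Summed over the p classes
    -- it gives the bound of Cauchy-Schwarz without the square of a sum.
    amgm : ∀ x → 2 * (n * p) * x ≤ p * p * (x * x) + n * n
    amgm x = begin
      2 * (n * p) * x               ≡⟨ e₁ n p x ⟩
      2 * ((p * x) * n)             ≤⟨ 2ab≤a²+b² (p * x) n ⟩
      (p * x) * (p * x) + n * n     ≡⟨ e₂ n p x ⟩
      p * p * (x * x) + n * n ∎
      where
      e₁ : ∀ n p x → 2 * (n * p) * x ≡ 2 * ((p * x) * n)
      e₁ = solve-∀
      e₂ : ∀ n p x → (p * x) * (p * x) + n * n ≡ p * p * (x * x) + n * n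
      e₂ = solve-∀

-- Valuations at a prime.

module Valuation where

  open import Data.Nat.Base
  open import Data.Nat.Divisibility
  open import Data.Nat.Induction using (<-rec)
  open import Data.Nat.Primality.Factorisation using (factorise)
  open import Data.Nat.Properties
  open import Data.Nat.Tactic.RingSolver using (solve-∀)
  open Sums

  opaque
    -- Encoded as the number of k ≥ 1 with p ^ k ∣ a, so that summing over values and exchanging the
    -- sums counts roots modulo each power. The range is long enough since a < p ^ a.
    v : ℕ → ℕ → ℕ
    v p a = Σ< a (λ k → ⟦ p ^ suc k ∣? a ⟧)

  prime>1 : ∀ {p} → Prime p → 1 < p
  prime>1 {p} pp = nonTrivial⇒n>1 p {{prime⇒nonTrivial pp}}

  n<p^n : ∀ {p} → 1 < p → ∀ n → n < p ^ n
  n<p^n 1<p zero    = ≤-refl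
  n<p^n {p} 1<p (suc n) = begin-strict
    suc n      ≤⟨ n<p^n 1<p n ⟩
    p ^ n      ≡⟨ *-identityˡ _ ⟨
    1 * p ^ n  <⟨ *-monoˡ-< (p ^ n) {{m^n≢0 p n {{>-nonZero (<-trans z<s 1<p)}}}} 1<p ⟩
    p * p ^ n ∎
    where open ≤-Reasoning

  decompose : ∀ {p} → 1 < p → ∀ a .{{_ : NonZero a}} → ∃[ e ] ∃[ b ] (a ≡ p ^ e * b × ¬ p ∣ b)
  decompose {p} 1<p a = <-rec (λ a → .{{NonZero a}} → ∃[ e ] ∃[ b ] (a ≡ p ^ e * b × ¬ p ∣ b)) step a
    where
    step : ∀ a → (∀ {a′} → a′ < a → .{{NonZero a′}} → ∃[ e ] ∃[ b ] (a′ ≡ p ^ e * b × ¬ p ∣ b)) →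
      .{{NonZero a}} → ∃[ e ] ∃[ b ] (a ≡ p ^ e * b × ¬ p ∣ b)
    step a rec with p ∣? a
    ... | no p∤a = 0 , a , sym (+-identityʳ a) , p∤a
    ... | yes p∣a =
      let instance
            q≢0 : NonZero (quotient p∣a)
            q≢0 = quotient≢0 p∣a
          e , b , q≡ , p∤b = rec (quotient-< p∣a {{n>1⇒nonTrivial 1<p}})
      in suc e , b , trans (_∣_.equality p∣a) (trans (*-comm (quotient p∣a) p) (trans (cong (p *_) q≡) (sym (*-assoc p (p ^ e) b)))) , p∤b

  p^suc-k∤ : ∀ {p b} → 1 < p → ¬ p ∣ b → ∀ {e k} → e ≤ k → ¬ p ^ suc k ∣ p ^ e * b
  p^suc-k∤ {p} {b} 1<p p∤b {e} {k} e≤k pᵏ∣ = p∤b (∣-trans (m∣m*n (p ^ (k ∸ e))) (*-cancelˡ-∣ (p ^ e) {{p^e≢0}}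
    (subst (_∣ p ^ e * b) (trans (cong (p ^_) (trans (cong suc (sym (m+[n∸m]≡n e≤k))) (sym (+-suc e (k ∸ e))))) (^-distribˡ-+-* p e (suc (k ∸ e)))) pᵏ∣)))
    where
    p^e≢0 : NonZero (p ^ e)
    p^e≢0 = m^n≢0 p e {{>-nonZero (<-trans z<s 1<p)}}

  p^k∣p^e*b : ∀ p b {k e} → k ≤ e → p ^ k ∣ p ^ e * b
  p^k∣p^e*b p b {k} {e} k≤e = subst (λ x → p ^ k ∣ x * b)
    (trans (sym (^-distribˡ-+-* p k (e ∸ k))) (cong (p ^_) (m+[n∸m]≡n k≤e))) (∣-trans (m∣m*n (p ^ (e ∸ k))) (m∣m*n b))

  count-powers : ∀ {p b} → 1 < p → ¬ p ∣ b → ∀ {e K} → e ≤ K → Σ< K (λ k → ⟦ p ^ suc k ∣? p ^ e * b ⟧) ≡ e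
  count-powers {p} {b} 1<p p∤b {e} {K} e≤K = begin
    Σ< K f                                    ≡⟨ cong (λ K → Σ< K f) (m+[n∸m]≡n e≤K) ⟨
    Σ< (e + (K ∸ e)) f                        ≡⟨ Σ-split e (K ∸ e) f ⟩
    Σ< e f + Σ< (K ∸ e) (λ i → f (e + i))     ≡⟨ cong₂ _+_
      (trans (Σ-cong e (λ i i<e → ⟦⟧-yes (p ^ suc i ∣? p ^ e * b) (p^k∣p^e*b p b i<e))) (trans (Σ-const e 1) (*-identityʳ e)))
      (Σ-zero (K ∸ e) (λ i _ → ⟦⟧-no (p ^ suc (e + i) ∣? p ^ e * b) (p^suc-k∤ 1<p p∤b (m≤m+n e i)))) ⟩
    e + 0                                     ≡⟨ +-identityʳ e ⟩
    e ∎
    where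
    open ≡-Reasoning
    f : ℕ → ℕ
    f k = ⟦ p ^ suc k ∣? p ^ e * b ⟧

  ∤⇒nonZero : ∀ {p b} → ¬ p ∣ b → NonZero b
  ∤⇒nonZero {p} {zero}  p∤0 = contradiction (p ∣0) p∤0
  ∤⇒nonZero {p} {suc _} _   = _

  e≤p^e*b : ∀ {p b} → 1 < p → ¬ p ∣ b → ∀ e → e ≤ p ^ e * b
  e≤p^e*b {p} {b} 1<p p∤b e = ≤-trans (<⇒≤ (n<p^n 1<p e)) (m≤m*n (p ^ e) b {{∤⇒nonZero p∤b}})

  opaque
    unfolding v

    v-exact : ∀ {p b} → 1 < p → ¬ p ∣ b → ∀ e → v p (p ^ e * b) ≡ e
    v-exact 1<p p∤b e = count-powers 1<p p∤b (e≤p^e*b 1<p p∤b e)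

  -- Beyond `a` no power counts, so one range can serve several numbers; this is needed before sums
  -- over values and over powers can be exchanged.
  v-count : ∀ {p} → 1 < p → ∀ a .{{_ : NonZero a}} {K} → a ≤ K → Σ< K (λ k → ⟦ p ^ suc k ∣? a ⟧) ≡ v p a
  v-count 1<p a a≤K with decompose 1<p a
  ... | e , b , refl , p∤b = trans (count-powers 1<p p∤b (≤-trans (e≤p^e*b 1<p p∤b e) a≤K)) (sym (v-exact 1<p p∤b e))

  ∣⇒≤v : ∀ {p} → 1 < p → ∀ k a .{{_ : NonZero a}} → p ^ k ∣ a → k ≤ v p a
  ∣⇒≤v {p} 1<p k a pᵏ∣a with decompose 1<p a
  ... | e , b , refl , p∤b = subst (k ≤_) (sym (v-exact 1<p p∤b e)) (k≤e k pᵏ∣a)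
    where
    k≤e : ∀ k → p ^ k ∣ p ^ e * b → k ≤ e
    k≤e zero    _    = z≤n
    k≤e (suc k) pᵏ∣ = ≰⇒> (λ e≤k → p^suc-k∤ 1<p p∤b e≤k pᵏ∣)

  ∤⇒v≡0 : ∀ {p a} → 1 < p → ¬ p ∣ a → v p a ≡ 0
  ∤⇒v≡0 {p} {a} 1<p p∤a = subst (λ a → v p a ≡ 0) (*-identityˡ a) (v-exact 1<p p∤a 0)

  v-* : ∀ {p} → Prime p → ∀ a b .{{_ : NonZero a}} .{{_ : NonZero b}} → v p (a * b) ≡ v p a + v p b
  v-* {p} pp a b with decompose (prime>1 pp) a | decompose (prime>1 pp) b
  ... | d , x , refl , p∤x | e , y , refl , p∤y = begin
    v p (p ^ d * x * (p ^ e * y))    ≡⟨ cong (v p) (trans (rearrange (p ^ d) x (p ^ e) y) (cong (_* (x * y)) (sym (^-distribˡ-+-* p d e)))) ⟩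
    v p (p ^ (d + e) * (x * y))      ≡⟨ v-exact 1<p p∤xy (d + e) ⟩
    d + e                            ≡⟨ cong₂ _+_ (v-exact 1<p p∤x d) (v-exact 1<p p∤y e) ⟨
    v p (p ^ d * x) + v p (p ^ e * y) ∎
    where
    open ≡-Reasoning
    1<p = prime>1 pp
    rearrange : ∀ a b c d → a * b * (c * d) ≡ a * c * (b * d)
    rearrange = solve-∀
    p∤xy : ¬ p ∣ x * y
    p∤xy p∣xy with euclidsLemma x y pp p∣xy
    ... | inj₁ p∣x = p∤x p∣x
    ... | inj₂ p∣y = p∤y p∣y

  v-1 : ∀ {p} → 1 < p → v p 1 ≡ 0
  v-1 1<p = ∤⇒v≡0 1<p (λ p∣1 → contradiction (∣1⇒≡1 p∣1) (>⇒≢ 1<p))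

  v-^ : ∀ {p} → Prime p → ∀ a .{{_ : NonZero a}} k → v p (a ^ k) ≡ k * v p a
  v-^ pp a zero    = v-1 (prime>1 pp)
  v-^ {p} pp a {{a≢0}} (suc k) = trans (v-* pp a (a ^ k) {{a≢0}} {{m^n≢0 a k}}) (cong (v p a +_) (v-^ pp a k))

  v-Π : ∀ {p} → Prime p → ∀ n f → (∀ i → i < n → NonZero (f i)) → v p (Π< n f) ≡ Σ< n (λ i → v p (f i))
  v-Π pp zero    f f≢0 = v-1 (prime>1 pp)
  v-Π {p} pp (suc n) f f≢0 = trans (v-* pp (Π< n f) (f n) {{Π-nonZero n f≢0′}} {{f≢0 n ≤-refl}}) (cong (_+ v p (f n)) (v-Π pp n f f≢0′))
    where
    f≢0′ : ∀ i → i < n → NonZero (f i)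
    f≢0′ i i<n = f≢0 i (m<n⇒m<1+n i<n)

  v-prime : ∀ {p} → Prime p → v p p ≡ 1
  v-prime {p} pp = trans (cong (v p) (sym (trans (*-identityʳ (p ^ 1)) (*-identityʳ p))))
    (v-exact (prime>1 pp) (λ p∣1 → contradiction (∣1⇒≡1 p∣1) (>⇒≢ (prime>1 pp))) 1)

  -- Induction on the prime factors of `a`: each has positive valuation in `b`, hence divides `b`,
  -- and can be cancelled from both sides.
  v-≤⇒∣ : ∀ a b .{{_ : NonZero a}} .{{_ : NonZero b}} → (∀ p → Prime p → v p a ≤ v p b) → a ∣ b
  v-≤⇒∣ a b h with factorise a
  ... | record { factors = ps ; isFactorisation = refl ; factorsPrime = primes } = go ps primes b h
    where
    open import Data.List.Relation.Unary.All using (All)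
    open import Data.Nat.ListAction using (product)
    open import Data.Nat.Primality using (productOfPrimes≢0)
    go : ∀ ps → All Prime ps → ∀ b .{{_ : NonZero b}} → (∀ p → Prime p → v p (product ps) ≤ v p b) → product ps ∣ b
    go []       _             b h = 1∣ b
    go (p ∷ ps) (pp ∷ primes) b h with p ∣? b
    ... | no p∤b = contradiction (≤-trans (m≤m+n 1 _) (≤-trans (≤-reflexive (sym vp)) (h p pp)))
                     (λ 1≤v → contradiction (subst (1 ≤_) (∤⇒v≡0 (prime>1 pp) p∤b) 1≤v) (λ ()))
      where
      vp : v p (p * product ps) ≡ 1 + v p (product ps)
      vp = trans (v-* pp p (product ps) {{prime⇒nonZero pp}} {{productOfPrimes≢0 primes}}) (cong (_+ v p (product ps)) (v-prime pp))
    ... | yes (divides q refl) = subst (p * product ps ∣_) (*-comm p q) (*-monoʳ-∣ p (go ps primes q {{q≢0}}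
        (λ r rp → +-cancelˡ-≤ (v r p) _ _ (subst₂ _≤_
          (v-* rp p (product ps) {{prime⇒nonZero pp}} {{productOfPrimes≢0 primes}})
          (trans (v-* rp q p {{q≢0}} {{prime⇒nonZero pp}}) (+-comm (v r q) (v r p)))
          (h r rp)))))
      where
      q≢0 : NonZero q
      q≢0 = m*n≢0⇒m≢0 q

-- Integer polynomials of formal degree d and their binary forms.

module IntegerPolynomials where

  open import Data.Integer.Base hiding (suc)
  open import Data.Integer.Divisibility.Signed renaming (_∣_ to _∣ℤ_)
  open import Data.Integer.Properties
  open import Data.Integer.Tactic.RingSolver using (solve-∀)
  open import Data.Nat.Base as ℕ using (ℕ; zero; suc; z≤n; s≤s)
  import Data.Nat.Divisibility as ℕ
  import Data.Nat.Properties as ℕ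
  import Data.Nat.Tactic.RingSolver as ℕSolver

  -- Poly d is the set of polynomials of formal degree d: a list of d + 1
  -- coefficients, constant term first, the last of which may vanish.
  data Poly : ℕ → Set where
    con : ℤ → Poly 0
    _∷_ : ∀ {d} → ℤ → Poly d → Poly (suc d)

  ev : ∀ {d} → Poly d → ℤ → ℤ
  ev (con c) x = c
  ev (a ∷ g) x = a + x * ev g x

  lead : ∀ {d} → Poly d → ℤ
  lead (con c) = c
  lead (a ∷ g) = lead g

  -- The homogenisation v ^ d * ev g (u / v).
  hom : ∀ {d} → Poly d → ℤ → ℤ → ℤ
  hom         (con c) u v = c
  hom {suc d} (a ∷ g) u v = a * v ^ suc d + u * hom g u v

  hom[x,1] : ∀ {d} (g : Poly d) x → hom g x 1ℤ ≡ ev g x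
  hom[x,1]         (con c) x = refl
  hom[x,1] {suc d} (a ∷ g) x = cong₂ _+_ (trans (cong (a *_) (^-zeroˡ (suc d))) (*-identityʳ a)) (cong (x *_) (hom[x,1] g x))

  ∣i^n∣≡∣i∣^n : ∀ i n → ∣ i ^ n ∣ ≡ ∣ i ∣ ℕ.^ n
  ∣i^n∣≡∣i∣^n i zero    = refl
  ∣i^n∣≡∣i∣^n i (suc n) = trans (abs-* i (i ^ n)) (cong (∣ i ∣ ℕ.*_) (∣i^n∣≡∣i∣^n i n))

  hom-bound : ∀ {d} (g : Poly d) → ∃[ B ] (∀ u v M → ∣ u ∣ ℕ.≤ M → ∣ v ∣ ℕ.≤ M → ∣ hom g u v ∣ ℕ.≤ B ℕ.* M ℕ.^ d)
  hom-bound (con c) = ∣ c ∣ , λ u v M _ _ → ℕ.≤-reflexive (sym (ℕ.*-identityʳ ∣ c ∣))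
  hom-bound {suc d} (a ∷ g) with hom-bound g
  ... | B , bound = ∣ a ∣ ℕ.+ B , λ u v M u≤M v≤M → begin
    ∣ a * v ^ suc d + u * hom g u v ∣                   ≤⟨ ∣i+j∣≤∣i∣+∣j∣ (a * v ^ suc d) (u * hom g u v) ⟩
    ∣ a * v ^ suc d ∣ ℕ.+ ∣ u * hom g u v ∣             ≡⟨ cong₂ ℕ._+_ (trans (abs-* a (v ^ suc d)) (cong (∣ a ∣ ℕ.*_) (∣i^n∣≡∣i∣^n v (suc d)))) (abs-* u (hom g u v)) ⟩
    ∣ a ∣ ℕ.* ∣ v ∣ ℕ.^ suc d ℕ.+ ∣ u ∣ ℕ.* ∣ hom g u v ∣  ≤⟨ ℕ.+-mono-≤ (ℕ.*-monoʳ-≤ ∣ a ∣ (ℕ.^-monoˡ-≤ (suc d) v≤M)) (ℕ.*-mono-≤ u≤M (bound u v M u≤M v≤M)) ⟩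
    ∣ a ∣ ℕ.* M ℕ.^ suc d ℕ.+ M ℕ.* (B ℕ.* M ℕ.^ d)      ≡⟨ rearrange ∣ a ∣ B M (M ℕ.^ d) ⟩
    (∣ a ∣ ℕ.+ B) ℕ.* M ℕ.^ suc d ∎
    where
    open ℕ.≤-Reasoning
    rearrange : ∀ a B M x → a ℕ.* (M ℕ.* x) ℕ.+ M ℕ.* (B ℕ.* x) ≡ (a ℕ.+ B) ℕ.* (M ℕ.* x)
    rearrange = ℕSolver.solve-∀

  ev-bound : ∀ {d} (g : Poly d) → ∃[ B ] (∀ n → 1 ℕ.≤ n → ∣ ev g (+ n) ∣ ℕ.≤ B ℕ.* n ℕ.^ d)
  ev-bound g with hom-bound g
  ... | B , bound = B , λ n 1≤n → subst (λ i → ∣ i ∣ ℕ.≤ _) (hom[x,1] g (+ n)) (bound (+ n) 1ℤ n ℕ.≤-refl 1≤n)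

  -- Horner's rule loses a factor 2 at each coefficient. With y the inner value, n ^ d ≤ K |y|
  -- forces y ≠ 0, so 2 |a| < n ≤ n |y|, and |a + n y| is at least n |y| / 2.
  growth : ∀ {d} (g : Poly d) → lead g ≢ 0ℤ → ∃[ K ] ∃[ n₀ ] (∀ n → n₀ ℕ.≤ n → n ℕ.^ d ℕ.≤ K ℕ.* ∣ ev g (+ n) ∣)
  growth (con c) c≢0 = 1 , 0 , λ n _ → ℕ.≤-trans (ℕ.n≢0⇒n>0 (λ c≡0 → c≢0 (∣i∣≡0⇒i≡0 c≡0))) (ℕ.m≤m+n ∣ c ∣ 0)
  growth {suc d} (a ∷ g) l≢0 with growth g l≢0
  ... | K , n₀ , grow = 2 ℕ.* K , n₀ ℕ.+ suc (2 ℕ.* ∣ a ∣) , bound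
    where
    open ℕ.≤-Reasoning
    bound : ∀ n → n₀ ℕ.+ suc (2 ℕ.* ∣ a ∣) ℕ.≤ n → n ℕ.^ suc d ℕ.≤ 2 ℕ.* K ℕ.* ∣ a + + n * ev g (+ n) ∣
    bound n n₀≤n = begin
      n ℕ.* n ℕ.^ d        ≤⟨ ℕ.*-monoʳ-≤ n (grow n n₀≤n′) ⟩
      n ℕ.* (K ℕ.* y)      ≡⟨ trans (ℕ.*-comm n _) (trans (ℕ.*-assoc K y n) (cong (K ℕ.*_) (ℕ.*-comm y n))) ⟩
      K ℕ.* (n ℕ.* y)      ≤⟨ ℕ.*-monoʳ-≤ K (ℕ.+-cancelʳ-≤ (n ℕ.* y) _ _ twice) ⟩
      K ℕ.* (2 ℕ.* z)      ≡⟨ trans (sym (ℕ.*-assoc K 2 z)) (cong (ℕ._* z) (ℕ.*-comm K 2)) ⟩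
      2 ℕ.* K ℕ.* z ∎
      where
      y = ∣ ev g (+ n) ∣
      z = ∣ a + + n * ev g (+ n) ∣
      n₀≤n′ : n₀ ℕ.≤ n
      n₀≤n′ = ℕ.≤-trans (ℕ.m≤m+n n₀ _) n₀≤n
      2a<n : 2 ℕ.* ∣ a ∣ ℕ.< n
      2a<n = ℕ.≤-trans (ℕ.m≤n+m _ n₀) n₀≤n
      y≢0 : y ≢ 0
      y≢0 y≡0 = ℕ.<⇒≱ (ℕ.≤-trans (ℕ.m^n>0 n {{ℕ.>-nonZero (ℕ.≤-trans (s≤s z≤n) 2a<n)}} d) (grow n n₀≤n′))
                  (ℕ.≤-reflexive (trans (cong (K ℕ.*_) y≡0) (ℕ.*-zeroʳ K)))
      2a≤ny : 2 ℕ.* ∣ a ∣ ℕ.≤ n ℕ.* y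
      2a≤ny = ℕ.≤-trans (ℕ.<⇒≤ 2a<n) (ℕ.m≤m*n n y {{ℕ.≢-nonZero y≢0}})
      cancel : ∀ a b → a + b - a ≡ b
      cancel = solve-∀
      ny≤z+a : n ℕ.* y ℕ.≤ z ℕ.+ ∣ a ∣
      ny≤z+a = begin
        n ℕ.* y                  ≡⟨ abs-* (+ n) (ev g (+ n)) ⟨
        ∣ + n * ev g (+ n) ∣     ≡⟨ cong ∣_∣ (cancel a (+ n * ev g (+ n))) ⟨
        ∣ a + + n * ev g (+ n) - a ∣ ≤⟨ ∣i-j∣≤∣i∣+∣j∣ (a + + n * ev g (+ n)) a ⟩
        z ℕ.+ ∣ a ∣ ∎
      twice : n ℕ.* y ℕ.+ n ℕ.* y ℕ.≤ 2 ℕ.* z ℕ.+ n ℕ.* y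
      twice = begin
        n ℕ.* y ℕ.+ n ℕ.* y              ≤⟨ ℕ.+-mono-≤ ny≤z+a ny≤z+a ⟩
        (z ℕ.+ ∣ a ∣) ℕ.+ (z ℕ.+ ∣ a ∣)  ≡⟨ rearrange z ∣ a ∣ ⟩
        2 ℕ.* z ℕ.+ 2 ℕ.* ∣ a ∣          ≤⟨ ℕ.+-monoʳ-≤ (2 ℕ.* z) 2a≤ny ⟩
        2 ℕ.* z ℕ.+ n ℕ.* y ∎
        where
        rearrange : ∀ z a → (z ℕ.+ a) ℕ.+ (z ℕ.+ a) ≡ 2 ℕ.* z ℕ.+ 2 ℕ.* a
        rearrange = ℕSolver.solve-∀

  euclid : ∀ {p} → Prime p → ∀ i j → + p ∣ℤ i * j → + p ∣ℤ i ⊎ + p ∣ℤ j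
  euclid {p} pp i j p∣ij with euclidsLemma ∣ i ∣ ∣ j ∣ pp (subst (p ℕ.∣_) (abs-* i j) (∣⇒∣ᵤ p∣ij))
  ... | inj₁ p∣i = inj₁ (∣ᵤ⇒∣ p∣i)
  ... | inj₂ p∣j = inj₂ (∣ᵤ⇒∣ p∣j)

  synthetic : ∀ {d} → Poly (suc d) → ℤ → Poly d
  synthetic (a ∷ con c)     n = con c
  synthetic (a ∷ g@(_ ∷ _)) n = ev g n ∷ synthetic g n

  ev-synthetic : ∀ {d} (p : Poly (suc d)) n x → ev p x - ev p n ≡ (x - n) * ev (synthetic p n) x
  ev-synthetic (a ∷ con c) n x = lemma a c n x
    where
    lemma : ∀ a c n x → a + x * c - (a + n * c) ≡ (x - n) * c
    lemma = solve-∀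
  ev-synthetic (a ∷ g@(_ ∷ _)) n x = begin
    a + x * ev g x - (a + n * ev g n)                     ≡⟨ lemma₁ a x n (ev g x) (ev g n) ⟩
    x * (ev g x - ev g n) + (x - n) * ev g n              ≡⟨ cong (λ t → x * t + (x - n) * ev g n) (ev-synthetic g n x) ⟩
    x * ((x - n) * ev q x) + (x - n) * ev g n             ≡⟨ lemma₂ x n (ev q x) (ev g n) ⟩
    (x - n) * (ev g n + x * ev q x) ∎
    where
    open ≡-Reasoning
    q = synthetic g n
    lemma₁ : ∀ a x n gx gn → a + x * gx - (a + n * gn) ≡ x * (gx - gn) + (x - n) * gn
    lemma₁ = solve-∀
    lemma₂ : ∀ x n q gn → x * ((x - n) * q) + (x - n) * gn ≡ (x - n) * (gn + x * q)
    lemma₂ = solve-∀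

  lead-synthetic : ∀ {d} (p : Poly (suc d)) n → lead (synthetic p n) ≡ lead p
  lead-synthetic (a ∷ con c)     n = refl
  lead-synthetic (a ∷ g@(_ ∷ _)) n = lead-synthetic g n

  -- Lagrange's argument over the field of p elements: the quotient by x - r keeps the leading
  -- coefficient, and by Euclid's lemma every root incongruent to r is a root of it.
  roots-mod-p : ∀ {p} → Prime p → ∀ {d} (g : Poly d) → ¬ + p ∣ℤ lead g → ∀ xs → All (λ x → + p ∣ℤ ev g x) xs →
    AllPairs (λ x y → ¬ + p ∣ℤ y - x) xs → length xs ℕ.≤ d
  roots-mod-p pp g       p∤l []       _        _               = z≤n
  roots-mod-p pp (con c) p∤l (x ∷ xs) (p∣c ∷ _) _              = contradiction p∣c p∤l
  roots-mod-p {p} pp g@(_ ∷ _) p∤l (x ∷ xs) (p∣gx ∷ p∣g) (x≢ ∷ distinct) =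
    s≤s (roots-mod-p pp (synthetic g x) (subst (λ l → ¬ + p ∣ℤ l) (sym (lead-synthetic g x)) p∤l) xs
      (All.zipWith root (p∣g , x≢)) distinct)
    where
    root : ∀ {y} → (+ p ∣ℤ ev g y) × (¬ + p ∣ℤ y - x) → + p ∣ℤ ev (synthetic g x) y
    root {y} (p∣gy , p∤y-x) with euclid pp (y - x) (ev (synthetic g x) y) (subst (+ p ∣ℤ_) (ev-synthetic g x y) (∣m∣n⇒∣m-n p∣gy p∣gx))
    ... | inj₁ p∣y-x = contradiction p∣y-x p∤y-x
    ... | inj₂ p∣q   = p∣q

  -- If u ≡ r v and g (r) ≡ 0 modulo p, this makes p divide the form. It is how a coincidence of two
  -- points modulo p becomes a prime factor of a small integer.
  hom≡v^d*ev[mod-u-rv] : ∀ {d} (g : Poly d) u v r → u - r * v ∣ℤ hom g u v - v ^ d * ev g r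
  hom≡v^d*ev[mod-u-rv] (con c) u v r = divides 0ℤ (lemma c)
    where
    lemma : ∀ c → c - 1ℤ * c ≡ 0ℤ
    lemma = solve-∀
  hom≡v^d*ev[mod-u-rv] {suc d} (a ∷ g) u v r with hom≡v^d*ev[mod-u-rv] g u v r
  ... | divides s eq = divides (u * s + v ^ d * ev g r) (begin
    a * (v * w) + u * h - v * w * (a + r * y)       ≡⟨ lemma₁ a u v r w h y ⟩
    u * (h - w * y) + w * y * (u - r * v)           ≡⟨ cong (λ t → u * t + w * y * (u - r * v)) eq ⟩
    u * (s * (u - r * v)) + w * y * (u - r * v)     ≡⟨ lemma₂ u (u - r * v) s (w * y) ⟩
    (u * s + w * y) * (u - r * v) ∎)
    where
    open ≡-Reasoning
    w = v ^ d
    h = hom g u v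
    y = ev g r
    lemma₁ : ∀ a u v r w h y → a * (v * w) + u * h - v * w * (a + r * y) ≡ u * (h - w * y) + w * y * (u - r * v)
    lemma₁ = solve-∀
    lemma₂ : ∀ u t s z → u * (s * t) + z * t ≡ (u * s + z) * t
    lemma₂ = solve-∀

  ^∣^ : ∀ {m i} → m ∣ℤ i → ∀ k → m ^ k ∣ℤ i ^ k
  ^∣^ m∣i zero    = ∣-refl
  ^∣^ {m} {i} m∣i (suc k) = ∣-trans (*-monoˡ-∣ (m ^ k) m∣i) (*-monoʳ-∣ i (^∣^ m∣i k))

  -- Serves the pairs of points congruent modulo p in both coordinates: they coincide for all roots
  -- at once, and homogeneity supplies the factor p ^ d that pays for up to d roots.
  m^d∣hom : ∀ {m d} (g : Poly d) u v → m ∣ℤ u → m ∣ℤ v → m ^ d ∣ℤ hom g u v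
  m^d∣hom (con c) u v m∣u m∣v = divides c (sym (*-identityʳ c))
  m^d∣hom {m} {suc d} (a ∷ g) u v m∣u m∣v = ∣m∣n⇒∣m+n (∣n⇒∣m*n a (^∣^ m∣v (suc d)))
    (∣-trans (*-monoˡ-∣ (m ^ d) m∣u) (*-monoʳ-∣ u (m^d∣hom g u v m∣u m∣v)))

  infixl 6 _⊕_

  _⊕_ : ∀ {d} → Poly d → Poly d → Poly d
  con a   ⊕ con b   = con (a + b)
  (a ∷ p) ⊕ (b ∷ q) = (a + b) ∷ (p ⊕ q)

  ev-⊕ : ∀ {d} (p q : Poly d) x → ev (p ⊕ q) x ≡ ev p x + ev q x
  ev-⊕ (con a) (con b) x = refl
  ev-⊕ (a ∷ p) (b ∷ q) x = trans (cong (λ t → a + b + x * t) (ev-⊕ p q x)) (lemma a b x (ev p x) (ev q x))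
    where
    lemma : ∀ a b x p q → a + b + x * (p + q) ≡ a + x * p + (b + x * q)
    lemma = solve-∀

  lead-⊕ : ∀ {d} (p q : Poly d) → lead (p ⊕ q) ≡ lead p + lead q
  lead-⊕ (con a) (con b) = refl
  lead-⊕ (a ∷ p) (b ∷ q) = lead-⊕ p q

  infixl 7 _⊙_

  _⊙_ : ∀ {d} → ℤ → Poly d → Poly d
  c ⊙ con a   = con (c * a)
  c ⊙ (a ∷ p) = c * a ∷ (c ⊙ p)

  hom-⊙ : ∀ {d} c (p : Poly d) u v → hom (c ⊙ p) u v ≡ c * hom p u v
  hom-⊙         c (con a) u v = refl
  hom-⊙ {suc d} c (a ∷ p) u v = trans (cong (λ t → c * a * v ^ suc d + u * t) (hom-⊙ c p u v)) (lemma c a (v ^ suc d) u (hom p u v))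
    where
    lemma : ∀ c a w u h → c * a * w + u * (c * h) ≡ c * (a * w + u * h)
    lemma = solve-∀

  ev-⊙ : ∀ {d} c (p : Poly d) x → ev (c ⊙ p) x ≡ c * ev p x
  ev-⊙ c p x = trans (sym (hom[x,1] (c ⊙ p) x)) (trans (hom-⊙ c p x 1ℤ) (cong (c *_) (hom[x,1] p x)))

  lead-⊙ : ∀ {d} c (p : Poly d) → lead (c ⊙ p) ≡ c * lead p
  lead-⊙ c (con a) = refl
  lead-⊙ c (a ∷ p) = lead-⊙ c p

  -- The polynomial p (q x).
  dilate : ∀ {d} → ℤ → Poly d → Poly d
  dilate q (con a) = con a
  dilate q (a ∷ p) = a ∷ (q ⊙ dilate q p)

  hom-dilate : ∀ {d} q (p : Poly d) u v → hom (dilate q p) u v ≡ hom p (q * u) v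
  hom-dilate         q (con a) u v = refl
  hom-dilate {suc d} q (a ∷ p) u v = cong (λ t → a * v ^ suc d + t) (begin
    u * hom (q ⊙ dilate q p) u v    ≡⟨ cong (u *_) (trans (hom-⊙ q (dilate q p) u v) (cong (q *_) (hom-dilate q p u v))) ⟩
    u * (q * hom p (q * u) v)       ≡⟨ trans (sym (*-assoc u q _)) (cong (_* hom p (q * u) v) (*-comm u q)) ⟩
    q * u * hom p (q * u) v ∎)
    where open ≡-Reasoning

  lead-dilate : ∀ {d} q (p : Poly d) → lead (dilate q p) ≡ q ^ d * lead p
  lead-dilate         q (con a) = sym (*-identityˡ a)
  lead-dilate {suc d} q (a ∷ p) = trans (lead-⊙ q (dilate q p)) (trans (cong (q *_) (lead-dilate q p)) (sym (*-assoc q (q ^ d) (lead p))))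

  deriv : ∀ {d} → Poly (suc d) → Poly d
  deriv (a ∷ con c)     = con c
  deriv (a ∷ g@(_ ∷ _)) = g ⊕ (0ℤ ∷ deriv g)

  -- Of the second-order remainder only its divisibility by t² matters, so `s` is an integer
  -- depending on x and t.
  taylor : ∀ {d} (p : Poly (suc d)) x t → ∃[ s ] (ev p (x + t) ≡ ev p x + t * (ev (deriv p) x + t * s))
  taylor (a ∷ con c) x t = 0ℤ , lemma a c x t
    where
    lemma : ∀ a c x t → a + (x + t) * c ≡ a + x * c + t * (c + t * 0ℤ)
    lemma = solve-∀
  taylor (a ∷ g@(_ ∷ _)) x t with taylor g x t
  ... | s , eq = ev (deriv g) x + x * s + t * s , (begin
    a + (x + t) * ev g (x + t)             ≡⟨ cong (λ y → a + (x + t) * y) eq ⟩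
    a + (x + t) * (y + t * (y′ + t * s))   ≡⟨ lemma a x t y y′ s ⟩
    a + x * y + t * (y + (0ℤ + x * y′) + t * (y′ + x * s + t * s))
      ≡⟨ cong (λ z → a + x * y + t * (z + t * (y′ + x * s + t * s))) (ev-⊕ g (0ℤ ∷ deriv g) x) ⟨
    a + x * y + t * (ev (g ⊕ (0ℤ ∷ deriv g)) x + t * (y′ + x * s + t * s)) ∎)
    where
    open ≡-Reasoning
    y  = ev g x
    y′ = ev (deriv g) x
    lemma : ∀ a x t y y′ s → a + (x + t) * (y + t * (y′ + t * s)) ≡ a + x * y + t * (y + (0ℤ + x * y′) + t * (y′ + x * s + t * s))
    lemma = solve-∀

  lead-deriv : ∀ {d} (p : Poly (suc d)) → lead (deriv p) ≡ + suc d * lead p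
  lead-deriv (a ∷ con c)     = sym (*-identityˡ c)
  lead-deriv {suc d} (a ∷ g@(_ ∷ _)) = trans (lead-⊕ g (0ℤ ∷ deriv g)) (trans (cong (λ t → lead g + t) (lead-deriv g)) (lemma (lead g) (+ suc d)))
    where
    lemma : ∀ l n → l + n * l ≡ (1ℤ + n) * l
    lemma = solve-∀

-- Roots modulo a prime and its powers, and the box argument at one prime.

module LocalCounts where

  open import Data.Integer.Base as ℤ using (ℤ; +_; 0ℤ; ∣_∣)
  open import Data.Integer.Divisibility.Signed as ℤ using (divides; ∣m∣n⇒∣m+n; ∣m∣n⇒∣m-n; ∣n⇒∣m*n) renaming (_∣_ to _∣ℤ_)
  import Data.Integer.DivMod as ℤ
  import Data.Integer.Properties as ℤ
  import Data.Integer.Tactic.RingSolver as ℤSolver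
  open import Data.Nat.Base
  open import Data.Nat.Divisibility using (_∣_; _∣?_; ∣⇒≤; ∣-trans; m∣m*n)
  open import Data.Nat.DivMod using (_/_; _%_; m≡m%n+[m/n]*n; m/n*n≤m)
  open import Data.Nat.Properties
  open import Data.Nat.Tactic.RingSolver using (solve-∀)
  open IntegerPolynomials
  open Sums
  open Valuation

  -- After the substitution in sieve, no prime p ≤ b divides a value, and no prime p > b is exceptional.
  record Sifted {d : ℕ} (h : Poly d) (b : ℕ) : Set where
    field
      values      : ∀ {p} → Prime p → p ≤ b → ∀ n → ¬ + p ∣ℤ ev h (+ n)
      leading     : ∀ {p} → Prime p → b < p → ¬ + p ∣ℤ lead h
      separated   : ∀ {p} → Prime p → b < p → ∀ k x y → + (p ^ k) ∣ℤ ev h x → + (p ^ k) ∣ℤ ev h y →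
                    + p ∣ℤ y ℤ.- x → + (p ^ k) ∣ℤ y ℤ.- x
      anisotropic : ∀ u v → hom h u v ≡ 0ℤ → u ≡ 0ℤ × v ≡ 0ℤ

  pairwise : ∀ {P : ℕ → Set} {R : ℕ → ℕ → Set} {xs} → All P xs → AllPairs R xs → AllPairs (λ x y → P x × P y × R x y) xs
  pairwise []       []       = []
  pairwise (p ∷ ps) (r ∷ rs) = All.zipWith (λ (q , r) → p , q , r) (ps , r) ∷ pairwise ps rs

  shifted-difference : ∀ a {x y} → y < x → ∣ + (a + y) ℤ.- + (a + x) ∣ ≡ x ∸ y
  shifted-difference a {x} {y} y<x = begin
    ∣ + (a + y) ℤ.- + (a + x) ∣                    ≡⟨ cong (λ x → ∣ + (a + y) ℤ.- + (a + x) ∣) (m+[n∸m]≡n (<⇒≤ y<x)) ⟨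
    ∣ + (a + y) ℤ.- + (a + (y + (x ∸ y))) ∣        ≡⟨ cong ∣_∣ (lemma (+ a) (+ y) (+ (x ∸ y))) ⟩
    ∣ ℤ.- (+ (x ∸ y)) ∣                            ≡⟨ ℤ.∣-i∣≡∣i∣ (+ (x ∸ y)) ⟩
    x ∸ y ∎
    where
    open ≡-Reasoning
    lemma : ∀ a y k → a ℤ.+ y ℤ.- (a ℤ.+ (y ℤ.+ k)) ≡ ℤ.- k
    lemma = ℤSolver.solve-∀

  incongruent : ∀ a m {x y} → x < m → y < x → ¬ + m ∣ℤ + (a + y) ℤ.- + (a + x)
  incongruent a m {x} {y} x<m y<x m∣ =
    <⇒≱ (≤-<-trans (m∸n≤m x y) x<m) (∣⇒≤ {{>-nonZero (m<n⇒0<n∸m y<x)}} (subst (m ∣_) (shifted-difference a y<x) (ℤ.∣⇒∣ᵤ m∣)))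

  ⌊_/_^_⌋ : ℕ → ∀ p .{{_ : NonZero p}} → ℕ → ℕ
  ⌊ n / p ^ k ⌋ = _/_ n (p ^ k) {{m^n≢0 p k}}

  H : ∀ {d} → Poly d → ℕ → ℕ
  H h n = ∣ ev h (+ n) ∣

  module _ {d : ℕ} (h : Poly d) {b : ℕ} (sifted : Sifted h b) {p : ℕ} (pp : Prime p) (b<p : b < p) where

    open Sifted sifted

    private instance
      p≢0 : NonZero p
      p≢0 = prime⇒nonZero pp

    -- Two solutions congruent modulo p are congruent modulo p ^ (k + 1) by `separated`, which
    -- cannot happen inside a window of that length. So the solutions are distinct roots modulo p.
    window : ∀ k a → Σ< (p ^ suc k) (λ i → ⟦ p ^ suc k ∣? H h (suc (a + i)) ⟧) ≤ d
    window k a = count≤ (p ^ suc k) (λ i → p ^ suc k ∣? H h (suc (a + i))) d λ xs ps <pᵏ ord →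
      subst (_≤ d) (length-map point xs)
        (roots-mod-p pp h (leading pp b<p) (map point xs)
          (All.map⁺ (All.map (λ pᵏ∣ → ℤ.∣-trans p∣pᵏ (ℤ.∣ᵤ⇒∣ pᵏ∣)) ps))
          (AllPairs.map⁺ (AllPairs.map (λ { ((px , x<) , (py , _) , y<x) p∣y-x →
              incongruent (suc a) (p ^ suc k) x< y<x (separated pp b<p (suc k) _ _ (ℤ.∣ᵤ⇒∣ px) (ℤ.∣ᵤ⇒∣ py) p∣y-x) })
            (pairwise (All.zip (ps , <pᵏ)) ord))))
      where
      point : ℕ → ℤ
      point i = + suc (a + i)
      p∣pᵏ : + p ∣ℤ + (p ^ suc k)
      p∣pᵏ = ℤ.∣ᵤ⇒∣ (m∣m*n (p ^ k))

    -- The index is shifted as in `v`: `ρ N k` belongs to the power p ^ (k + 1).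
    ρ : ℕ → ℕ → ℕ
    ρ N k = Σ< N (λ i → ⟦ p ^ suc k ∣? H h (suc i) ⟧)

    module _ (N : ℕ) (L : ℕ) (H∣L : ∀ i → i < N → H h (suc i) ∣ L) where

      -- The indicator is kept because the trailing `+ d` would otherwise contribute for every k;
      -- with it these terms add up to d times the valuation of `L`.
      ρ≤ : ∀ k → ρ N k ≤ ⟦ p ^ suc k ∣? L ⟧ * (d * ⌊ N / p ^ suc k ⌋ + d)
      ρ≤ k with p ^ suc k ∣? L
      ... | yes _   = ≤-trans (Σ-windows (p ^ suc k) {{m^n≢0 p (suc k)}} d _ (window k) N) (≤-reflexive (sym (+-identityʳ _)))
      ... | no pᵏ∤L = ≤-reflexive (Σ-zero N (λ i i<N → ⟦⟧-no (p ^ suc k ∣? H h (suc i)) (λ pᵏ∣ → pᵏ∤L (∣-trans pᵏ∣ (H∣L i i<N)))))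

    roots : ℕ
    roots = Σ< p (λ r → ⟦ p ∣? H h r ⟧)

    H-periodic : ∀ i → ⟦ p ∣? H h (i + p) ⟧ ≡ ⟦ p ∣? H h i ⟧
    H-periodic i = ⟦⟧-cong (p ∣? H h (i + p)) (p ∣? H h i)
      (λ p∣ → ℤ.∣⇒∣ᵤ (subst (+ p ∣ℤ_) (lemma₁ (ev h (+ (i + p))) (ev h (+ i))) (∣m∣n⇒∣m-n {m = ev h (+ (i + p))} (ℤ.∣ᵤ⇒∣ p∣) difference)))
      (λ p∣ → ℤ.∣⇒∣ᵤ (subst (+ p ∣ℤ_) (lemma₂ (ev h (+ (i + p))) (ev h (+ i))) (∣m∣n⇒∣m+n {n = ev h (+ i)} difference (ℤ.∣ᵤ⇒∣ p∣))))
      where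
      lemma₁ : ∀ x y → x ℤ.- (x ℤ.- y) ≡ y
      lemma₁ = ℤSolver.solve-∀
      lemma₂ : ∀ x y → x ℤ.- y ℤ.+ y ≡ x
      lemma₂ = ℤSolver.solve-∀
      lemma₃ : ∀ i p → i ℤ.+ p ℤ.- i ≡ p
      lemma₃ = ℤSolver.solve-∀
      difference : + p ∣ℤ ev h (+ (i + p)) ℤ.- ev h (+ i)
      difference = ev-periodic h
        where
        ev-periodic : ∀ {d} (g : Poly d) → + p ∣ℤ ev g (+ (i + p)) ℤ.- ev g (+ i)
        ev-periodic (con c) = divides 0ℤ (ℤ.+-inverseʳ c)
        ev-periodic g@(_ ∷ _) = divides (ev (synthetic g (+ i)) (+ (i + p)))
          (trans (ev-synthetic g (+ i) (+ (i + p))) (trans (cong (ℤ._* ev (synthetic g (+ i)) (+ (i + p))) (lemma₃ (+ i) (+ p))) (ℤ.*-comm (+ p) _)))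

    -- Keeps the exact number of roots instead of the bound d, since it is this number that the box
    -- argument controls on average over p.
    ρ₀≤ : ∀ N → ρ N 0 ≤ roots * (N / p) + roots
    ρ₀≤ N = ≤-trans (≤-reflexive (Σ-cong N (λ i _ → cong (λ q → ⟦ q ∣? H h (suc i) ⟧) (*-identityʳ p))))
      (Σ-windows p roots (λ i → ⟦ p ∣? H h (suc i) ⟧) (λ a → ≤-reflexive (Σ-periodic p (λ r → ⟦ p ∣? H h r ⟧) H-periodic (suc a))) N)

    module _ (u w : ℤ) where

      private
        F = hom h u w

      -- The roots r of h mod p with u ≡ r w: if p ∤ w there is at most one, and p divides the form;
      -- otherwise p divides u as well, there are at most d of them, and p ^ d divides the form.
      coincident-roots : F ≢ 0ℤ → ∀ xs → All (λ r → p ∣ H h r × + p ∣ℤ u ℤ.- + r ℤ.* w) xs → All (_< p) xs →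
        AllPairs _>_ xs → length xs ≤ v p ∣ F ∣
      coincident-roots F≢0 xs ps <p ord = bound xs ps <p ord (+ p ℤ.∣? w)
        where
        p^e∣F⇒≤v : ∀ e → + (p ^ e) ∣ℤ F → e ≤ v p ∣ F ∣
        p^e∣F⇒≤v e pᵉ∣F = ∣⇒≤v (prime>1 pp) e ∣ F ∣ {{≢-nonZero (λ F≡0 → F≢0 (ℤ.∣i∣≡0⇒i≡0 F≡0))}} (ℤ.∣⇒∣ᵤ pᵉ∣F)
        pos-^ : ∀ m k → (+ m) ℤ.^ k ≡ + (m ^ k)
        pos-^ m zero    = refl
        pos-^ m (suc k) = trans (cong (+ m ℤ.*_) (pos-^ m k)) (sym (ℤ.pos-* m (m ^ k)))
        lemma₁ : ∀ u r w → u ℤ.- r ℤ.* w ℤ.+ r ℤ.* w ≡ u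
        lemma₁ = ℤSolver.solve-∀
        lemma₂ : ∀ x y → x ℤ.- y ℤ.+ y ≡ x
        lemma₂ = ℤSolver.solve-∀
        lemma₃ : ∀ u r s w → u ℤ.- r ℤ.* w ℤ.- (u ℤ.- s ℤ.* w) ≡ (s ℤ.- r) ℤ.* w
        lemma₃ = ℤSolver.solve-∀
        bound : ∀ xs → All (λ r → p ∣ H h r × + p ∣ℤ u ℤ.- + r ℤ.* w) xs → All (_< p) xs →
          AllPairs _>_ xs → Dec (+ p ∣ℤ w) → length xs ≤ v p ∣ F ∣
        bound []       _                  _  _   _         = z≤n
        bound (r ∷ xs) ((p∣r , p∣) ∷ ps) <p ord (yes p∣w) = ≤-trans
          (subst (_≤ d) (length-map +_ (r ∷ xs)) (roots-mod-p pp h (leading pp b<p) (map +_ (r ∷ xs))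
            (All.map⁺ (ℤ.∣ᵤ⇒∣ p∣r ∷ All.map (λ q → ℤ.∣ᵤ⇒∣ (proj₁ q)) ps))
            (AllPairs.map⁺ (AllPairs.map (λ { (x<p , _ , y<x) → incongruent 0 p x<p y<x }) (pairwise <p ord)))))
          (p^e∣F⇒≤v d (subst (_∣ℤ F) (pos-^ p d) (m^d∣hom h u w p∣u p∣w)))
          where
          p∣u : + p ∣ℤ u
          p∣u = subst (+ p ∣ℤ_) (lemma₁ u (+ r) w) (∣m∣n⇒∣m+n p∣ (∣n⇒∣m*n (+ r) p∣w))
        bound (r ∷ []) ((p∣r , p∣) ∷ _) _ _ (no p∤w) =
          p^e∣F⇒≤v 1 (subst (λ q → + q ∣ℤ F) (sym (*-identityʳ p))
            (subst (+ p ∣ℤ_) (lemma₂ F (w ℤ.^ d ℤ.* ev h (+ r)))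
              (∣m∣n⇒∣m+n (ℤ.∣-trans p∣ (hom≡v^d*ev[mod-u-rv] h u w (+ r))) (∣n⇒∣m*n (w ℤ.^ d) (ℤ.∣ᵤ⇒∣ p∣r)))))
        bound (r ∷ s ∷ _) ((_ , p∣r) ∷ (_ , p∣s) ∷ _) (r<p ∷ _) ((s<r ∷ _) ∷ _) (no p∤w)
          with euclid pp (+ s ℤ.- + r) w (subst (+ p ∣ℤ_) (lemma₃ u (+ r) (+ s) w) (∣m∣n⇒∣m-n p∣r p∣s))
        ... | inj₁ p∣s-r = contradiction p∣s-r (incongruent 0 p r<p s<r)
        ... | inj₂ p∣w   = contradiction p∣w p∤w

  -- Makes the vanishing diagonal terms of the product over all pairs of points equal to 1.
  nz : ℕ → ℕ
  nz zero    = 1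
  nz (suc m) = suc m

  nz-nonZero : ∀ m → NonZero (nz m)
  nz-nonZero zero    = _
  nz-nonZero (suc m) = _

  nz-id : ∀ m → m ≢ 0 → nz m ≡ m
  nz-id zero    m≢0 = contradiction refl m≢0
  nz-id (suc m) _   = refl

  -- In `few`, rounding up costs 5/4 because 4 p ≤ N. In `many`, the diagonal term p n R is at most
  -- R n² / 36 because 36 p ≤ n, so removing it costs 36/35. The product of the two is 9/7.
  budget : ∀ p q R ρ w N n .{{_ : NonZero p}} → q * p ≤ N → ρ ≤ R * q + R → R * (n * n) ≤ p * (w + n * R) →
    4 * p ≤ N → 9 * N ≤ n → 7 * (n * n) * ρ ≤ 9 * N * w
  budget p q R ρ w N n qp≤N ρ≤ Rn²≤ 4p≤N 9N≤n = *-cancelˡ-≤ (20 * p) {{m*n≢0 20 p}} (begin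
    20 * p * (7 * (n * n) * ρ)        ≡⟨ e₁ p (n * n) ρ ⟩
    35 * (n * n) * (4 * (p * ρ))      ≤⟨ *-monoʳ-≤ (35 * (n * n)) few ⟩
    35 * (n * n) * (5 * (N * R))      ≡⟨ e₂ (n * n) N R ⟩
    5 * N * (35 * (R * (n * n)))      ≤⟨ *-monoʳ-≤ (5 * N) many ⟩
    5 * N * (36 * (p * w))            ≡⟨ e₃ N p w ⟩
    20 * p * (9 * N * w) ∎)
    where
    open ≤-Reasoning
    e₁ : ∀ p m r → 20 * p * (7 * m * r) ≡ 35 * m * (4 * (p * r))
    e₁ = solve-∀
    e₂ : ∀ m N R → 35 * m * (5 * (N * R)) ≡ 5 * N * (35 * (R * m))
    e₂ = solve-∀
    e₃ : ∀ N p w → 5 * N * (36 * (p * w)) ≡ 20 * p * (9 * N * w)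
    e₃ = solve-∀
    e₄ : ∀ p R q → 4 * (p * (R * q + R)) ≡ 4 * (R * (q * p)) + R * (4 * p)
    e₄ = solve-∀
    e₅ : ∀ R N → 4 * (R * N) + R * N ≡ 5 * (N * R)
    e₅ = solve-∀
    few : 4 * (p * ρ) ≤ 5 * (N * R)
    few = begin
      4 * (p * ρ)                          ≤⟨ *-monoʳ-≤ 4 (*-monoʳ-≤ p ρ≤) ⟩
      4 * (p * (R * q + R))                ≡⟨ e₄ p R q ⟩
      4 * (R * (q * p)) + R * (4 * p)      ≤⟨ +-mono-≤ (*-monoʳ-≤ 4 (*-monoʳ-≤ R qp≤N)) (*-monoʳ-≤ R 4p≤N) ⟩
      4 * (R * N) + R * N                  ≡⟨ e₅ R N ⟩
      5 * (N * R) ∎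
    36p≤n : 36 * p ≤ n
    36p≤n = ≤-trans (≤-reflexive (*-assoc 9 4 p)) (≤-trans (*-monoʳ-≤ 9 4p≤N) 9N≤n)
    e₆ : ∀ x → 35 * x + x ≡ 36 * x
    e₆ = solve-∀
    e₇ : ∀ p w n R → 36 * (p * (w + n * R)) ≡ 36 * (p * w) + 36 * p * (n * R)
    e₇ = solve-∀
    e₈ : ∀ n R → n * (n * R) ≡ R * (n * n)
    e₈ = solve-∀
    many : 35 * (R * (n * n)) ≤ 36 * (p * w)
    many = +-cancelʳ-≤ (R * (n * n)) _ _ (begin
      35 * (R * (n * n)) + R * (n * n)     ≡⟨ e₆ (R * (n * n)) ⟩
      36 * (R * (n * n))                   ≤⟨ *-monoʳ-≤ 36 Rn²≤ ⟩
      36 * (p * (w + n * R))               ≡⟨ e₇ p w n R ⟩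
      36 * (p * w) + 36 * p * (n * R)      ≤⟨ +-monoʳ-≤ (36 * (p * w)) (*-monoˡ-≤ (n * R) 36p≤n) ⟩
      36 * (p * w) + n * (n * R)           ≡⟨ cong (λ t → 36 * (p * w) + t) (e₈ n R) ⟩
      36 * (p * w) + R * (n * n) ∎)

  -- The points of an M × M box are numbered by i < M * M, with coordinates i / M and i % M.
  module Box {d : ℕ} (h : Poly d) (M : ℕ) .{{_ : NonZero M}} where

    n : ℕ
    n = M * M

    X Y : ℕ → ℕ
    X i = i / M
    Y i = i % M

    U V : ℕ → ℕ → ℤ
    U i j = + X i ℤ.- + X j
    V i j = + Y i ℤ.- + Y j

    form : ℕ → ℕ → ℕ
    form i j = nz ∣ hom h (U i j) (V i j) ∣

    coordinates-injective : ∀ i j → U i j ≡ 0ℤ → V i j ≡ 0ℤ → i ≡ j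
    coordinates-injective i j u≡0 v≡0 = begin
      i                   ≡⟨ m≡m%n+[m/n]*n i M ⟩
      i % M + i / M * M   ≡⟨ cong₂ (λ y x → y + x * M) (ℤ.+-injective (ℤ.i-j≡0⇒i≡j (+ Y i) (+ Y j) v≡0)) (ℤ.+-injective (ℤ.i-j≡0⇒i≡j (+ X i) (+ X j) u≡0)) ⟩
      j % M + j / M * M   ≡⟨ m≡m%n+[m/n]*n j M ⟨
      j ∎
      where open ≡-Reasoning

    module _ {b : ℕ} (sifted : Sifted h b) {p : ℕ} (pp : Prime p) (b<p : b < p) where

      open Sifted sifted

      private instance
        p≢0 : NonZero p
        p≢0 = prime⇒nonZero pp

      κ : ℕ → ℕ → ℕ
      κ r i = (+ X i ℤ.- + r ℤ.* + Y i) ℤ.%ℕ p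

      κ-≡ : ∀ r i j → κ r j ≡ κ r i → + p ∣ℤ U i j ℤ.- + r ℤ.* V i j
      κ-≡ r i j κ≡ = divides (qᵢ ℤ.- qⱼ) (begin
        U i j ℤ.- + r ℤ.* V i j                                ≡⟨ lemma₁ (+ X i) (+ X j) (+ r) (+ Y i) (+ Y j) ⟩
        zᵢ ℤ.- zⱼ                                              ≡⟨ cong₂ ℤ._-_ (ℤ.a≡a%ℕn+[a/ℕn]*n zᵢ p) (trans (ℤ.a≡a%ℕn+[a/ℕn]*n zⱼ p) (cong (λ c → + c ℤ.+ qⱼ ℤ.* + p) κ≡)) ⟩
        (+ κ r i ℤ.+ qᵢ ℤ.* + p) ℤ.- (+ κ r i ℤ.+ qⱼ ℤ.* + p)  ≡⟨ lemma₂ (+ κ r i) qᵢ qⱼ (+ p) ⟩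
        (qᵢ ℤ.- qⱼ) ℤ.* + p ∎)
        where
        open ≡-Reasoning
        zᵢ = + X i ℤ.- + r ℤ.* + Y i
        zⱼ = + X j ℤ.- + r ℤ.* + Y j
        qᵢ = zᵢ ℤ./ℕ p
        qⱼ = zⱼ ℤ./ℕ p
        lemma₁ : ∀ x x′ r y y′ → x ℤ.- x′ ℤ.- r ℤ.* (y ℤ.- y′) ≡ (x ℤ.- r ℤ.* y) ℤ.- (x′ ℤ.- r ℤ.* y′)
        lemma₁ = ℤSolver.solve-∀
        lemma₂ : ∀ c q q′ p → (c ℤ.+ q ℤ.* p) ℤ.- (c ℤ.+ q′ ℤ.* p) ≡ (q ℤ.- q′) ℤ.* p
        lemma₂ = ℤSolver.solve-∀

      a : ℕ → ℕ
      a r = ⟦ p ∣? H h r ⟧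

      -- Off the diagonal, each root for which the two points coincide is charged to a factor p of
      -- the form. A diagonal pair coincides for every root while its form was replaced by 1, so it
      -- is charged `roots` instead.
      coincidence : ∀ i j (i≟j : Dec (i ≡ j)) → Σ< p (λ r → a r * ⟦ κ r j ≟ κ r i ⟧) ≤ v p (form i j) + ⟦ i≟j ⟧ * roots h sifted pp b<p
      coincidence i j (yes _)  = ≤-trans (Σ-mono p (λ r _ → ≤-trans (*-monoʳ-≤ (a r) (⟦⟧≤1 (κ r j ≟ κ r i))) (≤-reflexive (*-identityʳ (a r)))))
                       (≤-trans (≤-reflexive (sym (+-identityʳ _))) (m≤n+m _ (v p (form i j))))
      coincidence i j (no i≢j) = ≤-trans (≤-reflexive (Σ-cong p (λ r _ → sym (⟦⟧-× (p ∣? H h r) (κ r j ≟ κ r i)))))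
                       (≤-trans (count≤ p (λ r → (p ∣? H h r) ×-dec (κ r j ≟ κ r i)) (v p ∣ hom h (U i j) (V i j) ∣)
                         (λ xs ps → coincident-roots h sifted pp b<p (U i j) (V i j) F≢0 xs (All.map (λ { {r} (p∣r , κ≡) → p∣r , κ-≡ r i j κ≡ }) ps)))
                       (≤-trans (≤-reflexive (cong (v p) (sym (nz-id _ (λ F≡0 → F≢0 (ℤ.∣i∣≡0⇒i≡0 F≡0)))))) (m≤m+n _ 0)))
        where
        -- The absence of nontrivial zeros enters here: distinct points differ in a coordinate.
        F≢0 : hom h (U i j) (V i j) ≢ 0ℤ
        F≢0 F≡0 = let u≡0 , w≡0 = anisotropic (U i j) (V i j) F≡0 in i≢j (coordinates-injective i j u≡0 w≡0)
        ⟦⟧-× : ∀ {P Q : Set} (d : Dec P) (e : Dec Q) → ⟦ d ×-dec e ⟧ ≡ ⟦ d ⟧ * ⟦ e ⟧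
        ⟦⟧-× (yes _) (yes _) = refl
        ⟦⟧-× (yes _) (no _)  = refl
        ⟦⟧-× (no _)  _       = refl

      weight : ℕ
      weight = Σ< n (λ i → Σ< n (λ j → v p (form i j)))

      -- Cauchy-Schwarz is applied for each root separately; exchanging the sums then collects, for
      -- each pair of points, the roots for which it coincides. The term `n * R` comes from the n
      -- diagonal pairs.
      roots*n²≤ : roots h sifted pp b<p * (n * n) ≤ p * (weight + n * roots h sifted pp b<p)
      roots*n²≤ = begin
        R * (n * n)                                     ≡⟨ *-comm R (n * n) ⟩
        n * n * R                                       ≡⟨ Σ-*ˡ p (n * n) a ⟨
        Σ< p (λ r → n * n * a r)                        ≤⟨ Σ-mono p (λ r _ → *-monoˡ-≤ (a r) (n²≤p*coincidences n p (κ r) (λ i → ℤ.n%ℕd<d (+ X i ℤ.- + r ℤ.* + Y i) p))) ⟩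
        Σ< p (λ r → p * A r * a r)                      ≡⟨ Σ-cong p (λ r _ → trans (*-assoc p (A r) (a r)) (cong (p *_) (*-comm (A r) (a r)))) ⟩
        Σ< p (λ r → p * (a r * A r))                    ≡⟨ Σ-*ˡ p p (λ r → a r * A r) ⟩
        p * Σ< p (λ r → a r * A r)                      ≡⟨ cong (p *_) interchange ⟩
        p * Σ< n (λ i → Σ< n (λ j → Σ< p (λ r → a r * c r i j)))  ≤⟨ *-monoʳ-≤ p (Σ-mono n (λ i _ → Σ-mono n (λ j _ → coincidence i j (i ≟ j)))) ⟩
        p * Σ< n (λ i → Σ< n (λ j → v p (form i j) + ⟦ i ≟ j ⟧ * R))   ≡⟨ cong (p *_) (Σ-cong n (λ i i<n → trans (Σ-+ n (λ j → v p (form i j)) (λ j → ⟦ i ≟ j ⟧ * R)) (cong (λ t → Σ< n (λ j → v p (form i j)) + t) (Σ-delta n i (λ _ → R) i<n)))) ⟩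
        p * Σ< n (λ i → Σ< n (λ j → v p (form i j)) + R)  ≡⟨ cong (p *_) (trans (Σ-+ n (λ i → Σ< n (λ j → v p (form i j))) (λ _ → R)) (cong (λ t → weight + t) (Σ-const n R))) ⟩
        p * (weight + n * R) ∎
        where
        open ≤-Reasoning
        R = roots h sifted pp b<p
        c : ℕ → ℕ → ℕ → ℕ
        c r i j = ⟦ κ r j ≟ κ r i ⟧
        A : ℕ → ℕ
        A r = Σ< n (λ i → Σ< n (λ j → c r i j))
        interchange : Σ< p (λ r → a r * A r) ≡ Σ< n (λ i → Σ< n (λ j → Σ< p (λ r → a r * c r i j)))
        interchange = trans (Σ-cong p (λ r _ → trans (sym (Σ-*ˡ n (a r) (λ i → Σ< n (c r i)))) (Σ-cong n (λ i _ → sym (Σ-*ˡ n (a r) (c r i))))))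
          (trans (Σ-swap p n (λ r i → Σ< n (λ j → a r * c r i j))) (Σ-cong n (λ i _ → Σ-swap p n (λ r j → a r * c r i j))))

      7n²ρ≤9N*weight : ∀ N → 4 * p ≤ N → 9 * N ≤ n → 7 * (n * n) * ρ h sifted pp b<p N 0 ≤ 9 * N * weight
      7n²ρ≤9N*weight N = budget p (N / p) (roots h sifted pp b<p) (ρ h sifted pp b<p N 0) weight N n
        (m/n*n≤m N p) (ρ₀≤ h sifted pp b<p N) roots*n²≤

-- The valuation of the product of the values at each prime.

module PrimeByPrime where

  open import Data.Integer.Base as ℤ using (1ℤ)
  import Data.Integer.Properties as ℤ
  open import Data.Nat.Base
  open import Data.Nat.Divisibility using (_∣_; _∣?_; ∣⇒≤)
  open import Data.Nat.DivMod using (_/_; m/n*n≤m; /-monoˡ-≤; /-congʳ; m*n/n≡m; n/1≡n; m/n/o≡m/[n*o]; m<n*o⇒m/o<n)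
  open import Data.Nat.Properties
  open import Data.Nat.Tactic.RingSolver using (solve-∀)
  open IntegerPolynomials
  open LocalCounts
  open Sums
  open Valuation

  *≤⇒≤/ : ∀ {x y} o .{{_ : NonZero o}} → x * o ≤ y → x ≤ y / o
  *≤⇒≤/ {x} o xo≤y = subst (_≤ _) (m*n/n≡m x o) (/-monoˡ-≤ o xo≤y)

  ⌊/^suc⌋ : ∀ n p .{{_ : NonZero p}} k → ⌊ n / p ^ suc k ⌋ ≡ ⌊ (n / p) / p ^ k ⌋
  ⌊/^suc⌋ n p k = sym (m/n/o≡m/[n*o] n p (p ^ k) {{_}} {{m^n≢0 p k}} {{m^n≢0 p (suc k)}})

  -- A geometric series of ratio 1 / p ≤ 1 / 2, summed on floors: n + 2 ⌊n / p⌋ ≤ n + p ⌊n / p⌋ ≤ 2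
  -- n.
  Σ⌊/^⌋≤ : ∀ p .{{_ : NonZero p}} → 1 < p → ∀ K n → Σ< K (λ k → ⌊ n / p ^ k ⌋) ≤ 2 * n
  Σ⌊/^⌋≤ p 1<p zero    n = z≤n
  Σ⌊/^⌋≤ p 1<p (suc K) n = begin
    Σ< (suc K) (λ k → ⌊ n / p ^ k ⌋)                ≡⟨ Σ-head K (λ k → ⌊ n / p ^ k ⌋) ⟩
    n / 1 + Σ< K (λ k → ⌊ n / p ^ suc k ⌋)          ≡⟨ cong₂ _+_ (n/1≡n n) (Σ-cong K (λ k _ → ⌊/^suc⌋ n p k)) ⟩
    n + Σ< K (λ k → ⌊ (n / p) / p ^ k ⌋)              ≤⟨ +-monoʳ-≤ n (Σ⌊/^⌋≤ p 1<p K (n / p)) ⟩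
    n + 2 * (n / p)                                 ≤⟨ +-monoʳ-≤ n (*-monoˡ-≤ (n / p) 1<p) ⟩
    n + p * (n / p)                                 ≡⟨ cong (n +_) (*-comm p (n / p)) ⟩
    n + n / p * p                                   ≤⟨ +-monoʳ-≤ n (m/n*n≤m n p) ⟩
    n + n                                           ≡⟨ cong (n +_) (+-identityʳ n) ⟨
    2 * n ∎
    where open ≤-Reasoning

  -- The comparison 1 / j² ≤ 1 / (j - 1) - 1 / j, carried out on floors; the extra term N / (b + K)
  -- is what makes the induction telescope.
  telescope : ∀ N b .{{_ : NonZero b}} → ∀ K → Σ< K (λ i → N / suc (b + i) / suc (b + i)) + _/_ N (b + K) {{>-nonZero (≤-trans (>-nonZero⁻¹ b) (m≤m+n b K))}} ≤ N / b
  telescope N b zero    = ≤-reflexive (/-congʳ {{_}} {{_}} (+-identityʳ b))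
  telescope N b (suc K) = begin
    S + t + _/_ N (b + suc K) {{_}}     ≡⟨ cong (λ q → S + t + q) (/-congʳ {{_}} {{_}} (+-suc b K)) ⟩
    S + t + m                           ≡⟨ +-assoc S t m ⟩
    S + (t + m)                         ≤⟨ +-monoʳ-≤ S (*≤⇒≤/ (b + K) {{b+K≢0}} (+-cancelʳ-≤ (t + m) _ _ bound)) ⟩
    S + _/_ N (b + K) {{b+K≢0}}         ≤⟨ telescope N b K ⟩
    N / b ∎
    where
    open ≤-Reasoning
    b+K≢0 : NonZero (b + K)
    b+K≢0 = >-nonZero (≤-trans (>-nonZero⁻¹ b) (m≤m+n b K))
    S = Σ< K (λ i → N / suc (b + i) / suc (b + i))
    j = suc (b + K)
    m = N / j
    t = m / j
    bound : (t + m) * (b + K) + (t + m) ≤ N + (t + m)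
    bound = begin
      (t + m) * (b + K) + (t + m)    ≡⟨ lemma t m (b + K) ⟩
      t * j + m * j                  ≤⟨ +-mono-≤ (m/n*n≤m m j) (m/n*n≤m N j) ⟩
      m + N                          ≡⟨ +-comm m N ⟩
      N + m                          ≤⟨ +-monoʳ-≤ N (m≤n+m m t) ⟩
      N + (t + m) ∎
      where
      lemma : ∀ t m b → (t + m) * b + (t + m) ≡ t * suc b + m * suc b
      lemma = solve-∀

  root-≤ : ∀ k .{{_ : NonZero k}} {x y} → x ^ k ≤ y ^ k → x ≤ y
  root-≤ k {x} {y} xᵏ≤yᵏ with ≤-total x y
  ... | inj₁ x≤y = x≤y
  ... | inj₂ y≤x with m≤n⇒m<n∨m≡n y≤x
  ...   | inj₁ y<x  = contradiction xᵏ≤yᵏ (<⇒≱ (^-monoˡ-< k y<x))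
  ...   | inj₂ refl = ≤-refl

  module _ {d : ℕ} (h : Poly d) {b : ℕ} (sifted : Sifted h b) where

    -- A root n would give the nontrivial zero (n, 1) of the form.
    H≢0 : ∀ n → NonZero (H h n)
    H≢0 n = ≢-nonZero λ H≡0 →
      contradiction (proj₂ (Sifted.anisotropic sifted (ℤ.+ n) 1ℤ (trans (hom[x,1] h (ℤ.+ n)) (ℤ.∣i∣≡0⇒i≡0 H≡0)))) λ ()

    module _ (N L : ℕ) .{{L≢0 : NonZero L}} (H∣L : ∀ i → i < N → H h (suc i) ∣ L) where

      values : ℕ
      values = Π< N (λ i → H h (suc i))

      module _ {p : ℕ} (pp : Prime p) (b<p : b < p) where

        private instance
          p≢0 : NonZero p
          p≢0 = prime⇒nonZero pp

        private
          ρN : ℕ → ℕ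
          ρN = ρ h sifted pp b<p N

          [_] : ℕ → ℕ
          [ k ] = ⟦ p ^ suc k ∣? L ⟧

          Σ[]≡v : Σ< L [_] ≡ v p L
          Σ[]≡v = v-count (prime>1 pp) L ≤-refl

        -- Each value divides `L`, so exponents up to `L` serve for all of them and the sums over
        -- values and over powers can be exchanged.
        v-values : v p values ≡ Σ< L ρN
        v-values = trans (v-Π pp N (λ i → H h (suc i)) (λ i _ → H≢0 (suc i)))
          (trans (Σ-cong N (λ i i<N → sym (v-count (prime>1 pp) (H h (suc i)) {{H≢0 (suc i)}} (∣⇒≤ (H∣L i i<N)))))
            (Σ-swap N L (λ i k → ⟦ p ^ suc k ∣? H h (suc i) ⟧)))

        -- From p² on, the crude count of d solutions per window suffices: the floors form a
        -- geometric series starting at N / p², and the incomplete windows add d for each power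
        -- dividing `L`.
        higher-powers : ∀ K → suc K ≤ L → Σ< K (λ k → ρN (suc k)) ≤ 2 * d * (N / p / p) + d * v p L
        higher-powers K K<L = begin
          Σ< K (λ k → ρN (suc k))                           ≤⟨ Σ-mono K (λ k _ → each (suc k)) ⟩
          Σ< K (λ k → d * ⌊ N / p ^ suc (suc k) ⌋ + d * [ suc k ])   ≡⟨ Σ-+ K (λ k → d * ⌊ N / p ^ suc (suc k) ⌋) (λ k → d * [ suc k ]) ⟩
          Σ< K (λ k → d * ⌊ N / p ^ suc (suc k) ⌋) + Σ< K (λ k → d * [ suc k ])  ≡⟨ cong₂ _+_ (Σ-*ˡ K d (λ k → ⌊ N / p ^ suc (suc k) ⌋)) (Σ-*ˡ K d (λ k → [ suc k ])) ⟩
          d * Σ< K (λ k → ⌊ N / p ^ suc (suc k) ⌋) + d * Σ< K (λ k → [ suc k ])  ≤⟨ +-mono-≤ (*-monoʳ-≤ d floors) (*-monoʳ-≤ d divisors) ⟩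
          d * (2 * (N / p / p)) + d * v p L                 ≡⟨ cong (_+ d * v p L) (trans (sym (*-assoc d 2 _)) (cong (_* (N / p / p)) (*-comm d 2))) ⟩
          2 * d * (N / p / p) + d * v p L ∎
          where
          open ≤-Reasoning
          each : ∀ k → ρN k ≤ d * ⌊ N / p ^ suc k ⌋ + d * [ k ]
          each k = ≤-trans (ρ≤ h sifted pp b<p N L H∣L k) (≤-trans (≤-reflexive (*-distribˡ-+ [ k ] (d * ⌊ N / p ^ suc k ⌋) d))
            (+-mono-≤ (≤-trans (*-monoˡ-≤ (d * ⌊ N / p ^ suc k ⌋) (⟦⟧≤1 (p ^ suc k ∣? L))) (≤-reflexive (*-identityˡ _))) (≤-reflexive (*-comm [ k ] d))))
          floors : Σ< K (λ k → ⌊ N / p ^ suc (suc k) ⌋) ≤ 2 * (N / p / p)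
          floors = ≤-trans (≤-reflexive (Σ-cong K (λ k _ → trans (⌊/^suc⌋ N p (suc k)) (⌊/^suc⌋ (N / p) p k)))) (Σ⌊/^⌋≤ p (prime>1 pp) K (N / p / p))
          divisors : Σ< K (λ k → [ suc k ]) ≤ v p L
          divisors = begin
            Σ< K (λ k → [ suc k ])          ≤⟨ m≤n+m _ [ 0 ] ⟩
            [ 0 ] + Σ< K (λ k → [ suc k ])  ≡⟨ Σ-head K [_] ⟨
            Σ< (suc K) [_]                  ≤⟨ Σ-monoˡ [_] K<L ⟩
            Σ< L [_]                        ≡⟨ Σ[]≡v ⟩
            v p L ∎

        -- Since N / p ≤ 3, at most 4 windows with d solutions each occur, and there is no solution
        -- at all unless p ∣ L.
        large-prime : N < 4 * p → ρN 0 ≤ 4 * d * v p L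
        large-prime N<4p = begin
          ρN 0                                   ≤⟨ ρ≤ h sifted pp b<p N L H∣L 0 ⟩
          [ 0 ] * (d * ⌊ N / p ^ 1 ⌋ + d)        ≤⟨ *-monoʳ-≤ [ 0 ] (+-monoˡ-≤ d (*-monoʳ-≤ d three)) ⟩
          [ 0 ] * (d * 3 + d)                    ≡⟨ lemma [ 0 ] d ⟩
          4 * d * [ 0 ]                          ≤⟨ *-monoʳ-≤ (4 * d) (≤-trans (Σ-term L [_] 0 (>-nonZero⁻¹ L)) (≤-reflexive Σ[]≡v)) ⟩
          4 * d * v p L ∎
          where
          open ≤-Reasoning
          lemma : ∀ x d → x * (d * 3 + d) ≡ 4 * d * x
          lemma = solve-∀
          three : ⌊ N / p ^ 1 ⌋ ≤ 3
          three = ≤-trans (≤-reflexive (trans (⌊/^suc⌋ N p 0) (n/1≡n (N / p)))) (s≤s⁻¹ (m<n*o⇒m/o<n {N} {4} {p} N<4p))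

        module _ (M : ℕ) .{{_ : NonZero M}} (9N≤M² : 9 * N ≤ M * M) where

          open Box h M

          private
            m = 7 * (M * M * (M * M))

          -- The factor `m` clears the denominator of 9 N / (7 n²), the rate at which the forms pay
          -- for the simple divisibilities by p. In 5 d, the share of the lcm, 4 d stems from a
          -- prime above N / 4 and d from the higher powers.
          v-values≤ : m * v p values ≤ 9 * N * weight sifted pp b<p + m * (2 * d * (N / p / p)) + m * (5 * d) * v p L
          v-values≤ = ≤-trans (≤-reflexive (cong (m *_) (trans v-values (split L)))) (bound (≤-total (4 * p) N))
            where
            open ≤-Reasoning
            w = weight sifted pp b<p
            e = 2 * d * (N / p / p)
            rest = Σ< (pred L) (λ k → ρN (suc k))
            split : ∀ L .{{_ : NonZero L}} → Σ< L ρN ≡ ρN 0 + Σ< (pred L) (λ k → ρN (suc k))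
            split (suc L) = Σ-head L ρN
            rest≤ : rest ≤ e + d * v p L
            rest≤ = higher-powers (pred L) (≤-reflexive (suc-pred L))
            bound : _ → m * (ρN 0 + rest) ≤ 9 * N * w + m * e + m * (5 * d) * v p L
            bound (inj₁ 4p≤N) = begin
              m * (ρN 0 + rest)                          ≡⟨ *-distribˡ-+ m (ρN 0) rest ⟩
              m * ρN 0 + m * rest                        ≤⟨ +-mono-≤ (7n²ρ≤9N*weight sifted pp b<p N 4p≤N 9N≤M²) (*-monoʳ-≤ m rest≤) ⟩
              9 * N * w + m * (e + d * v p L)            ≡⟨ lemma (9 * N * w) m e d (v p L) ⟩
              9 * N * w + m * e + m * (1 * d) * v p L    ≤⟨ +-monoʳ-≤ (9 * N * w + m * e) (*-monoˡ-≤ (v p L) (*-monoʳ-≤ m (*-monoˡ-≤ d (s≤s {n = 4} z≤n)))) ⟩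
              9 * N * w + m * e + m * (5 * d) * v p L ∎
              where
              lemma : ∀ x m e d y → x + m * (e + d * y) ≡ x + m * e + m * (1 * d) * y
              lemma = solve-∀
            bound (inj₂ N≤4p) with m≤n⇒m<n∨m≡n N≤4p
            ... | inj₂ N≡4p = bound (inj₁ (≤-reflexive (sym N≡4p)))
            ... | inj₁ N<4p = begin
              m * (ρN 0 + rest)                               ≤⟨ *-monoʳ-≤ m (+-mono-≤ (large-prime N<4p) rest≤) ⟩
              m * (4 * d * v p L + (e + d * v p L))           ≡⟨ lemma m d (v p L) e ⟩
              m * e + m * (5 * d) * v p L                     ≤⟨ +-monoˡ-≤ (m * (5 * d) * v p L) (m≤n+m (m * e) (9 * N * w)) ⟩
              9 * N * w + m * e + m * (5 * d) * v p L ∎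
              where
              lemma : ∀ m d y e → m * (4 * d * y + (e + d * y)) ≡ m * e + m * (5 * d) * y
              lemma = solve-∀

-- Sizes of factorials, of the allowance for higher powers, and of the box.

module Sizes where

  open import Data.Nat.Base
  open import Data.Nat.Divisibility using (_∣_)
  open import Data.Nat.DivMod using (_/_; m/n*n≤m; m<n⇒m/n≡0; 0/n≡0)
  open import Data.Nat.Properties
  open import Data.Nat.Tactic.RingSolver using (solve-∀)
  open PrimeByPrime
  open Sums
  open Valuation

  ^-distribʳ-* : ∀ x y n → (x * y) ^ n ≡ x ^ n * y ^ n
  ^-distribʳ-* x y zero    = refl
  ^-distribʳ-* x y (suc n) = trans (cong (x * y *_) (^-distribʳ-* x y n)) (lemma x y (x ^ n) (y ^ n))
    where
    lemma : ∀ x y a b → x * y * (a * b) ≡ x * a * (y * b)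
    lemma = solve-∀

  ^-swap : ∀ x m n → (x ^ m) ^ n ≡ (x ^ n) ^ m
  ^-swap x m n = trans (^-*-assoc x m n) (trans (cong (x ^_) (*-comm m n)) (sym (^-*-assoc x n m)))

  -- In place of Stirling's formula: N! N ^ N ≤ (2 N)! ≤ 4 ^ N (N!)², the second step by induction
  -- with (2 N + 1) (2 N + 2) ≤ 4 (N + 1)².
  N^N≤4^N*N! : ∀ N → N ^ N ≤ 4 ^ N * Π< N suc
  N^N≤4^N*N! N = *-cancelˡ-≤ (Π< N suc) {{Π-nonZero N (λ _ _ → _)}} (begin
    Π< N suc * N ^ N                         ≡⟨ cong (Π< N suc *_) (Π-const N N) ⟨
    Π< N suc * Π< N (λ _ → N)                ≤⟨ *-monoʳ-≤ (Π< N suc) (Π-mono N (λ i _ → m≤n⇒m≤1+n (m≤m+n N i))) ⟩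
    Π< N suc * Π< N (λ i → suc (N + i))      ≡⟨ Π-split N N ⟨
    Π< (N + N) suc                           ≤⟨ central N ⟩
    4 ^ N * (Π< N suc * Π< N suc)            ≡⟨ rearrange (4 ^ N) (Π< N suc) ⟩
    Π< N suc * (4 ^ N * Π< N suc) ∎)
    where
    open ≤-Reasoning
    rearrange : ∀ a b → a * (b * b) ≡ b * (a * b)
    rearrange = solve-∀
    Π-split : ∀ m n → Π< (m + n) suc ≡ Π< m suc * Π< n (λ i → suc (m + i))
    Π-split m zero    = trans (cong (λ k → Π< k suc) (+-identityʳ m)) (sym (*-identityʳ _))
    Π-split m (suc n) = trans (cong (λ k → Π< k suc) (+-suc m n)) (trans (cong (_* suc (m + n)) (Π-split m n)) (*-assoc (Π< m suc) _ _))
    central : ∀ N → Π< (N + N) suc ≤ 4 ^ N * (Π< N suc * Π< N suc)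
    central zero    = ≤-refl
    central (suc N) = begin
      Π< (suc N + suc N) suc                                        ≡⟨ cong (λ k → Π< (suc k) suc) (+-suc N N) ⟩
      Π< (N + N) suc * suc (N + N) * suc (suc (N + N))              ≤⟨ *-monoˡ-≤ (suc (suc (N + N))) (*-monoʳ-≤ (Π< (N + N) suc) (n≤1+n (suc (N + N)))) ⟩
      Π< (N + N) suc * suc (suc (N + N)) * suc (suc (N + N))        ≤⟨ *-monoˡ-≤ (suc (suc (N + N))) (*-monoˡ-≤ (suc (suc (N + N))) (central N)) ⟩
      4 ^ N * (Π< N suc * Π< N suc) * suc (suc (N + N)) * suc (suc (N + N))  ≡⟨ lemma (4 ^ N) (Π< N suc) N ⟩
      4 * 4 ^ N * (Π< N suc * suc N * (Π< N suc * suc N)) ∎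
      where
      lemma : ∀ f p N → f * (p * p) * suc (suc (N + N)) * suc (suc (N + N)) ≡ 4 * f * (p * suc N * (p * suc N))
      lemma = solve-∀

  -- Absorbs the contribution of the prime powers p ^ k with p > b and k ≥ 2, as N / p / p = ⌊N / p²⌋.
  E : ℕ → ℕ → ℕ → ℕ
  E d b N = Π< N (λ i → suc (b + i) ^ (2 * d * (N / suc (b + i) / suc (b + i))))

  E≢0 : ∀ d b N → NonZero (E d b N)
  E≢0 d b N = Π-nonZero N (λ i _ → m^n≢0 (suc (b + i)) (2 * d * (N / suc (b + i) / suc (b + i))))

  -- The exponents add up to 2 d S with S ≤ N / b by `telescope`, and the 14th power makes this 28 d
  -- S ≤ b (N / b) ≤ N. This is the origin of 28; the 14th power is the one compared in `combine`.
  E≤ : ∀ d b N .{{_ : NonZero b}} → 28 * d ≤ b → (E d b N ^ 7) ^ 2 ≤ N ^ N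
  E≤ d b zero    28d≤b = ≤-refl
  E≤ d b N@(suc _) 28d≤b = begin
    (E d b N ^ 7) ^ 2                  ≤⟨ ^-monoˡ-≤ 2 (^-monoˡ-≤ 7 bound) ⟩
    ((N ^ (2 * d * S)) ^ 7) ^ 2        ≡⟨ trans (cong (_^ 2) (^-*-assoc N (2 * d * S) 7)) (^-*-assoc N (2 * d * S * 7) 2) ⟩
    N ^ (2 * d * S * 7 * 2)            ≤⟨ ^-monoʳ-≤ N (≤-trans (≤-reflexive (lemma d S)) (≤-trans (*-mono-≤ (≤-trans (m≤m+n S _) (telescope N b N)) 28d≤b) (m/n*n≤m N b))) ⟩
    N ^ N ∎
    where
    open ≤-Reasoning
    S = Σ< N (λ i → N / suc (b + i) / suc (b + i))
    lemma : ∀ d S → 2 * d * S * 7 * 2 ≡ S * (28 * d)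
    lemma = solve-∀
    -- Beyond N the exponent is 0, so every base may be replaced by N.
    factor : ∀ j .{{_ : NonZero j}} → j ^ (2 * d * (N / j / j)) ≤ N ^ (2 * d * (N / j / j))
    factor j with j ≤? N
    ... | yes j≤N = ^-monoˡ-≤ (2 * d * (N / j / j)) j≤N
    ... | no j≰N = ≤-reflexive (trans (cong (j ^_) vanish) (cong (N ^_) (sym vanish)))
      where
      vanish : 2 * d * (N / j / j) ≡ 0
      vanish = trans (cong (2 * d *_) (trans (cong (_/ j) (m<n⇒m/n≡0 (≰⇒> j≰N))) (0/n≡0 j))) (*-zeroʳ (2 * d))
    bound : E d b N ≤ N ^ (2 * d * S)
    bound = begin
      E d b N                                                          ≤⟨ Π-mono N (λ i _ → factor (suc (b + i))) ⟩
      Π< N (λ i → N ^ (2 * d * (N / suc (b + i) / suc (b + i))))       ≡⟨ Π-exponent N N (λ i → 2 * d * (N / suc (b + i) / suc (b + i))) ⟩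
      N ^ Σ< N (λ i → 2 * d * (N / suc (b + i) / suc (b + i)))         ≡⟨ cong (N ^_) (Σ-*ˡ N (2 * d) (λ i → N / suc (b + i) / suc (b + i))) ⟩
      N ^ (2 * d * S) ∎

  v-E : ∀ d b N {p} (pp : Prime p) → b < p → 2 * d * (_/_ (_/_ N p {{prime⇒nonZero pp}}) p {{prime⇒nonZero pp}}) ≤ v p (E d b N)
  v-E d b N {p} pp b<p with p ≤? N
  ... | yes p≤N = ∣⇒≤v (prime>1 pp) _ (E d b N) {{E≢0 d b N}} (subst (_∣ E d b N) (power i p≡)
      (∣Π N (λ i → suc (b + i) ^ (2 * d * (N / suc (b + i) / suc (b + i)))) i (≤-trans (≤-trans (s≤s (m≤n+m i b)) (≤-reflexive p≡)) p≤N)))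
    where
    i = p ∸ suc b
    p≡ : suc (b + i) ≡ p
    p≡ = m+[n∸m]≡n b<p
    power : ∀ i → suc (b + i) ≡ p → suc (b + i) ^ (2 * d * (N / suc (b + i) / suc (b + i))) ≡ p ^ (2 * d * (_/_ (_/_ N p {{prime⇒nonZero pp}}) p {{prime⇒nonZero pp}}))
    power i refl = refl
  ... | no p≰N = ≤-trans (≤-reflexive (trans (cong (2 * d *_) vanish) (*-zeroʳ (2 * d)))) z≤n
    where
    instance _ = prime⇒nonZero pp
    vanish : N / p / p ≡ 0
    vanish = trans (cong (_/ p) (m<n⇒m/n≡0 (≰⇒> p≰N))) (0/n≡0 p)

  sqrt : ∀ N → ∃[ s ] (s * s ≤ N × N < suc s * suc s)
  sqrt zero    = 0 , z≤n , s≤s z≤n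
  sqrt (suc N) with sqrt N
  ... | s , s²≤N , N<s² with suc s * suc s ≤? suc N
  ...   | yes le = suc s , le , ≤-<-trans N<s² (*-mono-< (n<1+n (suc s)) (n<1+n (suc s)))
  ...   | no gt  = s , m≤n⇒m≤1+n s²≤N , ≰⇒> gt

  -- The lower bound makes the diagonal negligible, the upper one keeps the forms at size O(N ^ (d /
  -- 2)). With s = ⌊√N⌋ ≥ 1, the side 3 (s + 1) lies between 3 √N and 6 s.
  boxSize : ∀ N .{{_ : NonZero N}} → ∃[ M ] (NonZero M × 9 * N ≤ M * M × M * M ≤ 36 * N)
  boxSize N@(suc _) with sqrt N
  ... | zero  , _    , s≤s ()
  ... | s@(suc t) , s²≤N , N<s² = 3 * suc s , _ , lower , upper
    where
    open ≤-Reasoning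
    square : ∀ c x → c * x * (c * x) ≡ c * c * (x * x)
    square = solve-∀
    lower : 9 * N ≤ 3 * suc s * (3 * suc s)
    lower = ≤-trans (*-monoʳ-≤ 9 (<⇒≤ N<s²)) (≤-reflexive (sym (square 3 (suc s))))
    upper : 3 * suc s * (3 * suc s) ≤ 36 * N
    upper = begin
      3 * suc s * (3 * suc s)      ≤⟨ *-mono-≤ le le ⟩
      6 * s * (6 * s)              ≡⟨ square 6 s ⟩
      36 * (s * s)                 ≤⟨ *-monoʳ-≤ 36 s²≤N ⟩
      36 * N ∎
      where
      le : 3 * suc s ≤ 6 * s
      le = begin
        3 * suc s        ≤⟨ *-monoʳ-≤ 3 (+-monoˡ-≤ s (s≤s z≤n)) ⟩
        3 * (s + s)      ≡⟨ lemma s ⟩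
        6 * s ∎
        where
        lemma : ∀ s → 3 * (s + s) ≡ 6 * s
        lemma = solve-∀

  -- Here `n` is the number of pairs of points, and the n-th root is taken on both sides. Squaring
  -- then turns the bound `Z` for a form, of order M ^ d, into (M²) ^ d, which is a power of N up to
  -- a constant. The exponent 70 d is 2 · 7 · 5 d.
  squared-sizes : ∀ P W Z E L N n d .{{_ : NonZero n}} → W ≤ Z ^ n →
    P ^ (7 * n) ≤ W ^ (9 * N) * E ^ (7 * n) * L ^ (7 * n * (5 * d)) →
    (P ^ 7) ^ 2 ≤ (Z ^ 2) ^ (9 * N) * (E ^ 7) ^ 2 * L ^ (70 * d)
  squared-sizes P W Z E L N n d W≤ P≤ = begin
    (P ^ 7) ^ 2                                       ≤⟨ ^-monoˡ-≤ 2 (root-≤ n rooted) ⟩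
    (Z ^ (9 * N) * E ^ 7 * L ^ (7 * (5 * d))) ^ 2     ≡⟨ distrib (Z ^ (9 * N)) (E ^ 7) (L ^ (7 * (5 * d))) 2 ⟩
    (Z ^ (9 * N)) ^ 2 * (E ^ 7) ^ 2 * (L ^ (7 * (5 * d))) ^ 2
      ≡⟨ cong₂ _*_ (cong (_* (E ^ 7) ^ 2) (^-swap Z (9 * N) 2)) (trans (^-*-assoc L (7 * (5 * d)) 2) (cong (L ^_) (e d))) ⟩
    (Z ^ 2) ^ (9 * N) * (E ^ 7) ^ 2 * L ^ (70 * d) ∎
    where
    open ≤-Reasoning
    e : ∀ d → 7 * (5 * d) * 2 ≡ 70 * d
    e = solve-∀
    e′ : ∀ n d → 7 * n * (5 * d) ≡ 7 * (5 * d) * n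
    e′ = solve-∀
    distrib : ∀ x y z k → (x * y * z) ^ k ≡ x ^ k * y ^ k * z ^ k
    distrib x y z k = trans (^-distribʳ-* (x * y) z k) (cong (_* z ^ k) (^-distribʳ-* x y k))
    rooted : (P ^ 7) ^ n ≤ (Z ^ (9 * N) * E ^ 7 * L ^ (7 * (5 * d))) ^ n
    rooted = begin
      (P ^ 7) ^ n                                                  ≡⟨ ^-*-assoc P 7 n ⟩
      P ^ (7 * n)                                                  ≤⟨ P≤ ⟩
      W ^ (9 * N) * E ^ (7 * n) * L ^ (7 * n * (5 * d))            ≤⟨ *-monoˡ-≤ (L ^ (7 * n * (5 * d))) (*-monoˡ-≤ (E ^ (7 * n)) (^-monoˡ-≤ (9 * N) W≤)) ⟩
      (Z ^ n) ^ (9 * N) * E ^ (7 * n) * L ^ (7 * n * (5 * d))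
        ≡⟨ cong₂ _*_ (cong₂ _*_ (^-swap Z n (9 * N)) (sym (^-*-assoc E 7 n))) (trans (cong (L ^_) (e′ n d)) (sym (^-*-assoc L (7 * (5 * d)) n))) ⟩
      (Z ^ (9 * N)) ^ n * (E ^ 7) ^ n * (L ^ (7 * (5 * d))) ^ n    ≡⟨ distrib (Z ^ (9 * N)) (E ^ 7) (L ^ (7 * (5 * d))) n ⟨
      (Z ^ (9 * N) * E ^ 7 * L ^ (7 * (5 * d))) ^ n ∎

-- The global inequality N ^ N ≤ L ^ (70 d) for the sifted polynomial.

module LowerEstimate where

  open import Data.Integer.Base as ℤ using (ℤ; 0ℤ; ∣_∣)
  import Data.Integer.Divisibility.Signed as ℤ
  import Data.Integer.Properties as ℤ
  open import Data.Nat.Base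
  open import Data.Nat.Divisibility using (_∣_; ∣⇒≤)
  open import Data.Nat.DivMod using (m%n<n; m<n*o⇒m/o<n)
  open import Data.Nat.Properties
  open import Data.Nat.Tactic.RingSolver using (solve-∀)
  open Sizes
  open PrimeByPrime
  open IntegerPolynomials
  open LocalCounts
  open Sums
  open Valuation

  ∣+m-+n∣≤ : ∀ {m n M} → m ≤ M → n ≤ M → ∣ ℤ.+ m ℤ.- ℤ.+ n ∣ ≤ M
  ∣+m-+n∣≤ {m} {n} m≤M n≤M = ≤-trans (≤-reflexive (cong ∣_∣ (ℤ.[+m]-[+n]≡m⊖n m n))) (≤-trans (ℤ.∣m⊝n∣≤m⊔n m n) (⊔-lub m≤M n≤M))

  module _ {d : ℕ} (h : Poly d) {b : ℕ} .{{_ : NonZero b}} (sifted : Sifted h b) (28d≤b : 28 * d ≤ b) where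

    module _ (B : ℕ) (hom≤ : ∀ u v M → ∣ u ∣ ≤ M → ∣ v ∣ ≤ M → ∣ hom h u v ∣ ≤ B * M ^ d)
      (N L : ℕ) .{{_ : NonZero N}} .{{_ : NonZero L}} (H∣L : ∀ i → i < N → H h (suc i) ∣ L) where

      private
        P = values h sifted N L H∣L

        P≢0 : NonZero P
        P≢0 = Π-nonZero N (λ i _ → H≢0 h sifted (suc i))

      module _ (M : ℕ) .{{M≢0 : NonZero M}} (9N≤M² : 9 * N ≤ M * M) (M²≤36N : M * M ≤ 36 * N) where

        open Box h M

        private
          instance
            n≢0 : NonZero n
            n≢0 = m*n≢0 M M

            nn≢0 : NonZero (n * n)
            nn≢0 = m*n≢0 n n

        W : ℕ
        W = Π< n (λ i → Π< n (form i))

        W≢0 : NonZero W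
        W≢0 = Π-nonZero n (λ i _ → Π-nonZero n (λ j _ → nz-nonZero ∣ hom h (U i j) (V i j) ∣))

        v-W : ∀ {p} (pp : Prime p) (b<p : b < p) → v p W ≡ weight sifted pp b<p
        v-W pp b<p = trans (v-Π pp n (λ i → Π< n (form i)) (λ i _ → Π-nonZero n (λ j _ → nz-nonZero ∣ hom h (U i j) (V i j) ∣)))
          (Σ-cong n (λ i _ → v-Π pp n (form i) (λ j _ → nz-nonZero ∣ hom h (U i j) (V i j) ∣)))

        W≤ : W ≤ (suc B * M ^ d) ^ (n * n)
        W≤ = ≤-trans (Π-≤ n ((suc B * M ^ d) ^ n) (λ i i<n → Π-≤ n (suc B * M ^ d) (λ j j<n → form≤ i j i<n j<n)))
          (≤-reflexive (^-*-assoc (suc B * M ^ d) n n))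
          where
          nz≤ : ∀ m {x} → 1 ≤ x → m ≤ x → nz m ≤ x
          nz≤ zero    1≤x _   = 1≤x
          nz≤ (suc m) _   m≤x = m≤x
          form≤ : ∀ i j → i < n → j < n → form i j ≤ suc B * M ^ d
          form≤ i j i<n j<n = nz≤ _ (*-mono-≤ (s≤s (z≤n {B})) (m^n>0 M d)) (≤-trans
            (hom≤ (U i j) (V i j) M
              (∣+m-+n∣≤ (<⇒≤ (m<n*o⇒m/o<n {i} {M} {M} i<n)) (<⇒≤ (m<n*o⇒m/o<n {j} {M} {M} j<n)))
              (∣+m-+n∣≤ (<⇒≤ (m%n<n i M)) (<⇒≤ (m%n<n j M))))
            (*-monoˡ-≤ (M ^ d) (n≤1+n B)))

        private
          m = 7 * (n * n)
          Eᵇ = E d b N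

          instance
            E≢0′ : NonZero Eᵇ
            E≢0′ = E≢0 d b N

            W^≢0 : NonZero (W ^ (9 * N))
            W^≢0 = m^n≢0 W (9 * N) {{W≢0}}

            E^≢0 : NonZero (Eᵇ ^ m)
            E^≢0 = m^n≢0 Eᵇ m

            L^≢0 : NonZero (L ^ (m * (5 * d)))
            L^≢0 = m^n≢0 L (m * (5 * d))

        v-right : ∀ {p} (pp : Prime p) →
          v p (W ^ (9 * N) * Eᵇ ^ m * L ^ (m * (5 * d))) ≡ 9 * N * v p W + m * v p Eᵇ + m * (5 * d) * v p L
        v-right pp = trans (v-* pp (W ^ (9 * N) * Eᵇ ^ m) (L ^ (m * (5 * d))) {{m*n≢0 (W ^ (9 * N)) (Eᵇ ^ m)}})
          (cong₂ _+_ (trans (v-* pp (W ^ (9 * N)) (Eᵇ ^ m)) (cong₂ _+_ (v-^ pp W {{W≢0}} (9 * N)) (v-^ pp Eᵇ m))) (v-^ pp L (m * (5 * d))))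

        -- Checked at each prime: up to b no value is divisible by p, and above b it is `v-values≤`.
        -- This takes the place of summing the local inequalities against log p.
        P^m∣ : P ^ m ∣ W ^ (9 * N) * Eᵇ ^ m * L ^ (m * (5 * d))
        P^m∣ = v-≤⇒∣ _ _ {{m^n≢0 P m {{P≢0}}}} {{m*n≢0 (W ^ (9 * N) * Eᵇ ^ m) (L ^ (m * (5 * d))) {{m*n≢0 (W ^ (9 * N)) (Eᵇ ^ m)}}}} v≤v
          where
          v≤v : ∀ p → Prime p → v p (P ^ m) ≤ v p (W ^ (9 * N) * Eᵇ ^ m * L ^ (m * (5 * d)))
          v≤v p pp with b <? p
          ... | yes b<p = ≤-trans (≤-reflexive (v-^ pp P {{P≢0}} m)) (≤-trans (v-values≤ h sifted N L H∣L pp b<p M 9N≤M²)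
              (≤-trans (+-monoˡ-≤ (m * (5 * d) * v p L) (+-mono-≤ (≤-reflexive (cong (9 * N *_) (sym (v-W pp b<p)))) (*-monoʳ-≤ m (v-E d b N pp b<p))))
                (≤-reflexive (sym (v-right pp)))))
          ... | no b≮p = ≤-trans (≤-reflexive (trans (v-^ pp P {{P≢0}} m) (trans (cong (m *_) vanish) (*-zeroʳ m)))) z≤n
            where
            vanish : v p P ≡ 0
            vanish = trans (v-Π pp N (λ i → H h (suc i)) (λ i _ → H≢0 h sifted (suc i)))
              (Σ-zero N (λ i _ → ∤⇒v≡0 (prime>1 pp) (λ p∣H → Sifted.values sifted pp (≮⇒≥ b≮p) (suc i) (ℤ.∣ᵤ⇒∣ p∣H))))

        P¹⁴≤ : (P ^ 7) ^ 2 ≤ ((suc B ^ 2 * 36 ^ d) ^ 9) ^ N * N ^ (d * (9 * N)) * N ^ N * L ^ (70 * d)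
        P¹⁴≤ = begin
          (P ^ 7) ^ 2                                             ≤⟨ squared-sizes P W Z Eᵇ L N (n * n) d W≤ (∣⇒≤ {{m*n≢0 (W ^ (9 * N) * Eᵇ ^ m) (L ^ (m * (5 * d))) {{m*n≢0 (W ^ (9 * N)) (Eᵇ ^ m)}}}} P^m∣) ⟩
          (Z ^ 2) ^ (9 * N) * (Eᵇ ^ 7) ^ 2 * L ^ (70 * d)         ≤⟨ *-monoˡ-≤ (L ^ (70 * d)) (*-mono-≤ (≤-trans (^-monoˡ-≤ (9 * N) Z²≤) (≤-reflexive split)) (E≤ d b N 28d≤b)) ⟩
          (A ^ 9) ^ N * N ^ (d * (9 * N)) * N ^ N * L ^ (70 * d) ∎
          where
          open ≤-Reasoning
          Z = suc B * M ^ d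
          A = suc B ^ 2 * 36 ^ d
          Z²≤ : Z ^ 2 ≤ A * N ^ d
          Z²≤ = begin
            Z ^ 2                            ≡⟨ ^-distribʳ-* (suc B) (M ^ d) 2 ⟩
            suc B ^ 2 * (M ^ d) ^ 2          ≡⟨ cong (suc B ^ 2 *_) (trans (^-swap M d 2) (cong (λ x → (M * x) ^ d) (*-identityʳ M))) ⟩
            suc B ^ 2 * (M * M) ^ d          ≤⟨ *-monoʳ-≤ (suc B ^ 2) (^-monoˡ-≤ d M²≤36N) ⟩
            suc B ^ 2 * (36 * N) ^ d         ≡⟨ cong (suc B ^ 2 *_) (^-distribʳ-* 36 N d) ⟩
            suc B ^ 2 * (36 ^ d * N ^ d)     ≡⟨ *-assoc (suc B ^ 2) (36 ^ d) (N ^ d) ⟨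
            A * N ^ d ∎
          split : (A * N ^ d) ^ (9 * N) ≡ (A ^ 9) ^ N * N ^ (d * (9 * N))
          split = trans (^-distribʳ-* A (N ^ d) (9 * N)) (cong₂ _*_ (sym (^-*-assoc A 9 N)) (^-*-assoc N d (9 * N)))

  -- With P the product of the values and K a constant, this is N ^ (14 d N) ≤ K ^ N * N ^ ((9 d + 1) N) * L ^ (70 d).
  combine : ∀ N d K₁ K₂ F P L .{{_ : NonZero N}} → 1 ≤ d → N ^ N ≤ 4 ^ N * F → F ^ d ≤ K₁ ^ N * P →
    (P ^ 7) ^ 2 ≤ K₂ ^ N * N ^ (d * (9 * N)) * N ^ N * L ^ (70 * d) →
    (4 ^ d * K₁) ^ 14 * K₂ ≤ N → N ^ N ≤ L ^ (70 * d)
  combine N d K₁ K₂ F P L 1≤d stirling F≤ P≤ K≤N = *-cancelˡ-≤ (N ^ (9 * d * N + 2 * N)) {{m^n≢0 N (9 * d * N + 2 * N)}} (begin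
    N ^ (9 * d * N + 2 * N) * N ^ N                  ≡⟨ ^-distribˡ-+-* N (9 * d * N + 2 * N) N ⟨
    N ^ (9 * d * N + 2 * N + N)                      ≤⟨ ^-monoʳ-≤ N exponents ⟩
    N ^ (N * d * 14)                                 ≡⟨ trans (cong (_^ 14) (^-*-assoc N N d)) (^-*-assoc N (N * d) 14) ⟨
    ((N ^ N) ^ d) ^ 14                               ≤⟨ ^-monoˡ-≤ 14 (^-monoˡ-≤ d stirling) ⟩
    ((4 ^ N * F) ^ d) ^ 14                           ≡⟨ cong (_^ 14) (trans (^-distribʳ-* (4 ^ N) F d) (cong (_* F ^ d) (^-swap 4 N d))) ⟩
    ((4 ^ d) ^ N * F ^ d) ^ 14                       ≤⟨ ^-monoˡ-≤ 14 (*-monoʳ-≤ ((4 ^ d) ^ N) F≤) ⟩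
    ((4 ^ d) ^ N * (K₁ ^ N * P)) ^ 14                ≡⟨ cong (_^ 14) (trans (sym (*-assoc ((4 ^ d) ^ N) (K₁ ^ N) P)) (cong (_* P) (sym (^-distribʳ-* (4 ^ d) K₁ N)))) ⟩
    ((4 ^ d * K₁) ^ N * P) ^ 14                      ≡⟨ ^-distribʳ-* ((4 ^ d * K₁) ^ N) P 14 ⟩
    ((4 ^ d * K₁) ^ N) ^ 14 * P ^ 14                 ≡⟨ cong₂ _*_ (^-swap (4 ^ d * K₁) N 14) (sym (^-*-assoc P 7 2)) ⟩
    ((4 ^ d * K₁) ^ 14) ^ N * (P ^ 7) ^ 2            ≤⟨ *-monoʳ-≤ (((4 ^ d * K₁) ^ 14) ^ N) P≤ ⟩
    ((4 ^ d * K₁) ^ 14) ^ N * (K₂ ^ N * X * N ^ N * Y)   ≡⟨ rearrange (((4 ^ d * K₁) ^ 14) ^ N) (K₂ ^ N) X (N ^ N) Y ⟩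
    ((4 ^ d * K₁) ^ 14) ^ N * K₂ ^ N * (X * N ^ N * Y)   ≡⟨ cong (_* (X * N ^ N * Y)) (^-distribʳ-* ((4 ^ d * K₁) ^ 14) K₂ N) ⟨
    ((4 ^ d * K₁) ^ 14 * K₂) ^ N * (X * N ^ N * Y)       ≤⟨ *-monoˡ-≤ (X * N ^ N * Y) (^-monoˡ-≤ N K≤N) ⟩
    N ^ N * (X * N ^ N * Y)                              ≡⟨ rearrange′ (N ^ N) X Y ⟩
    X * (N ^ N * N ^ N) * Y                              ≡⟨ cong (_* Y) (trans (cong (X *_) (sym (^-distribˡ-+-* N N N))) (trans (sym (^-distribˡ-+-* N (d * (9 * N)) (N + N))) (cong (N ^_) (e₁ d N)))) ⟩
    N ^ (9 * d * N + 2 * N) * Y ∎)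
    where
    open ≤-Reasoning
    X = N ^ (d * (9 * N))
    Y = L ^ (70 * d)
    e₁ : ∀ d N → d * (9 * N) + (N + N) ≡ 9 * d * N + 2 * N
    e₁ = solve-∀
    e₂ : ∀ d N → 9 * d * N + 2 * N + N ≡ 9 * d * N + 3 * (1 * N)
    e₂ = solve-∀
    e₃ : ∀ d N → 9 * d * N + 5 * (d * N) ≡ N * d * 14
    e₃ = solve-∀
    -- Of the 5 d N left over from 14 d N, one N goes to the constants, as K ^ N ≤ N ^ N, one to the
    -- higher powers, and one remains for the conclusion; d ≥ 1 makes this enough.
    exponents : 9 * d * N + 2 * N + N ≤ N * d * 14
    exponents = begin
      9 * d * N + 2 * N + N          ≡⟨ e₂ d N ⟩
      9 * d * N + 3 * (1 * N)        ≤⟨ +-monoʳ-≤ (9 * d * N) (*-mono-≤ (s≤s (s≤s (s≤s (z≤n {2})))) (*-monoˡ-≤ N 1≤d)) ⟩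
      9 * d * N + 5 * (d * N)        ≡⟨ e₃ d N ⟩
      N * d * 14 ∎
    rearrange : ∀ a b x y z → a * (b * x * y * z) ≡ a * b * (x * y * z)
    rearrange = solve-∀
    rearrange′ : ∀ a x y → a * (x * a * y) ≡ x * (a * a) * y
    rearrange′ = solve-∀

  -- Growth says nothing below n₀. There n ^ d ≤ n₀ ^ d while the value is at least 1, so adding n₀
  -- ^ d to the constant covers these n.
  product-lower-bound : ∀ {d} (h : Poly d) → lead h ≢ 0ℤ → (∀ n → NonZero (H h n)) →
    ∃[ K ] (∀ N → Π< N suc ^ d ≤ K ^ N * Π< N (λ i → H h (suc i)))
  product-lower-bound {d} h l≢0 H≢0 with growth h l≢0
  ... | K , n₀ , grow = K + n₀ ^ d , λ N → begin
    Π< N suc ^ d                               ≡⟨ Π-^ N suc d ⟨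
    Π< N (λ i → suc i ^ d)                     ≤⟨ Π-mono N (λ i _ → each (suc i)) ⟩
    Π< N (λ i → (K + n₀ ^ d) * H h (suc i))    ≡⟨ Π-* N (λ _ → K + n₀ ^ d) (λ i → H h (suc i)) ⟩
    Π< N (λ _ → K + n₀ ^ d) * Π< N (λ i → H h (suc i))   ≡⟨ cong (_* Π< N (λ i → H h (suc i))) (Π-const N (K + n₀ ^ d)) ⟩
    (K + n₀ ^ d) ^ N * Π< N (λ i → H h (suc i)) ∎
    where
    open ≤-Reasoning
    each : ∀ n → n ^ d ≤ (K + n₀ ^ d) * H h n
    each n with n₀ ≤? n
    ... | yes n₀≤n = ≤-trans (grow n n₀≤n) (*-monoˡ-≤ (H h n) (m≤m+n K (n₀ ^ d)))
    ... | no n₀≰n  = ≤-trans (^-monoˡ-≤ d (≰⇒≥ n₀≰n)) (≤-trans (m≤n+m (n₀ ^ d) K) (m≤m*n (K + n₀ ^ d) (H h n) {{H≢0 n}}))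

  -- `L` may be any common multiple of the values, which later allows a constant multiple of the lcm
  -- of the values of f up to `q * N`.
  N^N≤L^70d : ∀ {d} (h : Poly d) {b} → 1 ≤ d → lead h ≢ 0ℤ → Sifted h b → 28 * d ≤ b →
    ∃[ K ] (∀ N L .{{_ : NonZero L}} → K ≤ N → (∀ i → i < N → H h (suc i) ∣ L) → N ^ N ≤ L ^ (70 * d))
  N^N≤L^70d {d} h {b} 1≤d l≢0 sifted 28d≤b with product-lower-bound h l≢0 (H≢0 h sifted) | hom-bound h
  ... | K₁ , product≥ | B , hom≤ = suc K , λ N L K<N H∣L → bound N L {{>-nonZero (≤-trans (s≤s z≤n) K<N)}} (<⇒≤ K<N) H∣L
    where
    K₂ = (suc B ^ 2 * 36 ^ d) ^ 9
    K = (4 ^ d * K₁) ^ 14 * K₂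
    b≢0 : NonZero b
    b≢0 = >-nonZero (≤-trans (*-mono-≤ (s≤s (z≤n {27})) 1≤d) 28d≤b)
    bound : ∀ N L .{{_ : NonZero N}} .{{_ : NonZero L}} → K ≤ N → (∀ i → i < N → H h (suc i) ∣ L) → N ^ N ≤ L ^ (70 * d)
    bound N L K≤N H∣L with boxSize N
    ... | M , M≢0 , 9N≤M² , M²≤36N = combine N d K₁ K₂ (Π< N suc) (Π< N (λ i → H h (suc i))) L 1≤d (N^N≤4^N*N! N) (product≥ N)
      (P¹⁴≤ h {{b≢0}} sifted 28d≤b B hom≤ N L H∣L M {{M≢0}} 9N≤M² M²≤36N) K≤N

-- Riemann sums of the logarithm compared with binary lengths.

module LogComparison where

  open import Data.Integer.Base as ℤ using (ℤ)
  import Data.Integer.Properties as ℤ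
  open import Data.Nat.Base as ℕ using (ℕ; zero; suc; z≤n; s≤s)
  import Data.Nat.Properties as ℕ
  import Data.Nat.Tactic.RingSolver as ℕSolver
  open import Data.Rational.Base
  import Data.Rational.Properties as ℚ
  import Data.Rational.Unnormalised.Base as ℚᵘ
  import Data.Rational.Unnormalised.Properties as ℚᵘ

  fraction-≤ : ∀ a b c d → a ℕ.* suc d ℕ.≤ c ℕ.* suc b → ℤ.+ a / suc b ≤ ℤ.+ c / suc d
  fraction-≤ a b c d ad≤cb = ℚ.toℚᵘ-cancel-≤
    (ℚᵘ.≤-respʳ-≃ (ℚᵘ.≃-sym (ℚ.toℚᵘ-fromℚᵘ (ℚᵘ.mkℚᵘ (ℤ.+ c) d)))
    (ℚᵘ.≤-respˡ-≃ (ℚᵘ.≃-sym (ℚ.toℚᵘ-fromℚᵘ (ℚᵘ.mkℚᵘ (ℤ.+ a) b)))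
    (ℚᵘ.*≤* (subst₂ ℤ._≤_ (ℤ.pos-* a (suc d)) (ℤ.pos-* c (suc b)) (ℤ.+≤+ ad≤cb)))))

  ι : ℕ → ℚ
  ι n = ℤ.+ n / 1

  ι-mono : ∀ {m n} → m ℕ.≤ n → ι m ≤ ι n
  ι-mono {m} {n} m≤n = fraction-≤ m 0 n 0 (ℕ.*-monoˡ-≤ 1 m≤n)

  ι-+ : ∀ m n → ι (m ℕ.+ n) ≡ ι m + ι n
  ι-+ m n = ℚ.toℚᵘ-injective
    (ℚᵘ.≃-trans (ℚ.toℚᵘ-fromℚᵘ (ℚᵘ.mkℚᵘ (ℤ.+ (m ℕ.+ n)) 0))
    (ℚᵘ.≃-trans (ℚᵘ.*≡* (cong (ℤ._* ℤ.+ 1) (sym (cong₂ ℤ._+_ (ℤ.*-identityʳ (ℤ.+ m)) (ℤ.*-identityʳ (ℤ.+ n))))))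
    (ℚᵘ.≃-trans (ℚᵘ.≃-sym (ℚᵘ.+-cong (ℚ.toℚᵘ-fromℚᵘ (ℚᵘ.mkℚᵘ (ℤ.+ m) 0)) (ℚ.toℚᵘ-fromℚᵘ (ℚᵘ.mkℚᵘ (ℤ.+ n) 0))))
    (ℚᵘ.≃-sym (ℚ.toℚᵘ-homo-+ (ι m) (ι n))))))

  fraction-* : ∀ m a b → ι m * (ℤ.+ a / suc b) ≡ ℤ.+ (m ℕ.* a) / suc b
  fraction-* m a b = ℚ.toℚᵘ-injective
    (ℚᵘ.≃-trans (ℚ.toℚᵘ-homo-* (ι m) (ℤ.+ a / suc b))
    (ℚᵘ.≃-trans (ℚᵘ.*-cong (ℚ.toℚᵘ-fromℚᵘ (ℚᵘ.mkℚᵘ (ℤ.+ m) 0)) (ℚ.toℚᵘ-fromℚᵘ (ℚᵘ.mkℚᵘ (ℤ.+ a) b)))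
    (ℚᵘ.≃-trans (ℚᵘ.*≡* (cong₂ ℤ._*_ (sym (ℤ.pos-* m a)) (sym (cong ℤ.+_ (ℕ.*-identityˡ (suc b))))))
    (ℚᵘ.≃-sym (ℚ.toℚᵘ-fromℚᵘ (ℚᵘ.mkℚᵘ (ℤ.+ (m ℕ.* a)) b))))))

  ι-* : ∀ m n → ι (m ℕ.* n) ≡ ι m * ι n
  ι-* m n = sym (fraction-* m n 0)

  ι-nonNeg : ∀ n → NonNegative (ι n)
  ι-nonNeg n = ℚ.normalize-nonNeg n 1

  reciprocals-split : ∀ m a b → reciprocals m (a ℕ.+ b) ≡ reciprocals m a + reciprocals (m ℕ.+ a) b
  reciprocals-split m a zero    = trans (cong (reciprocals m) (ℕ.+-identityʳ a)) (sym (ℚ.+-identityʳ (reciprocals m a)))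
  reciprocals-split m a (suc b) = trans (cong (reciprocals m) (ℕ.+-suc a b))
    (trans (cong₂ (λ x k → x + ℤ.+ 1 / suc k) (reciprocals-split m a b) (sym (ℕ.+-assoc m a b)))
      (ℚ.+-assoc (reciprocals m a) (reciprocals (m ℕ.+ a) b) _))

  reciprocals-≥0 : ∀ m k → 0ℚ ≤ reciprocals m k
  reciprocals-≥0 m zero    = ℚ.≤-refl
  reciprocals-≥0 m (suc k) = ℚ.+-mono-≤ (reciprocals-≥0 m k) (fraction-≤ 0 0 1 (m ℕ.+ k) z≤n)

  reciprocals-mono : ∀ m {a b} → a ℕ.≤ b → reciprocals m a ≤ reciprocals m b
  reciprocals-mono m {a} {b} a≤b = begin
    reciprocals m a                                       ≡⟨ ℚ.+-identityʳ _ ⟨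
    reciprocals m a + 0ℚ                                  ≤⟨ ℚ.+-monoʳ-≤ (reciprocals m a) (reciprocals-≥0 (m ℕ.+ a) (b ℕ.∸ a)) ⟩
    reciprocals m a + reciprocals (m ℕ.+ a) (b ℕ.∸ a)     ≡⟨ reciprocals-split m a (b ℕ.∸ a) ⟨
    reciprocals m (a ℕ.+ (b ℕ.∸ a))                       ≡⟨ cong (reciprocals m) (ℕ.m+[n∸m]≡n a≤b) ⟩
    reciprocals m b ∎
    where open ℚ.≤-Reasoning

  ι[1+k]*x : ∀ k x → ι (suc k) * x ≡ ι k * x + x
  ι[1+k]*x k x = trans (cong (_* x) (trans (cong ι (ℕ.+-comm 1 k)) (ι-+ k 1)))
    (trans (ℚ.*-distribʳ-+ x (ι k) 1ℚ) (cong (λ t → ι k * x + t) (ℚ.*-identityˡ x)))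

  reciprocals-upper : ∀ m k → reciprocals m k ≤ ι k * (ℤ.+ 1 / suc m)
  reciprocals-upper m zero    = ℚ.≤-reflexive (sym (ℚ.*-zeroˡ (ℤ.+ 1 / suc m)))
  reciprocals-upper m (suc k) = ℚ.≤-trans
    (ℚ.+-mono-≤ (reciprocals-upper m k) (fraction-≤ 1 (m ℕ.+ k) 1 m (ℕ.*-monoʳ-≤ 1 (s≤s (ℕ.m≤m+n m k)))))
    (ℚ.≤-reflexive (sym (ι[1+k]*x k (ℤ.+ 1 / suc m))))

  reciprocals-lower : ∀ m k n → k ℕ.≤ n → ι k * (ℤ.+ 1 / suc (m ℕ.+ n)) ≤ reciprocals m k
  reciprocals-lower m zero    n _   = ℚ.≤-reflexive (ℚ.*-zeroˡ (ℤ.+ 1 / suc (m ℕ.+ n)))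
  reciprocals-lower m (suc k) n k<n = ℚ.≤-trans
    (ℚ.≤-reflexive (ι[1+k]*x k (ℤ.+ 1 / suc (m ℕ.+ n))))
    (ℚ.+-mono-≤ (reciprocals-lower m k n (ℕ.<⇒≤ k<n)) (fraction-≤ 1 (m ℕ.+ n) 1 (m ℕ.+ k) (ℕ.*-monoʳ-≤ 1 (s≤s (ℕ.+-monoʳ-≤ m (ℕ.<⇒≤ k<n))))))

  2^n-1 : ℕ → ℕ
  2^n-1 zero    = 0
  2^n-1 (suc n) = 2^n-1 n ℕ.+ suc (2^n-1 n)

  2^n : ∀ n → 2 ℕ.^ n ≡ suc (2^n-1 n)
  2^n zero    = refl
  2^n (suc n) rewrite 2^n n = cong (λ t → suc (2^n-1 n) ℕ.+ t) (ℕ.+-identityʳ _)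

  -- In mesh 1 / s, passing from 2 ^ n to 2 ^ (n + 1) adds q = s · 2 ^ n terms, each at most 1 / (q
  -- + 1), hence less than 1 in all.
  dyadic-upper : ∀ s′ n → reciprocals (suc s′) (suc s′ ℕ.* 2^n-1 n) ≤ ι n
  dyadic-upper s′ zero    = ℚ.≤-reflexive (cong (reciprocals (suc s′)) (ℕ.*-zeroʳ (suc s′)))
  dyadic-upper s′ (suc n) = begin
    reciprocals s (s ℕ.* (2^n-1 n ℕ.+ suc (2^n-1 n)))                 ≡⟨ cong (reciprocals s) (ℕ.*-distribˡ-+ s (2^n-1 n) (suc (2^n-1 n))) ⟩
    reciprocals s (s ℕ.* 2^n-1 n ℕ.+ q)                               ≡⟨ reciprocals-split s (s ℕ.* 2^n-1 n) q ⟩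
    reciprocals s (s ℕ.* 2^n-1 n) + reciprocals (s ℕ.+ s ℕ.* 2^n-1 n) q   ≤⟨ ℚ.+-mono-≤ (dyadic-upper s′ n) (reciprocals-upper (s ℕ.+ s ℕ.* 2^n-1 n) q) ⟩
    ι n + ι q * (ℤ.+ 1 / suc (s ℕ.+ s ℕ.* 2^n-1 n))                   ≡⟨ cong (λ t → ι n + ι q * (ℤ.+ 1 / suc t)) (sym (ℕ.*-suc s (2^n-1 n))) ⟩
    ι n + ι q * (ℤ.+ 1 / suc q)                                       ≡⟨ cong (λ t → ι n + t) (fraction-* q 1 q) ⟩
    ι n + ℤ.+ (q ℕ.* 1) / suc q                                       ≤⟨ ℚ.+-monoʳ-≤ (ι n) (fraction-≤ (q ℕ.* 1) q 1 0 le) ⟩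
    ι n + ι 1                                                         ≡⟨ trans (cong ι (ℕ.+-comm 1 n)) (ι-+ n 1) ⟨
    ι (suc n) ∎
    where
    open ℚ.≤-Reasoning
    s = suc s′
    q = s ℕ.* suc (2^n-1 n)
    le : q ℕ.* 1 ℕ.* 1 ℕ.≤ 1 ℕ.* suc q
    le = ℕ.≤-trans (ℕ.≤-reflexive (trans (ℕ.*-identityʳ (q ℕ.* 1)) (ℕ.*-identityʳ q))) (ℕ.≤-trans (ℕ.n≤1+n q) (ℕ.≤-reflexive (sym (ℕ.*-identityˡ (suc q)))))

  -- The q = 2 ^ n terms after 1 / q are at least 1 / (2 q + 1) each, so every doubling adds at
  -- least 1/3, already in mesh 1.
  dyadic-lower : ∀ n → ι n ≤ ι 3 * reciprocals 1 (2^n-1 n)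
  dyadic-lower zero    = ℚ.≤-refl
  dyadic-lower (suc n) = begin
    ι (suc n)                                                     ≡⟨ trans (cong ι (ℕ.+-comm 1 n)) (ι-+ n 1) ⟩
    ι n + ι 1                                                     ≤⟨ ℚ.+-mono-≤ (dyadic-lower n) (fraction-≤ 1 0 (3 ℕ.* (q ℕ.* 1)) (q ℕ.+ q) le) ⟩
    ι 3 * R + ℤ.+ (3 ℕ.* (q ℕ.* 1)) / suc (q ℕ.+ q)               ≡⟨ cong (λ t → ι 3 * R + t) (trans (cong (ι 3 *_) (fraction-* q 1 (q ℕ.+ q))) (fraction-* 3 (q ℕ.* 1) (q ℕ.+ q))) ⟨
    ι 3 * R + ι 3 * (ι q * (ℤ.+ 1 / suc (q ℕ.+ q)))               ≤⟨ ℚ.+-monoʳ-≤ (ι 3 * R) (ℚ.*-monoˡ-≤-nonNeg (ι 3) (reciprocals-lower q q q ℕ.≤-refl)) ⟩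
    ι 3 * R + ι 3 * reciprocals q q                               ≡⟨ ℚ.*-distribˡ-+ (ι 3) R (reciprocals q q) ⟨
    ι 3 * (R + reciprocals q q)                                   ≡⟨ cong (ι 3 *_) (reciprocals-split 1 (2^n-1 n) q) ⟨
    ι 3 * reciprocals 1 (2^n-1 n ℕ.+ q) ∎
    where
    open ℚ.≤-Reasoning
    q = suc (2^n-1 n)
    R = reciprocals 1 (2^n-1 n)
    le : 1 ℕ.* suc (q ℕ.+ q) ℕ.≤ 3 ℕ.* (q ℕ.* 1) ℕ.* 1
    le = ℕ.≤-trans (ℕ.≤-reflexive (ℕ.*-identityˡ (suc (q ℕ.+ q)))) (ℕ.≤-trans (ℕ.+-monoˡ-≤ (q ℕ.+ q) (s≤s (z≤n {2^n-1 n}))) (ℕ.≤-reflexive (lemma q)))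
      where
      lemma : ∀ q → q ℕ.+ (q ℕ.+ q) ≡ 3 ℕ.* (q ℕ.* 1) ℕ.* 1
      lemma = ℕSolver.solve-∀

  lowerSum-upper : ∀ n m ℓ → n ℕ.≤ 2 ℕ.^ ℓ → lowerSum n m ≤ ι ℓ
  lowerSum-upper n m ℓ n≤ = ℚ.≤-trans
    (reciprocals-mono (suc m) (ℕ.*-monoʳ-≤ (suc m) (ℕ.≤-trans (ℕ.∸-monoˡ-≤ 1 n≤) (ℕ.≤-reflexive (cong (ℕ._∸ 1) (2^n ℓ))))))
    (dyadic-upper m ℓ)

  lowerSum-lower : ∀ n ℓ → 2 ℕ.^ ℓ ℕ.≤ n → ι ℓ ≤ ι 3 * lowerSum n 0
  lowerSum-lower n ℓ ≤n = ℚ.≤-trans (dyadic-lower ℓ)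
    (ℚ.*-monoˡ-≤-nonNeg (ι 3) (reciprocals-mono 1
      (ℕ.≤-trans (ℕ.≤-reflexive (cong (ℕ._∸ 1) (sym (2^n ℓ)))) (ℕ.≤-trans (ℕ.∸-monoˡ-≤ 1 ≤n) (ℕ.≤-reflexive (sym (ℕ.*-identityˡ (n ℕ.∸ 1))))))))

  binaryLength : ∀ n → 1 ℕ.≤ n → ∃[ ℓ ] (2 ℕ.^ ℓ ℕ.≤ n × n ℕ.< 2 ℕ.^ suc ℓ)
  binaryLength (suc zero)      _ = 0 , ℕ.≤-refl , ℕ.≤-refl
  binaryLength (suc n@(suc _)) _ with binaryLength n (s≤s z≤n)
  ... | ℓ , ≤n , n< with 2 ℕ.^ suc ℓ ℕ.≤? suc n
  ...   | yes le = suc ℓ , le , ℕ.≤-<-trans n< (ℕ.<-≤-trans (ℕ.m<m+n _ (ℕ.m^n>0 2 (suc ℓ))) (ℕ.≤-reflexive (cong (λ t → 2 ℕ.^ suc ℓ ℕ.+ t) (sym (ℕ.+-identityʳ _)))))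
  ...   | no gt  = ℓ , ℕ.m≤n⇒m≤1+n ≤n , ℕ.≰⇒> gt

  exponent-≤ : ∀ {x y} → 2 ℕ.^ x ℕ.≤ 2 ℕ.^ y → x ℕ.≤ y
  exponent-≤ {x} {y} le with x ℕ.≤? y
  ... | yes x≤y = x≤y
  ... | no x≰y  = contradiction le (ℕ.<⇒≱ (ℕ.^-monoʳ-< 2 ℕ.≤-refl (ℕ.≰⇒> x≰y)))

  private
    positive-length : ∀ {n} → 2 ℕ.≤ n → ∀ ℓ → n ℕ.< 2 ℕ.^ suc ℓ → 1 ℕ.≤ ℓ
    positive-length 2≤n zero    n<2 = contradiction n<2 (ℕ.≤⇒≯ 2≤n)
    positive-length 2≤n (suc ℓ) _   = s≤s z≤n

  lowerSum-≥0 : ∀ n m → 0ℚ ≤ lowerSum n m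
  lowerSum-≥0 n m = reciprocals-≥0 (suc m) (suc m ℕ.* (n ℕ.∸ 1))

  -- The binary length determines a logarithm up to a constant factor, which is all that ≪ needs.
  log-comparison : ∀ a b A B → a ℕ.^ A ℕ.≤ b ℕ.^ B → 2 ℕ.≤ b → ∀ m → ι A * lowerSum a m ≤ ι (12 ℕ.* B) * lowerSum b 0
  log-comparison a b A B aᴬ≤bᴮ 2≤b m with a ℕ.≤? 1
  ... | yes a≤1 = begin
    ι A * lowerSum a m             ≤⟨ ℚ.*-monoˡ-≤-nonNeg (ι A) {{ι-nonNeg A}} (lowerSum-upper a m 0 a≤1) ⟩
    ι A * 0ℚ                       ≡⟨ trans (ℚ.*-zeroʳ (ι A)) (sym (ℚ.*-zeroʳ (ι (12 ℕ.* B)))) ⟩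
    ι (12 ℕ.* B) * 0ℚ              ≤⟨ ℚ.*-monoˡ-≤-nonNeg (ι (12 ℕ.* B)) {{ι-nonNeg (12 ℕ.* B)}} (lowerSum-≥0 b 0) ⟩
    ι (12 ℕ.* B) * lowerSum b 0 ∎
    where open ℚ.≤-Reasoning
  ... | no a≰1 with binaryLength a (ℕ.<⇒≤ (ℕ.≰⇒> a≰1)) | binaryLength b (ℕ.<⇒≤ 2≤b)
  ...   | k , 2ᵏ≤a , a<2ᵏ | ℓ , 2ˡ≤b , b<2ˡ = begin
    ι A * lowerSum a m                    ≤⟨ ℚ.*-monoˡ-≤-nonNeg (ι A) {{ι-nonNeg A}} (lowerSum-upper a m (suc k) (ℕ.<⇒≤ a<2ᵏ)) ⟩
    ι A * ι (suc k)                       ≡⟨ ι-* A (suc k) ⟨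
    ι (A ℕ.* suc k)                       ≤⟨ ι-mono integers ⟩
    ι (4 ℕ.* B ℕ.* ℓ)                     ≡⟨ ι-* (4 ℕ.* B) ℓ ⟩
    ι (4 ℕ.* B) * ι ℓ                     ≤⟨ ℚ.*-monoˡ-≤-nonNeg (ι (4 ℕ.* B)) {{ι-nonNeg (4 ℕ.* B)}} (lowerSum-lower b ℓ 2ˡ≤b) ⟩
    ι (4 ℕ.* B) * (ι 3 * lowerSum b 0)    ≡⟨ ℚ.*-assoc (ι (4 ℕ.* B)) (ι 3) (lowerSum b 0) ⟨
    ι (4 ℕ.* B) * ι 3 * lowerSum b 0      ≡⟨ cong (_* lowerSum b 0) (trans (cong ι (e B)) (ι-* (4 ℕ.* B) 3)) ⟨
    ι (12 ℕ.* B) * lowerSum b 0 ∎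
    where
    open ℚ.≤-Reasoning
    e : ∀ B → 12 ℕ.* B ≡ 4 ℕ.* B ℕ.* 3
    e = ℕSolver.solve-∀
    e₁ : ∀ A k → A ℕ.* (k ℕ.+ k) ≡ 2 ℕ.* (k ℕ.* A)
    e₁ = ℕSolver.solve-∀
    e₂ : ∀ B ℓ → 2 ℕ.* ((ℓ ℕ.+ ℓ) ℕ.* B) ≡ 4 ℕ.* B ℕ.* ℓ
    e₂ = ℕSolver.solve-∀
    exponents : k ℕ.* A ℕ.≤ suc ℓ ℕ.* B
    exponents = exponent-≤ (subst₂ ℕ._≤_ (ℕ.^-*-assoc 2 k A) (ℕ.^-*-assoc 2 (suc ℓ) B)
      (ℕ.≤-trans (ℕ.^-monoˡ-≤ A 2ᵏ≤a) (ℕ.≤-trans aᴬ≤bᴮ (ℕ.^-monoˡ-≤ B (ℕ.<⇒≤ b<2ˡ)))))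
    -- Both lengths are at least 1, so k + 1 ≤ 2 k and ℓ + 1 ≤ 2 ℓ. These give the factor 4, and the
    -- 3 of `lowerSum-lower` makes it 12.
    integers : A ℕ.* suc k ℕ.≤ 4 ℕ.* B ℕ.* ℓ
    integers = ℕ.≤-trans (ℕ.*-monoʳ-≤ A (ℕ.+-monoˡ-≤ k (positive-length (ℕ.≰⇒> a≰1) k a<2ᵏ)))
      (ℕ.≤-trans (ℕ.≤-reflexive (e₁ A k)) (ℕ.≤-trans (ℕ.*-monoʳ-≤ 2 (ℕ.≤-trans exponents (ℕ.*-monoˡ-≤ B (ℕ.+-monoˡ-≤ ℓ (positive-length 2≤b ℓ b<2ˡ)))))
        (ℕ.≤-reflexive (e₂ B ℓ))))

-- From inequalities between powers to inequalities between logarithms.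

module LogGrowth where

  open import Data.Nat.Base as ℕ using (ℕ; suc; s≤s)
  import Data.Nat.Properties as ℕ
  open import Data.Rational.Base
  import Data.Rational.Properties as ℚ
  open LogComparison

  ½*x<x : ∀ {x} → 0ℚ < x → ½ * x < x
  ½*x<x {x} 0<x = subst (½ * x <_) (ℚ.*-identityˡ x) (ℚ.*-monoˡ-<-pos x {{positive 0<x}} (from-yes (½ ℚ.<? 1ℚ)))

  lowerSum>0 : ∀ n → 2 ℕ.≤ n → 0ℚ < lowerSum n 0
  lowerSum>0 n 2≤n = ℚ.*-cancelˡ-<-nonNeg (ι 3) (ℚ.<-≤-trans (from-yes (ι 3 * 0ℚ ℚ.<? ι 1)) (lowerSum-lower n 1 2≤n))

  ι*½ : ∀ k x → ι (2 ℕ.* k) * (½ * x) ≡ ι k * x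
  ι*½ k x = begin
    ι (2 ℕ.* k) * (½ * x)     ≡⟨ cong (_* (½ * x)) (trans (cong ι (ℕ.*-comm 2 k)) (ι-* k 2)) ⟩
    ι k * ι 2 * (½ * x)       ≡⟨ ℚ.*-assoc (ι k) (ι 2) (½ * x) ⟩
    ι k * (ι 2 * (½ * x))     ≡⟨ cong (ι k *_) (trans (sym (ℚ.*-assoc (ι 2) ½ x)) (ℚ.*-identityˡ x)) ⟩
    ι k * x ∎
    where open ≡-Reasoning

  ι-pos : ∀ n .{{_ : ℕ.NonZero n}} → Positive (ι n)
  ι-pos n = ℚ.normalize-pos n 1

  -- Cuts are open, so the witness has to lie strictly below a lower sum: half of the sum of mesh 1
  -- is taken and the constant doubled. Passing to `suc C` keeps the constant positive.
  NlogN≪log : ∀ (L : ℕ → ℕ) C N₀ → (∀ N → N₀ ℕ.≤ N → N ℕ.^ N ℕ.≤ L N ℕ.^ C) → NlogN ≪ (λ N → log (L N))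
  NlogN≪log L C N₀ bound = ι (2 ℕ.* (12 ℕ.* suc C)) , ι-pos (2 ℕ.* (12 ℕ.* suc C)) , 2 ℕ.+ N₀ , below
    where
    open ℚ.≤-Reasoning
    below : ∀ N → 2 ℕ.+ N₀ ℕ.≤ N → NlogN N ≤ᴿ _·_ (ι (2 ℕ.* (12 ℕ.* suc C))) {{ι-nonNeg (2 ℕ.* (12 ℕ.* suc C))}} (log (L N))
    below N 2+N₀≤N r (s , (m , s<) , r<) = ½ * x , (0 , ½*x<x (lowerSum>0 (L N) 2≤L)) , (begin-strict
      r                                               <⟨ r< ⟩
      ι N * s                                         ≤⟨ ℚ.*-monoˡ-≤-nonNeg (ι N) {{ι-nonNeg N}} (ℚ.<⇒≤ s<) ⟩
      ι N * lowerSum N m                              ≤⟨ log-comparison N (L N) N (suc C) N^N≤ 2≤L m ⟩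
      ι (12 ℕ.* suc C) * x                            ≡⟨ ι*½ (12 ℕ.* suc C) x ⟨
      ι (2 ℕ.* (12 ℕ.* suc C)) * (½ * x) ∎)
      where
      x = lowerSum (L N) 0
      2≤N : 2 ℕ.≤ N
      2≤N = ℕ.≤-trans (ℕ.m≤m+n 2 N₀) 2+N₀≤N
      2≤N^N : 2 ℕ.≤ N ℕ.^ N
      2≤N^N = ℕ.≤-trans 2≤N (ℕ.≤-trans (ℕ.≤-reflexive (sym (ℕ.^-identityʳ N))) (ℕ.^-monoʳ-≤ N {{ℕ.>-nonZero (ℕ.<⇒≤ 2≤N)}} (ℕ.<⇒≤ 2≤N)))
      N^N≤L^C : N ℕ.^ N ℕ.≤ L N ℕ.^ C
      N^N≤L^C = bound N (ℕ.≤-trans (ℕ.m≤n+m N₀ 2) 2+N₀≤N)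
      2≤L : 2 ℕ.≤ L N
      2≤L with 2 ℕ.≤? L N
      ... | yes 2≤L = 2≤L
      ... | no 2≰L  = contradiction (ℕ.≤-trans 2≤N^N (ℕ.≤-trans N^N≤L^C (ℕ.≤-trans (ℕ.^-monoˡ-≤ C (ℕ.s≤s⁻¹ (ℕ.≰⇒> 2≰L))) (ℕ.≤-reflexive (ℕ.^-zeroˡ C))))) λ { (s≤s ()) }
      N^N≤ : N ℕ.^ N ℕ.≤ L N ℕ.^ suc C
      N^N≤ = ℕ.≤-trans N^N≤L^C (ℕ.^-monoʳ-≤ (L N) {{ℕ.>-nonZero (ℕ.<⇒≤ 2≤L)}} (ℕ.n≤1+n C))

  -- The multiple by N and the multiple by the constant each ask for a witness strictly below; hence
  -- two halvings and the factor 4.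
  log≪NlogN : ∀ (L : ℕ → ℕ) C N₀ → (∀ N → N₀ ℕ.≤ N → L N ℕ.≤ N ℕ.^ (C ℕ.* N)) → (λ N → log (L N)) ≪ NlogN
  log≪NlogN L C N₀ bound = ι (2 ℕ.* (2 ℕ.* (12 ℕ.* suc C))) , ι-pos (2 ℕ.* (2 ℕ.* (12 ℕ.* suc C))) , 2 ℕ.+ N₀ , below
    where
    open ℚ.≤-Reasoning
    c = 12 ℕ.* suc C
    below : ∀ N → 2 ℕ.+ N₀ ℕ.≤ N → log (L N) ≤ᴿ _·_ (ι (2 ℕ.* (2 ℕ.* c))) {{ι-nonNeg (2 ℕ.* (2 ℕ.* c))}} (NlogN N)
    below N 2+N₀≤N r (m , r<) = ½ * y , (½ * x , (0 , ½*x<x x>0) , ½*x<x y>0) , (begin-strict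
      r                                   <⟨ r< ⟩
      lowerSum (L N) m                    ≡⟨ ℚ.*-identityˡ (lowerSum (L N) m) ⟨
      ι 1 * lowerSum (L N) m              ≤⟨ log-comparison (L N) N 1 (suc C ℕ.* N) L≤ 2≤N m ⟩
      ι (12 ℕ.* (suc C ℕ.* N)) * x        ≡⟨ cong (_* x) (trans (cong ι (sym (ℕ.*-assoc 12 (suc C) N))) (ι-* c N)) ⟩
      ι c * ι N * x                       ≡⟨ ℚ.*-assoc (ι c) (ι N) x ⟩
      ι c * (ι N * x)                     ≡⟨ ι*½ c (ι N * x) ⟨
      ι (2 ℕ.* c) * (½ * (ι N * x))       ≡⟨ cong (ι (2 ℕ.* c) *_) (trans (sym (ℚ.*-assoc ½ (ι N) x)) (trans (cong (_* x) (ℚ.*-comm ½ (ι N))) (ℚ.*-assoc (ι N) ½ x))) ⟩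
      ι (2 ℕ.* c) * y                     ≡⟨ ι*½ (2 ℕ.* c) y ⟨
      ι (2 ℕ.* (2 ℕ.* c)) * (½ * y) ∎)
      where
      x = lowerSum N 0
      y = ι N * (½ * x)
      2≤N : 2 ℕ.≤ N
      2≤N = ℕ.≤-trans (ℕ.m≤m+n 2 N₀) 2+N₀≤N
      instance
        N≢0 : ℕ.NonZero N
        N≢0 = ℕ.>-nonZero (ℕ.<⇒≤ 2≤N)
      x>0 : 0ℚ < x
      x>0 = lowerSum>0 N 2≤N
      y>0 : 0ℚ < y
      y>0 = subst (_< y) (ℚ.*-zeroʳ (ι N)) (ℚ.*-monoʳ-<-pos (ι N) {{ι-pos N}} (subst (_< ½ * x) (ℚ.*-zeroʳ ½) (ℚ.*-monoʳ-<-pos ½ x>0)))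
      L≤ : L N ℕ.^ 1 ℕ.≤ N ℕ.^ (suc C ℕ.* N)
      L≤ = ℕ.≤-trans (ℕ.≤-reflexive (ℕ.^-identityʳ (L N))) (ℕ.≤-trans (bound N (ℕ.≤-trans (ℕ.m≤n+m N₀ 2) 2+N₀≤N))
        (ℕ.^-monoʳ-≤ N (ℕ.*-monoˡ-≤ N (ℕ.n≤1+n C))))

-- Evaluation, and the passage between integer and rational coefficients.

module PolynomialRings where

  open import Algebra.Bundles using (CommutativeRing)
  open import Data.Integer.Base as ℤ using (ℤ; 0ℤ)
  import Data.Integer.Divisibility.Signed as ℤ
  import Data.Integer.Properties as ℤ
  open import Data.Integer.Tactic.RingSolver using (solve-∀)
  open import Data.Nat.Base as ℕ using (ℕ; zero; suc)
  import Data.Nat.Divisibility as ℕ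
  import Data.Nat.Properties as ℕ
  open import Data.Rational.Base as ℚ using (ℚ; 0ℚ)
  import Data.Rational.Properties as ℚ
  import Data.Rational.Unnormalised.Base as ℚᵘ
  import Data.Rational.Unnormalised.Properties as ℚᵘ

  module Evaluation (R : CommutativeRing 0ℓ 0ℓ) where

    private module R = CommutativeRing R
    open CommutativeRing R hiding (zero; refl; sym; trans)
    open Polynomial R
    import Relation.Binary.Reasoning.Setoid as SetoidReasoning
    open SetoidReasoning setoid
    open import Algebra.Properties.CommutativeSemigroup +-commutativeSemigroup using (interchange)
    open import Algebra.Properties.CommutativeSemigroup *-commutativeSemigroup using (x∙yz≈y∙xz)

    eval-[] : ∀ p x → p ≈ₚ [] → eval p x ≈ 0#
    eval-[] []      x p≈0 = R.refl
    eval-[] (a ∷ p) x p≈0 = begin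
      a + x * eval p x   ≈⟨ +-cong (p≈0 0) (*-congˡ (eval-[] p x (λ i → p≈0 (suc i)))) ⟩
      0# + x * 0#        ≈⟨ +-identityˡ (x * 0#) ⟩
      x * 0#             ≈⟨ zeroʳ x ⟩
      0# ∎

    eval-cong : ∀ p q x → p ≈ₚ q → eval p x ≈ eval q x
    eval-cong []      q       x p≈q = R.sym (eval-[] q x (λ i → R.sym (p≈q i)))
    eval-cong (a ∷ p) []      x p≈q = eval-[] (a ∷ p) x p≈q
    eval-cong (a ∷ p) (b ∷ q) x p≈q = +-cong (p≈q 0) (*-congˡ (eval-cong p q x (λ i → p≈q (suc i))))

    eval-+ : ∀ p q x → eval (p +ₚ q) x ≈ eval p x + eval q x
    eval-+ []      q       x = R.sym (+-identityˡ (eval q x))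
    eval-+ (a ∷ p) []      x = R.sym (+-identityʳ _)
    eval-+ (a ∷ p) (b ∷ q) x = begin
      a + b + x * eval (p +ₚ q) x                  ≈⟨ +-congˡ (*-congˡ (eval-+ p q x)) ⟩
      a + b + x * (eval p x + eval q x)            ≈⟨ +-congˡ (distribˡ x (eval p x) (eval q x)) ⟩
      a + b + (x * eval p x + x * eval q x)        ≈⟨ interchange a b (x * eval p x) (x * eval q x) ⟩
      a + x * eval p x + (b + x * eval q x) ∎

    eval-scale : ∀ c p x → eval (map (c *_) p) x ≈ c * eval p x
    eval-scale c []      x = R.sym (zeroʳ c)
    eval-scale c (a ∷ p) x = begin
      c * a + x * eval (map (c *_) p) x    ≈⟨ +-congˡ (*-congˡ (eval-scale c p x)) ⟩
      c * a + x * (c * eval p x)           ≈⟨ +-congˡ (x∙yz≈y∙xz x c (eval p x)) ⟩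
      c * a + c * (x * eval p x)           ≈⟨ distribˡ c a (x * eval p x) ⟨
      c * (a + x * eval p x) ∎

    eval-* : ∀ p q x → eval (p *ₚ q) x ≈ eval p x * eval q x
    eval-* []      q x = R.sym (zeroˡ (eval q x))
    eval-* (a ∷ p) q x = begin
      eval (map (a *_) q +ₚ (0# ∷ p *ₚ q)) x             ≈⟨ eval-+ (map (a *_) q) (0# ∷ p *ₚ q) x ⟩
      eval (map (a *_) q) x + (0# + x * eval (p *ₚ q) x) ≈⟨ +-cong (eval-scale a q x) (R.trans (+-identityˡ _) (*-congˡ (eval-* p q x))) ⟩
      a * eval q x + x * (eval p x * eval q x)           ≈⟨ +-congˡ (*-assoc x (eval p x) (eval q x)) ⟨
      a * eval q x + x * eval p x * eval q x             ≈⟨ distribʳ (eval q x) a (x * eval p x) ⟨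
      (a + x * eval p x) * eval q x ∎

    coeff-+ : ∀ p q i → coeff (p +ₚ q) i ≈ coeff p i + coeff q i
    coeff-+ []      q       i       = R.sym (+-identityˡ _)
    coeff-+ (a ∷ p) []      i       = R.sym (+-identityʳ _)
    coeff-+ (a ∷ p) (b ∷ q) zero    = R.refl
    coeff-+ (a ∷ p) (b ∷ q) (suc i) = coeff-+ p q i

    coeff-scale : ∀ c p i → coeff (map (c *_) p) i ≈ c * coeff p i
    coeff-scale c []      i       = R.sym (zeroʳ c)
    coeff-scale c (a ∷ p) zero    = R.refl
    coeff-scale c (a ∷ p) (suc i) = coeff-scale c p i

    coeff-scale-* : ∀ c p q i → coeff (map (c *_) p *ₚ q) i ≈ c * coeff (p *ₚ q) i
    coeff-scale-* c []      q i = R.sym (zeroʳ c)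
    coeff-scale-* c (a ∷ p) q i = begin
      coeff (map ((c * a) *_) q +ₚ (0# ∷ map (c *_) p *ₚ q)) i        ≈⟨ coeff-+ (map ((c * a) *_) q) (0# ∷ map (c *_) p *ₚ q) i ⟩
      coeff (map ((c * a) *_) q) i + coeff (0# ∷ map (c *_) p *ₚ q) i ≈⟨ +-cong (R.trans (coeff-scale (c * a) q i) (*-assoc c a (coeff q i))) (shifted i) ⟩
      c * (a * coeff q i) + c * coeff (0# ∷ p *ₚ q) i                 ≈⟨ +-congʳ (*-congˡ (coeff-scale a q i)) ⟨
      c * coeff (map (a *_) q) i + c * coeff (0# ∷ p *ₚ q) i          ≈⟨ distribˡ c _ _ ⟨
      c * (coeff (map (a *_) q) i + coeff (0# ∷ p *ₚ q) i)            ≈⟨ *-congˡ (coeff-+ (map (a *_) q) (0# ∷ p *ₚ q) i) ⟨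
      c * coeff (map (a *_) q +ₚ (0# ∷ p *ₚ q)) i ∎
      where
      shifted : ∀ i → coeff (0# ∷ map (c *_) p *ₚ q) i ≈ c * coeff (0# ∷ p *ₚ q) i
      shifted zero    = R.sym (zeroʳ c)
      shifted (suc i) = coeff-scale-* c p q i

  module Evalℤ = Evaluation ℤ.+-*-commutativeRing
  module Evalℚ = Evaluation ℚ.+-*-commutativeRing

  τ : ℤ → ℚ
  τ a = a ℚ./ 1

  private
    toℚᵘ-τ : ∀ a → ℚ.toℚᵘ (τ a) ℚᵘ.≃ ℚᵘ.mkℚᵘ a 0
    toℚᵘ-τ a = ℚ.toℚᵘ-fromℚᵘ (ℚᵘ.mkℚᵘ a 0)

  τ-+ : ∀ a b → τ (a ℤ.+ b) ≡ τ a ℚ.+ τ b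
  τ-+ a b = ℚ.toℚᵘ-injective (ℚᵘ.≃-trans (toℚᵘ-τ (a ℤ.+ b))
    (ℚᵘ.≃-trans (ℚᵘ.*≡* (cong (ℤ._* ℤ.+ 1) (sym (cong₂ ℤ._+_ (ℤ.*-identityʳ a) (ℤ.*-identityʳ b)))))
    (ℚᵘ.≃-trans (ℚᵘ.≃-sym (ℚᵘ.+-cong (toℚᵘ-τ a) (toℚᵘ-τ b))) (ℚᵘ.≃-sym (ℚ.toℚᵘ-homo-+ (τ a) (τ b))))))

  τ-* : ∀ a b → τ (a ℤ.* b) ≡ τ a ℚ.* τ b
  τ-* a b = ℚ.toℚᵘ-injective (ℚᵘ.≃-trans (toℚᵘ-τ (a ℤ.* b))
    (ℚᵘ.≃-trans (ℚᵘ.*≡* refl)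
    (ℚᵘ.≃-trans (ℚᵘ.≃-sym (ℚᵘ.*-cong (toℚᵘ-τ a) (toℚᵘ-τ b))) (ℚᵘ.≃-sym (ℚ.toℚᵘ-homo-* (τ a) (τ b))))))

  τ-injective : ∀ {a b} → τ a ≡ τ b → a ≡ b
  τ-injective {a} {b} τa≡τb with ℚᵘ.≃-trans (ℚᵘ.≃-sym (toℚᵘ-τ a)) (ℚᵘ.≃-trans (ℚᵘ.≃-reflexive (cong ℚ.toℚᵘ τa≡τb)) (toℚᵘ-τ b))
  ... | ℚᵘ.*≡* a*1≡b*1 = trans (sym (ℤ.*-identityʳ a)) (trans a*1≡b*1 (ℤ.*-identityʳ b))

  τ-denominator : ∀ q → τ (ℚ.↧ q) ℚ.* q ≡ τ (ℚ.↥ q)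
  τ-denominator q@(ℚ.mkℚ _ _ _) = ℚ.toℚᵘ-injective (ℚᵘ.≃-trans (ℚ.toℚᵘ-homo-* (τ (ℚ.↧ q)) q)
    (ℚᵘ.≃-trans (ℚᵘ.*-congʳ {ℚ.toℚᵘ q} (toℚᵘ-τ (ℚ.↧ q)))
    (ℚᵘ.≃-trans (ℚᵘ.*≡* (trans (ℤ.*-identityʳ _) (trans (ℤ.*-comm (ℚ.↧ q) (ℚ.↥ q)) (cong (λ k → ℚ.↥ q ℤ.* ℤ.+ k) (sym (ℕ.*-identityˡ (ℚ.denominatorℕ q)))))))
    (ℚᵘ.≃-sym (toℚᵘ-τ (ℚ.↥ q))))))

  toℚ-+ : ∀ p q → toℚ[x] (p ℤ[x].+ₚ q) ≡ toℚ[x] p ℚ[x].+ₚ toℚ[x] q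
  toℚ-+ []      q       = refl
  toℚ-+ (a ∷ p) []      = refl
  toℚ-+ (a ∷ p) (b ∷ q) = cong₂ _∷_ (τ-+ a b) (toℚ-+ p q)

  toℚ-scale : ∀ c p → toℚ[x] (map (c ℤ.*_) p) ≡ map (τ c ℚ.*_) (toℚ[x] p)
  toℚ-scale c []      = refl
  toℚ-scale c (a ∷ p) = cong₂ _∷_ (τ-* c a) (toℚ-scale c p)

  toℚ-* : ∀ p q → toℚ[x] (p ℤ[x].*ₚ q) ≡ toℚ[x] p ℚ[x].*ₚ toℚ[x] q
  toℚ-* []      q = refl
  toℚ-* (a ∷ p) q = trans (toℚ-+ (map (a ℤ.*_) q) (0ℤ ∷ p ℤ[x].*ₚ q)) (cong₂ (λ r s → r ℚ[x].+ₚ (0ℚ ∷ s)) (toℚ-scale a q) (toℚ-* p q))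

  coeff-toℚ : ∀ p i → ℚ[x].coeff (toℚ[x] p) i ≡ τ (ℤ[x].coeff p i)
  coeff-toℚ []      i       = refl
  coeff-toℚ (a ∷ p) zero    = refl
  coeff-toℚ (a ∷ p) (suc i) = coeff-toℚ p i

  eval-toℚ : ∀ p x → ℚ[x].eval (toℚ[x] p) (τ x) ≡ τ (ℤ[x].eval p x)
  eval-toℚ []      x = refl
  eval-toℚ (a ∷ p) x = trans (cong (λ t → τ a ℚ.+ τ x ℚ.* t) (eval-toℚ p x))
    (trans (cong (λ t → τ a ℚ.+ t) (sym (τ-* x (ℤ[x].eval p x)))) (sym (τ-+ a (x ℤ.* ℤ[x].eval p x))))

  integral-multiple : ∀ p → ∃[ m ] ∃[ P ] (m ≢ 0ℤ × map (τ m ℚ.*_) p ≡ toℚ[x] P)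
  integral-multiple []      = ℤ.+ 1 , [] , (λ ()) , refl
  integral-multiple (a ∷ p) with integral-multiple p
  ... | m , P , m≢0 , eq = ℚ.↧ a ℤ.* m , m ℤ.* ℚ.↥ a ∷ map (ℚ.↧ a ℤ.*_) P , product≢0 , cong₂ _∷_ head tail
    where
    product≢0 : ℚ.↧ a ℤ.* m ≢ 0ℤ
    product≢0 am≡0 with ℤ.i*j≡0⇒i≡0∨j≡0 (ℚ.↧ a) am≡0
    ... | inj₂ m≡0 = m≢0 m≡0
    head : τ (ℚ.↧ a ℤ.* m) ℚ.* a ≡ τ (m ℤ.* ℚ.↥ a)
    head = trans (cong (λ t → τ t ℚ.* a) (ℤ.*-comm (ℚ.↧ a) m)) (trans (cong (ℚ._* a) (τ-* m (ℚ.↧ a)))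
      (trans (ℚ.*-assoc (τ m) (τ (ℚ.↧ a)) a) (trans (cong (τ m ℚ.*_) (τ-denominator a)) (sym (τ-* m (ℚ.↥ a))))))
    tail : map (τ (ℚ.↧ a ℤ.* m) ℚ.*_) p ≡ toℚ[x] (map (ℚ.↧ a ℤ.*_) P)
    tail = trans (map-cong (λ t → trans (cong (ℚ._* t) (τ-* (ℚ.↧ a) m)) (ℚ.*-assoc (τ (ℚ.↧ a)) (τ m) t)) p)
      (trans (map-∘ p) (trans (cong (map (τ (ℚ.↧ a) ℚ.*_)) eq) (sym (toℚ-scale (ℚ.↧ a) P))))

  -- The constant term is divisible by every n ≥ n₀, so it is 0, by a choice of n > |a|; then n
  -- cancels. Raising n₀ by one at each coefficient ensures n ≠ 0.
  vanishing : ∀ p n₀ → (∀ n → n₀ ℕ.≤ n → ℤ[x].eval p (ℤ.+ n) ≡ 0ℤ) → ∀ i → ℤ[x].coeff p i ≡ 0ℤ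
  vanishing []      n₀ p≡0 i = refl
  vanishing (a ∷ p) n₀ p≡0 = λ { zero → a≡0 ; (suc i) → vanishing p (suc n₀) tail i }
    where
    n = n₀ ℕ.+ suc ℤ.∣ a ∣
    a≡0 : a ≡ 0ℤ
    a≡0 with ℤ.∣ a ∣ in eq | ℤ.∣⇒∣ᵤ {ℤ.+ n} {a} (ℤ.divides (ℤ.- ℤ[x].eval p (ℤ.+ n)) (lemma a (ℤ.+ n) (ℤ[x].eval p (ℤ.+ n)) (p≡0 n (ℕ.m≤m+n n₀ _))))
      where
      lemma′ : ∀ a n y → a ≡ (a ℤ.+ n ℤ.* y) ℤ.+ (ℤ.- y) ℤ.* n
      lemma′ = solve-∀
      lemma : ∀ a n y → a ℤ.+ n ℤ.* y ≡ 0ℤ → a ≡ (ℤ.- y) ℤ.* n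
      lemma a n y eq = trans (lemma′ a n y) (trans (cong (ℤ._+ (ℤ.- y) ℤ.* n) eq) (ℤ.+-identityˡ _))
    ... | zero  | _   = ℤ.∣i∣≡0⇒i≡0 eq
    ... | suc k | n∣a = contradiction (ℕ.∣⇒≤ n∣a) (ℕ.<⇒≱ (ℕ.≤-trans (ℕ.n<1+n (suc k)) (ℕ.m≤n+m _ n₀)))
    tail : ∀ n → suc n₀ ℕ.≤ n → ℤ[x].eval p (ℤ.+ n) ≡ 0ℤ
    tail n n₀<n with ℤ.i*j≡0⇒i≡0∨j≡0 (ℤ.+ n) (trans (sym (ℤ.+-identityˡ _)) (trans (cong (λ a → a ℤ.+ ℤ.+ n ℤ.* ℤ[x].eval p (ℤ.+ n)) (sym a≡0)) (p≡0 n (ℕ.<⇒≤ n₀<n))))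
    ... | inj₁ n≡0 = contradiction (subst (suc n₀ ℕ.≤_) (ℤ.+-injective n≡0) n₀<n) λ ()
    ... | inj₂ y≡0 = y≡0

  -- A bridge: the integer arguments compare polynomials by their values, whereas irreducibility
  -- speaks of coefficients.
  coefficients-determined : ∀ p q → (∀ x → ℤ[x].eval p x ≡ ℤ[x].eval q x) → p ℤ[x].≈ₚ q
  coefficients-determined p q p≡q i = ℤ.i-j≡0⇒i≡j _ _ (begin
    ℤ[x].coeff p i ℤ.- ℤ[x].coeff q i                     ≡⟨ cong (λ t → ℤ[x].coeff p i ℤ.+ t) (trans (sym (ℤ.-1*i≡-i (ℤ[x].coeff q i))) (sym (Evalℤ.coeff-scale ℤ.-1ℤ q i))) ⟩
    ℤ[x].coeff p i ℤ.+ ℤ[x].coeff (map (ℤ.-1ℤ ℤ.*_) q) i  ≡⟨ Evalℤ.coeff-+ p (map (ℤ.-1ℤ ℤ.*_) q) i ⟨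
    ℤ[x].coeff (p ℤ[x].+ₚ map (ℤ.-1ℤ ℤ.*_) q) i           ≡⟨ vanishing (p ℤ[x].+ₚ map (ℤ.-1ℤ ℤ.*_) q) 0 (λ n _ → zeros (ℤ.+ n)) i ⟩
    0ℤ ∎)
    where
    open ≡-Reasoning
    zeros : ∀ x → ℤ[x].eval (p ℤ[x].+ₚ map (ℤ.-1ℤ ℤ.*_) q) x ≡ 0ℤ
    zeros x = trans (Evalℤ.eval-+ p (map (ℤ.-1ℤ ℤ.*_) q) x) (trans (cong₂ ℤ._+_ (p≡q x) (trans (Evalℤ.eval-scale ℤ.-1ℤ q x) (ℤ.-1*i≡-i _))) (ℤ.+-inverseʳ (ℤ[x].eval q x)))

-- Irreducibility over the rationals, Bézout identities and rational roots.

module Factors where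

  open import Algebra.Bundles using (CommutativeRing)
  open import Algebra.Definitions.RawMagma using (_,_)
  open import Data.Integer.Base hiding (suc)
  open import Data.Integer.Divisibility.Signed using (divides; ∣⇒∣ᵤ) renaming (_∣_ to _∣ℤ_)
  open import Data.Integer.Properties
  open import Data.Integer.Tactic.RingSolver using (solve-∀)
  open import Data.Nat.Base as ℕ using (ℕ; zero; suc; z≤n; s≤s)
  import Data.Nat.Divisibility as ℕ
  import Data.Nat.Properties as ℕ
  import Data.Rational.Base as ℚ
  open ℚ using (ℚ; 1ℚ)
  import Data.Rational.Properties as ℚ
  open IntegerPolynomials
  open PolynomialRings

  *≢0 : ∀ {i j} → i ≢ 0ℤ → j ≢ 0ℤ → i * j ≢ 0ℤ
  *≢0 {i} i≢0 j≢0 ij≡0 with i*j≡0⇒i≡0∨j≡0 i ij≡0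
  ... | inj₁ i≡0 = i≢0 i≡0
  ... | inj₂ j≡0 = j≢0 j≡0

  toList : ∀ {d} → Poly d → List ℤ
  toList (con a) = a ∷ []
  toList (a ∷ p) = a ∷ toList p

  eval-toList : ∀ {d} (p : Poly d) x → ℤ[x].eval (toList p) x ≡ ev p x
  eval-toList (con a) x = trans (cong (λ t → a + t) (*-zeroʳ x)) (+-identityʳ a)
  eval-toList (a ∷ p) x = cong (λ t → a + x * t) (eval-toList p x)

  fromList : (p : List ℤ) → Poly (length p)
  fromList []      = con 0ℤ
  fromList (a ∷ p) = a ∷ fromList p

  ev-fromList : ∀ p x → ev (fromList p) x ≡ ℤ[x].eval p x
  ev-fromList []      x = refl
  ev-fromList (a ∷ p) x = cong (λ t → a + x * t) (ev-fromList p x)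

  const : ∀ d → ℤ → Poly d
  const zero    a = con a
  const (suc d) a = a ∷ const d 0ℤ

  ev-const : ∀ d a x → ev (const d a) x ≡ a
  ev-const zero    a x = refl
  ev-const (suc d) a x = trans (cong (λ t → a + x * t) (ev-const d 0ℤ x)) (trans (cong (λ t → a + t) (*-zeroʳ x)) (+-identityʳ a))

  truncate : ∀ d p → (∀ i → d ℕ.< i → ℤ[x].coeff p i ≡ 0ℤ) → ∃[ g ] (lead {d} g ≡ ℤ[x].coeff p d × (∀ x → ev g x ≡ ℤ[x].eval p x))
  truncate d       []      _     = const d 0ℤ , lead-const d , ev-const d 0ℤ
    where
    lead-const : ∀ d → lead (const d 0ℤ) ≡ 0ℤ
    lead-const zero    = refl
    lead-const (suc d) = lead-const d
  truncate zero    (a ∷ p) above = con a , refl , λ x → sym (trans (cong (λ t → a + x * t) (Evalℤ.eval-[] p x (λ i → above (suc i) (s≤s z≤n))))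
    (trans (cong (λ t → a + t) (*-zeroʳ x)) (+-identityʳ a)))
  truncate (suc d) (a ∷ p) above with truncate d p (λ i d<i → above (suc i) (s≤s d<i))
  ... | g , lead≡ , ev≡ = a ∷ g , lead≡ , λ x → cong (λ t → a + x * t) (ev≡ x)

  trim : ∀ {d} (p : Poly d) → (∀ x → ev p x ≡ 0ℤ) ⊎ (∃[ e ] Σ[ q ∈ Poly e ] (e ℕ.≤ d × lead q ≢ 0ℤ × (∀ x → ev q x ≡ ev p x)))
  trim (con a) with a ≟ 0ℤ
  ... | yes a≡0 = inj₁ λ _ → a≡0
  ... | no a≢0  = inj₂ (0 , con a , z≤n , a≢0 , λ _ → refl)
  trim (a ∷ p) with trim p
  ... | inj₂ (e , q , e≤d , l≢0 , q≡p) = inj₂ (suc e , a ∷ q , s≤s e≤d , l≢0 , λ x → cong (λ t → a + x * t) (q≡p x))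
  ... | inj₁ p≡0 with a ≟ 0ℤ
  ...   | yes refl = inj₁ λ x → trans (+-identityˡ _) (trans (cong (x *_) (p≡0 x)) (*-zeroʳ x))
  ...   | no a≢0   = inj₂ (0 , con a , z≤n , a≢0 , λ x → sym (trans (cong (λ t → a + x * t) (p≡0 x)) (trans (cong (λ t → a + t) (*-zeroʳ x)) (+-identityʳ a))))

  drop-lead : ∀ {d} (p : Poly (suc d)) → lead p ≡ 0ℤ → Σ[ q ∈ Poly d ] (∀ x → ev q x ≡ ev p x)
  drop-lead (a ∷ con c) refl = con a , λ x → sym (trans (cong (λ t → a + t) (*-zeroʳ x)) (+-identityʳ a))
  drop-lead (a ∷ p@(_ ∷ _)) l≡0 with drop-lead p l≡0
  ... | q , q≡p = a ∷ q , λ x → cong (λ t → a + x * t) (q≡p x)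

  -- Long division run along Horner's rule. At each coefficient everything is multiplied by the
  -- leading coefficient of `h` instead of divided by it, which stays in the integers; the top
  -- coefficient of the new remainder cancels.
  pseudo-division : ∀ {e} (h : Poly (suc e)) → lead h ≢ 0ℤ → ∀ {d} (p : Poly d) →
    ∃[ c ] ∃[ q ] Σ[ r ∈ Poly e ] (c ≢ 0ℤ × (∀ x → c * ev p x ≡ ℤ[x].eval q x * ev h x + ev r x))
  pseudo-division {e} h l≢0 (con a) = 1ℤ , [] , const e a , (λ ()) , λ x → trans (*-identityˡ a) (sym (trans (+-identityˡ _) (ev-const e a x)))
  pseudo-division h l≢0 (a ∷ p) with pseudo-division h l≢0 p
  ... | c , q , r , c≢0 , eq = l * c , s ∷ map (l *_) q , proj₁ r″ , *≢0 l≢0 c≢0 , λ x → begin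
    l * c * (a + x * ev p x)                                       ≡⟨ e₁ l c a x (ev p x) ⟩
    l * (c * a) + l * x * (c * ev p x)                             ≡⟨ cong (λ t → l * (c * a) + l * x * t) (eq x) ⟩
    l * (c * a) + l * x * (ℤ[x].eval q x * ev h x + ev r x)        ≡⟨ e₂ l (c * a) x (ℤ[x].eval q x) (ev h x) (ev r x) s ⟩
    (s + x * (l * ℤ[x].eval q x)) * ev h x + (l * (c * a + x * ev r x) + (- s) * ev h x)
      ≡⟨ cong₂ (λ y z → (s + x * y) * ev h x + z) (sym (Evalℤ.eval-scale l q x)) (sym (trans (ev-⊕ (l ⊙ r′) (- s ⊙ h) x) (cong₂ _+_ (ev-⊙ l r′ x) (ev-⊙ (- s) h x)))) ⟩
    (s + x * ℤ[x].eval (map (l *_) q) x) * ev h x + ev (l ⊙ r′ ⊕ - s ⊙ h) x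
      ≡⟨ cong (λ t → (s + x * ℤ[x].eval (map (l *_) q) x) * ev h x + t) (proj₂ r″ x) ⟨
    (s + x * ℤ[x].eval (map (l *_) q) x) * ev h x + ev (proj₁ r″) x ∎
    where
    open ≡-Reasoning
    l = lead h
    s = lead r
    r′ = c * a ∷ r
    e₁ : ∀ l c a x p → l * c * (a + x * p) ≡ l * (c * a) + l * x * (c * p)
    e₁ = solve-∀
    e₂ : ∀ l a x q h r s → l * a + l * x * (q * h + r) ≡ (s + x * (l * q)) * h + (l * (a + x * r) + (- s) * h)
    e₂ = solve-∀
    e₃ : ∀ l s → l * s + (- s) * l ≡ 0ℤ
    e₃ = solve-∀
    r″ = drop-lead (l ⊙ r′ ⊕ - s ⊙ h) (trans (lead-⊕ (l ⊙ r′) (- s ⊙ h)) (trans (cong₂ _+_ (lead-⊙ l r′) (lead-⊙ (- s) h)) (e₃ l s)))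

  -- Irreducibility in the form in which pseudo-division meets it: an identity of values, with a
  -- nonzero integer `c` clearing the denominators of the cofactor.
  NoFactor : ∀ {d} → Poly d → Set
  NoFactor {d} g = ∀ {e} (h : Poly (suc e)) → suc e ℕ.< d → lead h ≢ 0ℤ → ∀ c q → c ≢ 0ℤ →
    ¬ (∀ x → c * ev g x ≡ ℤ[x].eval q x * ev h x)

  -- Euclid's algorithm, dividing the same polynomial g at every step: a remainder cannot vanish
  -- before its degree is zero.
  bezout : ∀ {d} (g : Poly d) → NoFactor g → ∀ {e} (h : Poly e) → e ℕ.< d → lead h ≢ 0ℤ →
    ∃[ D ] Σ[ A ∈ (ℤ → ℤ) ] Σ[ B ∈ (ℤ → ℤ) ] (D ≢ 0ℤ × (∀ x → A x * ev g x + B x * ev h x ≡ D))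
  bezout {d} g noFactor {e} h e<d l≢0 = go (suc e) h ℕ.≤-refl e<d l≢0
    where
    go : ∀ n {e} (h : Poly e) → e ℕ.< n → e ℕ.< d → lead h ≢ 0ℤ →
      ∃[ D ] Σ[ A ∈ (ℤ → ℤ) ] Σ[ B ∈ (ℤ → ℤ) ] (D ≢ 0ℤ × (∀ x → A x * ev g x + B x * ev h x ≡ D))
    go (suc n) (con c) _ _ c≢0 = c , (λ _ → 0ℤ) , (λ _ → 1ℤ) , c≢0 , λ x → trans (+-identityˡ (1ℤ * c)) (*-identityˡ c)
    go (suc n) {suc e} h@(_ ∷ _) (s≤s e<n) e<d l≢0 with pseudo-division h l≢0 g
    ... | c , q , r , c≢0 , eq with trim r
    ...   | inj₁ r≡0 = contradiction (λ x → trans (eq x) (trans (cong (λ t → ℤ[x].eval q x * ev h x + t) (r≡0 x)) (+-identityʳ _))) (noFactor h e<d l≢0 c q c≢0)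
    ...   | inj₂ (e′ , r′ , e′≤e , l′≢0 , r′≡r) with go n r′ (ℕ.≤-<-trans e′≤e e<n) (ℕ.≤-<-trans e′≤e (ℕ.<-trans (ℕ.n<1+n e) e<d)) l′≢0
    ...     | D , A , B , D≢0 , comb = D , (λ x → A x + B x * c) , (λ x → - (B x * ℤ[x].eval q x)) , D≢0 , λ x → begin
      (A x + B x * c) * ev g x + (- (B x * ℤ[x].eval q x)) * ev h x        ≡⟨ e₁ (A x) (B x) c (ev g x) (ℤ[x].eval q x) (ev h x) ⟩
      A x * ev g x + B x * (c * ev g x - ℤ[x].eval q x * ev h x)           ≡⟨ cong (λ t → A x * ev g x + B x * (t - ℤ[x].eval q x * ev h x)) (eq x) ⟩
      A x * ev g x + B x * (ℤ[x].eval q x * ev h x + ev r x - ℤ[x].eval q x * ev h x)  ≡⟨ e₂ (A x * ev g x) (B x) (ℤ[x].eval q x * ev h x) (ev r x) ⟩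
      A x * ev g x + B x * ev r x                                          ≡⟨ cong (λ t → A x * ev g x + B x * t) (r′≡r x) ⟨
      A x * ev g x + B x * ev r′ x                                         ≡⟨ comb x ⟩
      D ∎
      where
      open ≡-Reasoning
      e₁ : ∀ a b c g q h → (a + b * c) * g + (- (b * q)) * h ≡ a * g + b * (c * g - q * h)
      e₁ = solve-∀
      e₂ : ∀ a b z r → a + b * (z + r - z) ≡ a + b * r
      e₂ = solve-∀

  hom[u,0] : ∀ {d} (g : Poly d) u → hom g u 0ℤ ≡ lead g * u ^ d
  hom[u,0] (con c) u = sym (*-identityʳ c)
  hom[u,0] {suc d} (a ∷ g) u = trans (cong (λ t → a * t + u * hom g u 0ℤ) (*-zeroˡ (0ℤ ^ d)))
    (trans (cong₂ _+_ (*-zeroʳ a) (cong (u *_) (hom[u,0] g u))) (lemma u (lead g) (u ^ d)))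
    where
    lemma : ∀ u l w → 0ℤ + u * (l * w) ≡ l * (u * w)
    lemma = solve-∀

  -- The remainder theorem at u / v, cleared of denominators. A zero of the form with v ≠ 0 thus
  -- yields the factor v x - u.
  division-by-linear : ∀ {d} (g : Poly d) u v → ∃[ q ] (∀ x → v ^ d * ev g x ≡ ℤ[x].eval q x * (- u + x * v) + hom g u v)
  division-by-linear (con c) u v = [] , λ x → trans (*-identityˡ c) (sym (+-identityˡ c))
  division-by-linear {suc d} (a ∷ g) u v with division-by-linear g u v
  ... | q , eq = hom g u v ∷ map (v *_) q , λ x → begin
    v * v ^ d * (a + x * ev g x)                                   ≡⟨ e₁ v (v ^ d) a x (ev g x) ⟩
    a * (v * v ^ d) + x * v * (v ^ d * ev g x)                     ≡⟨ cong (λ t → a * (v * v ^ d) + x * v * t) (eq x) ⟩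
    a * (v * v ^ d) + x * v * (ℤ[x].eval q x * (- u + x * v) + hom g u v)   ≡⟨ e₂ (a * (v * v ^ d)) x v (ℤ[x].eval q x) u (hom g u v) ⟩
    (hom g u v + x * (v * ℤ[x].eval q x)) * (- u + x * v) + (a * (v * v ^ d) + u * hom g u v)
      ≡⟨ cong (λ t → (hom g u v + x * t) * (- u + x * v) + (a * (v * v ^ d) + u * hom g u v)) (Evalℤ.eval-scale v q x) ⟨
    (hom g u v + x * ℤ[x].eval (map (v *_) q) x) * (- u + x * v) + (a * (v * v ^ d) + u * hom g u v) ∎
    where
    open ≡-Reasoning
    e₁ : ∀ v w a x g → v * w * (a + x * g) ≡ a * (v * w) + x * v * (w * g)
    e₁ = solve-∀
    e₂ : ∀ a x v q u h → a + x * v * (q * (- u + x * v) + h) ≡ (h + x * (v * q)) * (- u + x * v) + (a + u * h)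
    e₂ = solve-∀

  -- For v ≠ 0 a zero would give a linear factor, proper because d ≥ 2; for v = 0 the form is the
  -- leading coefficient times u ^ d.
  hom-anisotropic : ∀ {d} (g : Poly d) → 1 ℕ.< d → lead g ≢ 0ℤ → NoFactor g → ∀ u v → hom g u v ≡ 0ℤ → u ≡ 0ℤ × v ≡ 0ℤ
  hom-anisotropic {d} g 1<d l≢0 noFactor u v hom≡0 with v ≟ 0ℤ
  ... | no v≢0 with division-by-linear g u v
  ...   | q , eq = contradiction (λ x → trans (eq x) (trans (cong (λ t → ℤ[x].eval q x * (- u + x * v) + t) hom≡0) (+-identityʳ _)))
                     (noFactor (- u ∷ con v) 1<d v≢0 (v ^ d) q (λ v^d≡0 → v≢0 (i^n≡0⇒i≡0 v d v^d≡0)))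
  hom-anisotropic {d} g 1<d l≢0 noFactor u v hom≡0 | yes refl with i*j≡0⇒i≡0∨j≡0 (lead g) (trans (sym (hom[u,0] g u)) hom≡0)
  ... | inj₁ l≡0   = contradiction l≡0 l≢0
  ... | inj₂ u^d≡0 = i^n≡0⇒i≡0 u d u^d≡0 , refl

  scaled-eval : ∀ m p P → map (τ m ℚ.*_) p ≡ toℚ[x] P → ∀ x → τ (ℤ[x].eval P x) ≡ τ m ℚ.* ℚ[x].eval p (τ x)
  scaled-eval m p P mp≡P x = trans (sym (eval-toℚ P x)) (trans (cong (λ p → ℚ[x].eval p (τ x)) (sym mp≡P)) (Evalℚ.eval-scale (τ m) p (τ x)))

  rearrange : ∀ a b c d → a ℚ.* b ℚ.* (c ℚ.* d) ≡ a ℚ.* c ℚ.* (b ℚ.* d)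
  rearrange = interchange
    where
    open import Algebra.Properties.CommutativeSemigroup (CommutativeRing.*-commutativeSemigroup ℚ.+-*-commutativeRing) using (interchange)

  -- Units are recognised by their values instead of their degree: values dividing a fixed nonzero
  -- integer are bounded, which growth can contradict.
  unit-values : ∀ a y Y → a ≢ 0ℤ → map (τ a ℚ.*_) y ≡ toℚ[x] Y → y ℚ[x].∣ ℚ[x].1ₚ →
    ∃[ e ] (e ≢ 0ℤ × (∀ x → ℤ[x].eval Y x ∣ℤ e))
  unit-values a y Y a≢0 ay≡Y (w , wy≈1) with integral-multiple w
  ... | m , W , m≢0 , mw≡W = m * a , *≢0 m≢0 a≢0 , λ x → divides (ℤ[x].eval W x) (τ-injective (sym (begin
    τ (ℤ[x].eval W x * ℤ[x].eval Y x)                                ≡⟨ τ-* (ℤ[x].eval W x) (ℤ[x].eval Y x) ⟩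
    τ (ℤ[x].eval W x) ℚ.* τ (ℤ[x].eval Y x)                          ≡⟨ cong₂ ℚ._*_ (scaled-eval m w W mw≡W x) (scaled-eval a y Y ay≡Y x) ⟩
    τ m ℚ.* ℚ[x].eval w (τ x) ℚ.* (τ a ℚ.* ℚ[x].eval y (τ x))        ≡⟨ rearrange (τ m) (ℚ[x].eval w (τ x)) (τ a) (ℚ[x].eval y (τ x)) ⟩
    τ m ℚ.* τ a ℚ.* (ℚ[x].eval w (τ x) ℚ.* ℚ[x].eval y (τ x))        ≡⟨ cong (τ m ℚ.* τ a ℚ.*_) (trans (sym (Evalℚ.eval-* w y (τ x))) (Evalℚ.eval-cong (w ℚ[x].*ₚ y) ℚ[x].1ₚ (τ x) wy≈1)) ⟩
    τ m ℚ.* τ a ℚ.* (1ℚ ℚ.+ τ x ℚ.* ℚ.0ℚ)                            ≡⟨ cong (τ m ℚ.* τ a ℚ.*_) (trans (cong (1ℚ ℚ.+_) (ℚ.*-zeroʳ (τ x))) (ℚ.+-identityʳ 1ℚ)) ⟩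
    τ m ℚ.* τ a ℚ.* 1ℚ                                               ≡⟨ trans (ℚ.*-identityʳ _) (sym (τ-* m a)) ⟩
    τ (m * a) ∎)))
    where
    open ≡-Reasoning

  bounded-by-divisor : ∀ {i j} → i ∣ℤ j → j ≢ 0ℤ → ∣ i ∣ ℕ.≤ ∣ j ∣
  bounded-by-divisor i∣j j≢0 = ℕ.∣⇒≤ {{ℕ.≢-nonZero (λ j≡0 → j≢0 (∣i∣≡0⇒i≡0 j≡0))}} (∣⇒∣ᵤ i∣j)

  growth-contradiction : ∀ (e k C n₀ : ℕ) → 1 ℕ.≤ k → ¬ (∀ n → n₀ ℕ.≤ n → n ℕ.^ (k ℕ.+ e) ℕ.≤ C ℕ.* n ℕ.^ e)
  growth-contradiction e (suc k) C n₀ _ bound = ℕ.<⇒≱ C<n (ℕ.≤-trans (ℕ.m≤m*n n (n ℕ.^ k) {{ℕ.m^n≢0 n k}})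
    (ℕ.*-cancelʳ-≤ _ _ (n ℕ.^ e) {{ℕ.m^n≢0 n e}} (ℕ.≤-trans (ℕ.≤-reflexive (sym (ℕ.^-distribˡ-+-* n (suc k) e))) (bound n (ℕ.m≤n⇒m≤1+n (ℕ.m≤m+n n₀ C))))))
    where
    n = suc (n₀ ℕ.+ C)
    C<n : C ℕ.< n
    C<n = s≤s (ℕ.m≤n+m C n₀)

  -- From c g = q h comes γ = x y, where y is h and x is q divided by the constant c m; one of them
  -- is a unit. But |h (n)| grows like n ^ (e + 1), and a bounded q would give |g (n)| = O(n ^ (e +
  -- 1)) although e + 1 < d.
  irreducible⇒noFactor : ∀ {d} (g : Poly d) γ G m → lead g ≢ 0ℤ → ℚ[x].Irreducible γ → m ≢ 0ℤ → map (τ m ℚ.*_) γ ≡ toℚ[x] G →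
    (∀ x → ev g x ≡ ℤ[x].eval G x) → NoFactor g
  irreducible⇒noFactor {d} g γ G m lg≢0 irr m≢0 mγ≡G g≡G {e} h e<d l≢0 c q c≢0 cg≡qh = conclude (split-∣1 {x} {y} γ≈xy)
    where
    open ≡-Reasoning
    open import Algebra.Definitions.RawSemiring ℚ[x].polyRawSemiring using (module Irreducible)
    open Irreducible irr using (split-∣1)
    t = τ (c * m)
    t≢0 : ℚ.NonZero t
    t≢0 = ℚ.≢-nonZero (λ t≡0 → *≢0 c≢0 m≢0 (τ-injective t≡0))
    t⁻¹ = ℚ.1/_ t {{t≢0}}
    hℤ = toList h
    x = map (t⁻¹ ℚ.*_) (toℚ[x] q)
    y = toℚ[x] hℤ
    integral : map (c *_) G ℤ[x].≈ₚ (q ℤ[x].*ₚ hℤ)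
    integral = coefficients-determined (map (c *_) G) (q ℤ[x].*ₚ hℤ) λ x → begin
      ℤ[x].eval (map (c *_) G) x              ≡⟨ Evalℤ.eval-scale c G x ⟩
      c * ℤ[x].eval G x                       ≡⟨ cong (c *_) (g≡G x) ⟨
      c * ev g x                              ≡⟨ cg≡qh x ⟩
      ℤ[x].eval q x * ev h x                  ≡⟨ cong (ℤ[x].eval q x *_) (eval-toList h x) ⟨
      ℤ[x].eval q x * ℤ[x].eval hℤ x          ≡⟨ Evalℤ.eval-* q hℤ x ⟨
      ℤ[x].eval (q ℤ[x].*ₚ hℤ) x ∎
    rational : ∀ i → t ℚ.* ℚ[x].coeff γ i ≡ ℚ[x].coeff (toℚ[x] q ℚ[x].*ₚ y) i
    rational i = begin
      t ℚ.* ℚ[x].coeff γ i                          ≡⟨ trans (cong (ℚ._* ℚ[x].coeff γ i) (τ-* c m)) (ℚ.*-assoc (τ c) (τ m) _) ⟩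
      τ c ℚ.* (τ m ℚ.* ℚ[x].coeff γ i)              ≡⟨ cong (τ c ℚ.*_) (trans (sym (Evalℚ.coeff-scale (τ m) γ i)) (cong (λ p → ℚ[x].coeff p i) mγ≡G)) ⟩
      τ c ℚ.* ℚ[x].coeff (toℚ[x] G) i               ≡⟨ trans (cong (τ c ℚ.*_) (coeff-toℚ G i)) (sym (τ-* c _)) ⟩
      τ (c * ℤ[x].coeff G i)                        ≡⟨ cong τ (trans (sym (Evalℤ.coeff-scale c G i)) (integral i)) ⟩
      τ (ℤ[x].coeff (q ℤ[x].*ₚ hℤ) i)               ≡⟨ trans (sym (coeff-toℚ (q ℤ[x].*ₚ hℤ) i)) (cong (λ p → ℚ[x].coeff p i) (toℚ-* q hℤ)) ⟩
      ℚ[x].coeff (toℚ[x] q ℚ[x].*ₚ y) i ∎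
    γ≈xy : γ ℚ[x].≈ₚ (x ℚ[x].*ₚ y)
    γ≈xy i = begin
      ℚ[x].coeff γ i                                ≡⟨ trans (cong (ℚ._* ℚ[x].coeff γ i) (ℚ.*-inverseˡ t {{t≢0}})) (ℚ.*-identityˡ _) ⟨
      t⁻¹ ℚ.* t ℚ.* ℚ[x].coeff γ i                  ≡⟨ ℚ.*-assoc t⁻¹ t _ ⟩
      t⁻¹ ℚ.* (t ℚ.* ℚ[x].coeff γ i)                ≡⟨ cong (t⁻¹ ℚ.*_) (rational i) ⟩
      t⁻¹ ℚ.* ℚ[x].coeff (toℚ[x] q ℚ[x].*ₚ y) i     ≡⟨ Evalℚ.coeff-scale-* t⁻¹ (toℚ[x] q) y i ⟨
      ℚ[x].coeff (x ℚ[x].*ₚ y) i ∎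
    tx≡q : map (t ℚ.*_) x ≡ toℚ[x] q
    tx≡q = trans (sym (map-∘ (toℚ[x] q))) (trans (map-cong (λ a → trans (sym (ℚ.*-assoc t t⁻¹ a)) (trans (cong (ℚ._* a) (ℚ.*-inverseʳ t {{t≢0}})) (ℚ.*-identityˡ a))) (toℚ[x] q)) (map-id (toℚ[x] q)))
    conclude : ¬ (x ℚ[x].∣ ℚ[x].1ₚ ⊎ y ℚ[x].∣ ℚ[x].1ₚ)
    conclude (inj₂ y∣1) with unit-values 1ℤ y hℤ (λ ()) (trans (map-cong ℚ.*-identityˡ y) (map-id y)) y∣1 | growth h l≢0
    ... | ε , ε≢0 , h∣ε | K , n₀ , grow = growth-contradiction 0 (suc e) (K ℕ.* ∣ ε ∣) n₀ (s≤s z≤n) λ n n₀≤n →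
      subst (λ k → n ℕ.^ k ℕ.≤ K ℕ.* ∣ ε ∣ ℕ.* 1) (sym (ℕ.+-identityʳ (suc e)))
        (ℕ.≤-trans (grow n n₀≤n) (ℕ.≤-trans (ℕ.*-monoʳ-≤ K (subst (λ i → ∣ i ∣ ℕ.≤ ∣ ε ∣) (eval-toList h (+ n)) (bounded-by-divisor (h∣ε (+ n)) ε≢0)))
          (ℕ.≤-reflexive (sym (ℕ.*-identityʳ _)))))
    conclude (inj₁ x∣1) with unit-values (c * m) x q (*≢0 c≢0 m≢0) tx≡q x∣1 | growth g lg≢0 | ev-bound h
    ... | ε , ε≢0 , q∣ε | K , n₀ , grow | B , h≤ = growth-contradiction (suc e) (d ℕ.∸ suc e) (K ℕ.* (∣ ε ∣ ℕ.* B)) (suc n₀) (ℕ.m<n⇒0<n∸m e<d) λ n n₀<n →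
      subst (λ k → n ℕ.^ k ℕ.≤ K ℕ.* (∣ ε ∣ ℕ.* B) ℕ.* n ℕ.^ suc e) (sym (ℕ.m∸n+n≡m (ℕ.<⇒≤ e<d))) (chain n n₀<n)
      where
      chain : ∀ n → n₀ ℕ.< n → n ℕ.^ d ℕ.≤ K ℕ.* (∣ ε ∣ ℕ.* B) ℕ.* n ℕ.^ suc e
      chain n n₀<n = R.begin
        n ℕ.^ d                                    R.≤⟨ grow n (ℕ.<⇒≤ n₀<n) ⟩
        K ℕ.* ∣ ev g (+ n) ∣                       R.≤⟨ ℕ.*-monoʳ-≤ K (ℕ.m≤n*m ∣ ev g (+ n) ∣ ∣ c ∣ {{ℕ.≢-nonZero (λ c≡0 → c≢0 (∣i∣≡0⇒i≡0 c≡0))}}) ⟩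
        K ℕ.* (∣ c ∣ ℕ.* ∣ ev g (+ n) ∣)           R.≡⟨ cong (K ℕ.*_) (trans (sym (abs-* c _)) (trans (cong ∣_∣ (cg≡qh (+ n))) (abs-* (ℤ[x].eval q (+ n)) (ev h (+ n))))) ⟩
        K ℕ.* (∣ ℤ[x].eval q (+ n) ∣ ℕ.* ∣ ev h (+ n) ∣)   R.≤⟨ ℕ.*-monoʳ-≤ K (ℕ.*-mono-≤ (bounded-by-divisor (q∣ε (+ n)) ε≢0) (h≤ n (ℕ.≤-trans (s≤s z≤n) n₀<n))) ⟩
        K ℕ.* (∣ ε ∣ ℕ.* (B ℕ.* n ℕ.^ suc e))      R.≡⟨ trans (cong (K ℕ.*_) (sym (ℕ.*-assoc ∣ ε ∣ B _))) (sym (ℕ.*-assoc K (∣ ε ∣ ℕ.* B) _)) ⟩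
        K ℕ.* (∣ ε ∣ ℕ.* B) ℕ.* n ℕ.^ suc e R.∎
        where module R = ℕ.≤-Reasoning

-- Removing the small and the exceptional primes.

module Sieve where

  open import Data.Integer.Base hiding (suc)
  open import Data.Integer.Divisibility.Signed using (divides; ∣⇒∣ᵤ; ∣ᵤ⇒∣; ∣-trans; ∣m∣n⇒∣m+n; ∣m∣n⇒∣m-n; ∣n⇒∣m*n; ∣m⇒∣m*n; *-cancelˡ-∣; *-monoʳ-∣) renaming (_∣_ to _∣ℤ_)
  open import Data.Integer.Properties
  open import Data.Integer.Tactic.RingSolver using (solve-∀)
  open import Data.Nat.Base as ℕ using (ℕ; zero; suc; z≤n; s≤s; _!)
  import Data.Nat.Divisibility as ℕ
  import Data.Nat.Properties as ℕ
  open Factors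
  open IntegerPolynomials
  open LocalCounts using (Sifted)
  open Valuation using (prime>1)

  ∤-small : ∀ {p} i → i ≢ 0ℤ → ∣ i ∣ ℕ.< p → ¬ + p ∣ℤ i
  ∤-small i i≢0 i<p p∣i = ℕ.<⇒≱ i<p (bounded-by-divisor p∣i i≢0)

  prime∤n! : ∀ {p} → Prime p → ∀ n → n ℕ.< p → ¬ p ℕ.∣ n !
  prime∤n! pp zero    _   p∣1 = contradiction (ℕ.∣1⇒≡1 p∣1) (ℕ.>⇒≢ (prime>1 pp))
  prime∤n! pp (suc n) n<p p∣n! with euclidsLemma (suc n) (n !) pp p∣n!
  ... | inj₁ p∣1+n = ℕ.<⇒≱ n<p (ℕ.∣⇒≤ p∣1+n)
  ... | inj₂ p∣n!′ = prime∤n! pp n (ℕ.<⇒≤ n<p) p∣n!′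

  ∤-* : ∀ {p} → Prime p → ∀ {i j} → ¬ + p ∣ℤ i → ¬ + p ∣ℤ j → ¬ + p ∣ℤ i * j
  ∤-* pp {i} {j} p∤i p∤j p∣ij with euclid pp i j p∣ij
  ... | inj₁ p∣i = p∤i p∣i
  ... | inj₂ p∣j = p∤j p∣j

  ∤1 : ∀ {p} → Prime p → ¬ + p ∣ℤ 1ℤ
  ∤1 pp = ∤-small 1ℤ (λ ()) (prime>1 pp)

  ∤-^ : ∀ {p} → Prime p → ∀ {i} → ¬ + p ∣ℤ i → ∀ k → ¬ + p ∣ℤ i ^ k
  ∤-^ pp p∤i zero    = ∤1 pp
  ∤-^ pp p∤i (suc k) = ∤-* pp p∤i (∤-^ pp p∤i k)

  p^k∣*⇒p^k∣ : ∀ {p} → Prime p → ∀ {z} → ¬ + p ∣ℤ z → ∀ k t → + (p ℕ.^ k) ∣ℤ t * z → + (p ℕ.^ k) ∣ℤ t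
  p^k∣*⇒p^k∣ pp p∤z zero    t _ = divides t (sym (*-identityʳ t))
  p^k∣*⇒p^k∣ {p} pp {z} p∤z (suc k) t pᵏ∣tz with euclid pp t z (∣-trans (∣ᵤ⇒∣ (ℕ.m∣m*n (p ℕ.^ k))) pᵏ∣tz)
  ... | inj₂ p∣z = contradiction p∣z p∤z
  ... | inj₁ (divides s refl) = subst (_∣ℤ s * + p) (sym (pos-* p (p ℕ.^ k))) (subst (+ p * + (p ℕ.^ k) ∣ℤ_) (*-comm (+ p) s)
      (*-monoʳ-∣ (+ p) (p^k∣*⇒p^k∣ pp p∤z k s (*-cancelˡ-∣ (+ p) {{prime⇒nonZero pp}} (subst (_∣ℤ + p * (s * z)) (pos-* p (p ℕ.^ k)) (subst (+ (p ℕ.^ suc k) ∣ℤ_) (lemma s (+ p) z) pᵏ∣tz))))))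
    where
    lemma : ∀ s p z → s * p * z ≡ p * (s * z)
    lemma = solve-∀

  -- If D is a ℤ[x]-combination of g and its derivative, then roots of g mod p ^ k that agree mod a prime
  -- p ∤ D agree mod p ^ k: subtract the values, and use Taylor's formula.
  hensel : ∀ {d} (g : Poly (suc d)) {D} (A B : ℤ → ℤ) → (∀ x → A x * ev g x + B x * ev (deriv g) x ≡ D) → ∀ {p} → Prime p → ¬ + p ∣ℤ D →
    ∀ k x t → + (p ℕ.^ k) ∣ℤ ev g x → + (p ℕ.^ k) ∣ℤ ev g (x + t) → + p ∣ℤ t → + (p ℕ.^ k) ∣ℤ t
  hensel g {D} A B comb {p} pp p∤D k x t pᵏ∣x pᵏ∣x+t p∣t with taylor g x t
  ... | s , eq = p^k∣*⇒p^k∣ pp p∤z k t (subst (+ (p ℕ.^ k) ∣ℤ_) value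
      (∣m∣n⇒∣m+n (∣n⇒∣m*n (B x) (∣m∣n⇒∣m-n pᵏ∣x+t pᵏ∣x)) (∣n⇒∣m*n (t * A x) pᵏ∣x)))
    where
    open ≡-Reasoning
    z = D + B x * (t * s)
    cancel : ∀ a b → a + b - a ≡ b
    cancel = solve-∀
    p∤z : ¬ + p ∣ℤ z
    p∤z p∣z = p∤D (subst (+ p ∣ℤ_) (lemma D (B x * (t * s))) (∣m∣n⇒∣m-n p∣z (∣n⇒∣m*n (B x) (∣m⇒∣m*n s p∣t))))
      where
      lemma : ∀ a b → a + b - b ≡ a
      lemma = solve-∀
    e : ∀ a b y y′ t s → b * (y + t * (y′ + t * s) - y) + t * a * y ≡ t * (a * y + b * y′ + b * (t * s))
    e = solve-∀
    value : B x * (ev g (x + t) - ev g x) + t * A x * ev g x ≡ t * z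
    value = begin
      B x * (ev g (x + t) - ev g x) + t * A x * ev g x   ≡⟨ cong (λ y → B x * (y - ev g x) + t * A x * ev g x) eq ⟩
      B x * (ev g x + t * (ev (deriv g) x + t * s) - ev g x) + t * A x * ev g x   ≡⟨ e (A x) (B x) (ev g x) (ev (deriv g) x) t s ⟩
      t * (A x * ev g x + B x * ev (deriv g) x + B x * (t * s))   ≡⟨ cong (λ y → t * (y + B x * (t * s))) (comb x) ⟩
      t * z ∎

  square : ∀ i → i * i ≡ + (∣ i ∣ ℕ.* ∣ i ∣)
  square (+ n)    = sym (pos-* n n)
  square -[1+ n ] = refl

  -- For c = g (0), the polynomial g (c² b! x) / c has values 1 mod every prime up to b.
  sieve : ∀ {d} (g : Poly (suc (suc d))) → lead g ≢ 0ℤ → NoFactor g → ∀ b₀ →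
    Σ[ h ∈ Poly (suc (suc d)) ] ∃[ b ] ∃[ q ] (ℕ.NonZero q × b₀ ℕ.≤ b × lead h ≢ 0ℤ × Sifted h b × (∀ x → ev h x ∣ℤ ev g (+ q * x)))
  -- The nonzero integer `D` takes the place of the discriminant. It exists because the derivative
  -- has lower degree than g and g has no proper factor.
  sieve {d} g@(c ∷ g₁) l≢0 noFactor b₀ with bezout g noFactor (deriv g) ℕ.≤-refl (λ l′≡0 → *≢0 {+ suc (suc d)} (λ ()) l≢0 (trans (sym (lead-deriv g)) l′≡0))
  ... | D , A , B , D≢0 , comb = h , b , qₙ , qₙ≢0 , ℕ.m≤m+n b₀ _ , lead-h≢0 , sifted , h∣g
    where
    open ≡-Reasoning
    anisotropic = hom-anisotropic g (s≤s (s≤s z≤n)) l≢0 noFactor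
    -- A root at 0 would be the nontrivial zero (0, 1) of the form.
    c≢0 : c ≢ 0ℤ
    c≢0 c≡0 = contradiction (proj₂ (anisotropic 0ℤ 1ℤ (trans (hom[x,1] g 0ℤ) (trans (cong (λ c → c + 0ℤ * ev g₁ 0ℤ) c≡0) refl)))) λ ()
    -- No prime above b divides `c`, `D` or the leading coefficient, as each of them is nonzero and
    -- at most b in absolute value.
    b = b₀ ℕ.+ (∣ c ∣ ℕ.+ (∣ D ∣ ℕ.+ ∣ lead g ∣))
    P = c * + (b !)
    q = c * P
    -- The square in q = c² b! makes q positive whatever the sign of `c`, so that q n is again a
    -- positive argument.
    qₙ = ∣ c ∣ ℕ.* ∣ c ∣ ℕ.* b !
    q≡ : q ≡ + qₙ
    q≡ = trans (sym (*-assoc c c (+ (b !)))) (trans (cong (_* + (b !)) (square c)) (sym (pos-* (∣ c ∣ ℕ.* ∣ c ∣) (b !))))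
    c≤b : ∣ c ∣ ℕ.≤ b
    c≤b = ℕ.≤-trans (ℕ.m≤m+n ∣ c ∣ _) (ℕ.m≤n+m _ b₀)
    D≤b : ∣ D ∣ ℕ.≤ b
    D≤b = ℕ.≤-trans (ℕ.≤-trans (ℕ.m≤m+n ∣ D ∣ _) (ℕ.m≤n+m _ ∣ c ∣)) (ℕ.m≤n+m _ b₀)
    l≤b : ∣ lead g ∣ ℕ.≤ b
    l≤b = ℕ.≤-trans (ℕ.≤-trans (ℕ.m≤n+m ∣ lead g ∣ ∣ D ∣) (ℕ.m≤n+m _ ∣ c ∣)) (ℕ.m≤n+m _ b₀)
    b!≢0 : + (b !) ≢ 0ℤ
    b!≢0 b!≡0 = ℕ.≢-nonZero⁻¹ (b !) {{b ℕ.!≢0}} (+-injective b!≡0)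
    P≢0 : P ≢ 0ℤ
    P≢0 = *≢0 c≢0 b!≢0
    q≢0 : q ≢ 0ℤ
    q≢0 = *≢0 c≢0 P≢0
    qₙ≢0 : ℕ.NonZero qₙ
    qₙ≢0 = ℕ.≢-nonZero λ qₙ≡0 → q≢0 (trans q≡ (cong +_ qₙ≡0))
    -- Since g (x) = c + x g₁ (x) and q = c P, the quotient g (q x) / c is 1 + P x g₁ (q x).
    h : Poly (suc (suc d))
    h = 1ℤ ∷ (P ⊙ dilate q g₁)
    lead-h : lead h ≡ P * (q ^ suc d * lead g₁)
    lead-h = trans (lead-⊙ P (dilate q g₁)) (cong (P *_) (lead-dilate q g₁))
    lead-h≢0 : lead h ≢ 0ℤ
    lead-h≢0 lh≡0 = *≢0 P≢0 (*≢0 (λ q^≡0 → q≢0 (i^n≡0⇒i≡0 q (suc d) q^≡0)) l≢0) (trans (sym lead-h) lh≡0)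
    hom-h : ∀ u v → c * hom h u v ≡ hom g (q * u) v
    hom-h u v = begin
      c * (1ℤ * w + u * hom (P ⊙ dilate q g₁) u v)   ≡⟨ cong (λ t → c * (1ℤ * w + u * t)) (trans (hom-⊙ P (dilate q g₁) u v) (cong (P *_) (hom-dilate q g₁ u v))) ⟩
      c * (1ℤ * w + u * (P * y))                     ≡⟨ e c w u P y ⟩
      c * w + c * P * u * y ∎
      where
      w = v ^ suc (suc d)
      y = hom g₁ (q * u) v
      e : ∀ c w u P y → c * (1ℤ * w + u * (P * y)) ≡ c * w + c * P * u * y
      e = solve-∀
    ev-h : ∀ x → c * ev h x ≡ ev g (q * x)
    ev-h x = trans (cong (c *_) (sym (hom[x,1] h x))) (trans (hom-h x 1ℤ) (hom[x,1] g (q * x)))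
    h∣g : ∀ x → ev h x ∣ℤ ev g (+ qₙ * x)
    h∣g x = divides c (trans (cong (λ q → ev g (q * x)) (sym q≡)) (sym (ev-h x)))
    ∤q : ∀ {p} → Prime p → b ℕ.< p → ¬ + p ∣ℤ q
    ∤P : ∀ {p} → Prime p → b ℕ.< p → ¬ + p ∣ℤ P
    ∤P pp b<p = ∤-* pp (∤-small c c≢0 (ℕ.≤-<-trans c≤b b<p)) (λ p∣b! → prime∤n! pp b b<p (∣⇒∣ᵤ p∣b!))
    ∤q pp b<p = ∤-* pp (∤-small c c≢0 (ℕ.≤-<-trans c≤b b<p)) (∤P pp b<p)
    sifted : Sifted h b
    sifted = record
      { values      = λ {p} pp p≤b n p∣h → ∤1 pp (subst (+ p ∣ℤ_) (cancel 1ℤ (+ n * ev (P ⊙ dilate q g₁) (+ n)))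
          (∣m∣n⇒∣m-n p∣h (∣n⇒∣m*n (+ n) (subst (+ p ∣ℤ_) (sym (ev-⊙ P (dilate q g₁) (+ n)))
            (∣m⇒∣m*n (ev (dilate q g₁) (+ n)) (∣n⇒∣m*n c (∣ᵤ⇒∣ (ℕ.∣-trans (p∣p! p (prime⇒nonZero pp)) (ℕ.m≤n⇒m!∣n! p≤b)))))))))
      ; leading     = λ {p} pp b<p p∣l → ∤-* pp (∤P pp b<p) (∤-* pp (∤-^ pp (∤q pp b<p) (suc d)) (∤-small (lead g) l≢0 (ℕ.≤-<-trans l≤b b<p))) (subst (+ p ∣ℤ_) lead-h p∣l)
      -- As p does not divide q, the claim for x and y under `h` follows from `hensel` at q x and q
      -- y under `g`.
      ; separated   = λ {p} pp b<p k x y pᵏ∣x pᵏ∣y p∣y-x → p^k∣*⇒p^k∣ pp (∤q pp b<p) k (y - x) (subst (+ (p ℕ.^ k) ∣ℤ_) (*-comm q (y - x))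
          (hensel g A B comb pp (∤-small D D≢0 (ℕ.≤-<-trans D≤b b<p)) k (q * x) (q * (y - x))
            (subst (+ (p ℕ.^ k) ∣ℤ_) (ev-h x) (∣n⇒∣m*n c pᵏ∣x))
            (subst (+ (p ℕ.^ k) ∣ℤ_) (trans (ev-h y) (cong (ev g) (shift q x y))) (∣n⇒∣m*n c pᵏ∣y))
            (∣n⇒∣m*n q p∣y-x)))
      ; anisotropic = λ u v hom≡0 → let qu≡0 , v≡0 = anisotropic (q * u) v (trans (sym (hom-h u v)) (trans (cong (c *_) hom≡0) (*-zeroʳ c))) in
          case-≡0 (i*j≡0⇒i≡0∨j≡0 q qu≡0) , v≡0
      }
      where
      case-≡0 : ∀ {u} → q ≡ 0ℤ ⊎ u ≡ 0ℤ → u ≡ 0ℤ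
      case-≡0 (inj₁ q≡0) = contradiction q≡0 q≢0
      case-≡0 (inj₂ u≡0) = u≡0
      p∣p! : ∀ p → ℕ.NonZero p → p ℕ.∣ p !
      p∣p! (suc p) _ = ℕ.m∣m*n (p !)
      cancel : ∀ a b → a + b - b ≡ a
      cancel = solve-∀
      shift : ∀ q x y → q * y ≡ q * x + q * (y - x)
      shift = solve-∀

-- The lcm of the values: upper bound, and return from the sifted polynomial to f.

module LcmOfValues where

  open import Algebra.Definitions.RawMagma using (_,_)
  open import Data.Integer.Base as ℤ using (ℤ; 0ℤ; ∣_∣)
  import Data.Integer.Divisibility.Signed as ℤ
  import Data.Integer.Properties as ℤ
  open import Data.Nat.Base
  open import Data.Nat.Divisibility using (_∣_; ∣⇒≤; ∣-trans; 1∣_; n∣m*n; m∣m*n; *-monoʳ-∣)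
  open import Data.Nat.DivMod using (_/_; _%_; m≡m%n+[m/n]*n; m%n<n; m/n*n≤m)
  open import Data.Nat.GCD using (gcd)
  open import Data.Nat.LCM using (lcm; m∣lcm[m,n]; n∣lcm[m,n]; lcm-least; gcd*lcm)
  open import Data.Nat.Properties
  open import Data.Nat.Tactic.RingSolver using (solve-∀)
  import Data.Rational.Base as ℚ
  import Data.Rational.Properties as ℚ
  open Sizes using (^-distribʳ-*)
  open PrimeByPrime using (*≤⇒≤/; H≢0)
  open LowerEstimate
  open Factors
  open IntegerPolynomials
  open LocalCounts using (Sifted; H)
  open LogGrowth
  open PolynomialRings
  open Sieve
  open Sums

  -- The shape of `L`, for an arbitrary list, so that induction on the list is possible.
  lcm⁺ : List ℕ → ℕ
  lcm⁺ xs = foldr lcm 1 (filter (λ v → ¬? (v ≟ 0)) xs)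

  lcm≢0 : ∀ m n .{{_ : NonZero m}} .{{_ : NonZero n}} → NonZero (lcm m n)
  lcm≢0 m n = ≢-nonZero λ lcm≡0 → ≢-nonZero⁻¹ (m * n) {{m*n≢0 m n}} (trans (sym (gcd*lcm m n)) (trans (cong (gcd m n *_) lcm≡0) (*-zeroʳ (gcd m n))))

  lcm⁺≢0 : ∀ xs → NonZero (lcm⁺ xs)
  lcm⁺≢0 []           = _
  lcm⁺≢0 (zero ∷ xs)  = lcm⁺≢0 xs
  lcm⁺≢0 (suc x ∷ xs) = lcm≢0 (suc x) (lcm⁺ xs) {{_}} {{lcm⁺≢0 xs}}

  ∈⇒∣lcm⁺ : ∀ {x xs} → x ∈ xs → x ≢ 0 → x ∣ lcm⁺ xs
  ∈⇒∣lcm⁺ {zero}  _ x≢0 = contradiction refl x≢0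
  ∈⇒∣lcm⁺ {suc x} {_ ∷ xs}     (here refl) _   = m∣lcm[m,n] (suc x) (lcm⁺ xs)
  ∈⇒∣lcm⁺ {suc x} {zero ∷ xs}  (there x∈)  x≢0 = ∈⇒∣lcm⁺ x∈ x≢0
  ∈⇒∣lcm⁺ {suc x} {suc y ∷ xs} (there x∈)  x≢0 = ∣-trans (∈⇒∣lcm⁺ x∈ x≢0) (n∣lcm[m,n] (suc y) (lcm⁺ xs))

  lcm⁺-least : ∀ xs z → (∀ {x} → x ∈ xs → x ≢ 0 → x ∣ z) → lcm⁺ xs ∣ z
  lcm⁺-least []           z _  = 1∣ z
  lcm⁺-least (zero ∷ xs)  z ∣z = lcm⁺-least xs z (λ x∈ → ∣z (there x∈))
  lcm⁺-least (suc x ∷ xs) z ∣z = lcm-least (∣z (here refl) (λ ())) (lcm⁺-least xs z (λ x∈ → ∣z (there x∈)))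

  lcm⁺≤^ : ∀ xs X → 1 ≤ X → All (_≤ X) xs → lcm⁺ xs ≤ X ^ length xs
  lcm⁺≤^ []           X 1≤X []          = ≤-refl
  lcm⁺≤^ (zero ∷ xs)  X 1≤X (_ ∷ ≤X)   = ≤-trans (lcm⁺≤^ xs X 1≤X ≤X) (m≤n*m (X ^ length xs) X {{>-nonZero 1≤X}})
  lcm⁺≤^ (suc x ∷ xs) X 1≤X (x≤X ∷ ≤X) = ≤-trans
    (∣⇒≤ {{m*n≢0 (suc x) (lcm⁺ xs) {{_}} {{lcm⁺≢0 xs}}}} (lcm-least (m∣m*n (lcm⁺ xs)) (n∣m*n (suc x))))
    (*-mono-≤ x≤X (lcm⁺≤^ xs X 1≤X ≤X))

  module _ (f : ℤ[x].Poly) where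

    private
      F : ℕ → ℕ
      F n = ∣ ℤ[x].eval f (ℤ.+ n) ∣

    L≢0 : ∀ N → NonZero (L f N)
    L≢0 N = lcm⁺≢0 (applyUpTo (λ i → F (suc i)) N)

    value∣L : ∀ N i → i < N → F (suc i) ≢ 0 → F (suc i) ∣ L f N
    value∣L N i i<N = ∈⇒∣lcm⁺ (∈-applyUpTo⁺ (λ i → F (suc i)) i<N)

    L-mono : ∀ {M N} → M ≤ N → L f M ≤ L f N
    L-mono {M} {N} M≤N = ∣⇒≤ {{L≢0 N}} (lcm⁺-least _ (L f N) divides)
      where
      divides : ∀ {x} → x ∈ applyUpTo (λ i → F (suc i)) M → x ≢ 0 → x ∣ L f N
      divides x∈ x≢0 with ∈-applyUpTo⁻ (λ i → F (suc i)) x∈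
      ... | i , i<M , refl = value∣L N i (<-≤-trans i<M M≤N) x≢0

    -- The lcm is at most the product of N values, each at most B N ^ length f; taking N > B absorbs
    -- B into one more factor N.
    L-upper : ∃[ C ] ∃[ N₀ ] (∀ N → N₀ ≤ N → L f N ≤ N ^ (C * N))
    L-upper with ev-bound (fromList f)
    ... | B , bound = suc (length f) , suc B , λ N B<N → begin
      L f N                                                     ≤⟨ lcm⁺≤^ (applyUpTo (λ i → F (suc i)) N) (N ^ suc (length f)) (m^n>0 N {{>-nonZero (≤-trans (s≤s z≤n) B<N)}} (suc (length f)))
                                                                     (All.applyUpTo⁺₁ (λ i → F (suc i)) N (λ {i} i<N → each N i B<N i<N)) ⟩
      (N ^ suc (length f)) ^ length (applyUpTo (λ i → F (suc i)) N) ≡⟨ cong ((N ^ suc (length f)) ^_) (length-applyUpTo (λ i → F (suc i)) N) ⟩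
      (N ^ suc (length f)) ^ N                                  ≡⟨ ^-*-assoc N (suc (length f)) N ⟩
      N ^ (suc (length f) * N) ∎
      where
      open ≤-Reasoning
      each : ∀ N i → B < N → i < N → F (suc i) ≤ N ^ suc (length f)
      each N i B<N i<N = begin
        F (suc i)                               ≡⟨ cong ∣_∣ (ev-fromList f (ℤ.+ suc i)) ⟨
        ∣ ev (fromList f) (ℤ.+ suc i) ∣         ≤⟨ bound (suc i) (s≤s z≤n) ⟩
        B * suc i ^ length f                    ≤⟨ *-mono-≤ (<⇒≤ B<N) (^-monoˡ-≤ (length f) i<N) ⟩
        N ^ suc (length f) ∎

    eventually-nonzero : ¬ (f ℤ[x].≈ₚ ℤ[x].0ₚ) → ∃[ n₀ ] (∀ n → n₀ ≤ n → F n ≢ 0)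
    eventually-nonzero f≉0 with trim (fromList f)
    ... | inj₁ f≡0 = contradiction (vanishing f 0 (λ n _ → trans (sym (ev-fromList f (ℤ.+ n))) (f≡0 (ℤ.+ n)))) f≉0
    ... | inj₂ (e , g , _ , l≢0 , g≡f) with growth g l≢0
    ...   | K , n₀ , grow = suc n₀ , λ n n₀<n F≡0 → contradiction (≤-trans (m^n>0 n {{>-nonZero (≤-trans (s≤s z≤n) n₀<n)}} e)
              (≤-trans (grow n (<⇒≤ n₀<n)) (≤-reflexive (trans (cong (λ y → K * ∣ y ∣) (trans (g≡f (ℤ.+ n)) (ev-fromList f (ℤ.+ n)))) (trans (cong (K *_) F≡0) (*-zeroʳ K)))))) λ ()

  -- Squaring the hypothesis leaves an N ^ N to spare, which absorbs κ ^ (2 c) for large N. For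
  -- general n take N = ⌊n / q⌋: then n ≤ 2 q N ≤ N², so n ^ n ≤ (N ^ N) ^ (4 q), and monotonicity
  -- passes from q N to n.
  rescale : ∀ (ℓ : ℕ → ℕ) → (∀ {M N} → M ≤ N → ℓ M ≤ ℓ N) → ∀ c κ q K .{{_ : NonZero q}} →
    (∀ N → K ≤ N → N ^ N ≤ (κ * ℓ (q * N)) ^ c) → ∃[ C ] ∃[ N₀ ] (∀ N → N₀ ≤ N → N ^ N ≤ ℓ N ^ C)
  rescale ℓ ℓ-mono c κ q K bound = c * 2 * (2 * q * 2) , N₀ * q , λ n N₀q≤n → scaled n (n / q) (*≤⇒≤/ q N₀q≤n) (m/n*n≤m n q) (n≤ n)
    where
    open ≤-Reasoning
    N₀ = 1 + (K + (κ + (c * 2 + 2 * q)))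
    n≤ : ∀ n → n ≤ q * suc (n / q)
    n≤ n = begin
      n                      ≡⟨ m≡m%n+[m/n]*n n q ⟩
      n % q + n / q * q      ≤⟨ +-monoˡ-≤ (n / q * q) (<⇒≤ (m%n<n n q)) ⟩
      q + n / q * q          ≡⟨ *-comm (suc (n / q)) q ⟩
      q * suc (n / q) ∎
    N^N≤ℓ : ∀ N → N₀ ≤ N → N ^ N ≤ ℓ (q * N) ^ (c * 2)
    N^N≤ℓ N N₀≤N = *-cancelˡ-≤ (N ^ N) {{m^n≢0 N N {{>-nonZero (≤-trans (s≤s z≤n) N₀≤N)}}}} (begin
      N ^ N * N ^ N                              ≡⟨ cong (N ^ N *_) (*-identityʳ (N ^ N)) ⟨
      (N ^ N) ^ 2                                ≤⟨ ^-monoˡ-≤ 2 (bound N (≤-trans (m≤n⇒m≤1+n (m≤m+n K _)) N₀≤N)) ⟩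
      ((κ * ℓ (q * N)) ^ c) ^ 2                  ≡⟨ trans (^-*-assoc (κ * ℓ (q * N)) c 2) (^-distribʳ-* κ (ℓ (q * N)) (c * 2)) ⟩
      κ ^ (c * 2) * ℓ (q * N) ^ (c * 2)          ≤⟨ *-monoˡ-≤ (ℓ (q * N) ^ (c * 2)) (≤-trans (^-monoˡ-≤ (c * 2) κ≤N) (^-monoʳ-≤ N {{>-nonZero (≤-trans (s≤s z≤n) N₀≤N)}} c2≤N)) ⟩
      N ^ N * ℓ (q * N) ^ (c * 2) ∎)
      where
      κ≤N : κ ≤ N
      κ≤N = ≤-trans (m≤n⇒m≤1+n (≤-trans (m≤m+n κ _) (m≤n+m _ K))) N₀≤N
      c2≤N : c * 2 ≤ N
      c2≤N = ≤-trans (m≤n⇒m≤1+n (≤-trans (≤-trans (m≤m+n (c * 2) _) (m≤n+m _ κ)) (m≤n+m _ K))) N₀≤N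
    scaled : ∀ n N → N₀ ≤ N → N * q ≤ n → n ≤ q * suc N → n ^ n ≤ ℓ n ^ (c * 2 * (2 * q * 2))
    scaled n N N₀≤N Nq≤n n≤ = begin
      n ^ n                                  ≤⟨ ^-monoʳ-≤ n {{>-nonZero 1≤n}} (≤-trans n≤2qN (≤-reflexive (*-comm (2 * q) N))) ⟩
      n ^ (N * (2 * q))                      ≤⟨ ^-monoˡ-≤ (N * (2 * q)) (≤-trans n≤2qN (*-monoˡ-≤ N 2q≤N)) ⟩
      (N * N) ^ (N * (2 * q))                ≡⟨ cong (λ x → (N * x) ^ (N * (2 * q))) (*-identityʳ N) ⟨
      (N ^ 2) ^ (N * (2 * q))                ≡⟨ trans (^-*-assoc N 2 (N * (2 * q))) (trans (cong (N ^_) (e N q)) (sym (^-*-assoc N N (2 * q * 2)))) ⟩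
      (N ^ N) ^ (2 * q * 2)                  ≤⟨ ^-monoˡ-≤ (2 * q * 2) (N^N≤ℓ N N₀≤N) ⟩
      (ℓ (q * N) ^ (c * 2)) ^ (2 * q * 2)    ≡⟨ ^-*-assoc (ℓ (q * N)) (c * 2) (2 * q * 2) ⟩
      ℓ (q * N) ^ (c * 2 * (2 * q * 2))      ≤⟨ ^-monoˡ-≤ (c * 2 * (2 * q * 2)) (ℓ-mono (≤-trans (≤-reflexive (*-comm q N)) Nq≤n)) ⟩
      ℓ n ^ (c * 2 * (2 * q * 2)) ∎
      where
      e : ∀ N q → 2 * (N * (2 * q)) ≡ N * (2 * q * 2)
      e = solve-∀
      e′ : ∀ q N → q * (N + N) ≡ 2 * q * N
      e′ = solve-∀
      1≤N : 1 ≤ N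
      1≤N = ≤-trans (s≤s z≤n) N₀≤N
      1≤n : 1 ≤ n
      1≤n = ≤-trans (*-mono-≤ 1≤N (>-nonZero⁻¹ q)) Nq≤n
      2q≤N : 2 * q ≤ N
      2q≤N = ≤-trans (m≤n⇒m≤1+n (≤-trans (≤-trans (m≤n+m (2 * q) (c * 2)) (m≤n+m _ κ)) (m≤n+m _ K))) N₀≤N
      n≤2qN : n ≤ 2 * q * N
      n≤2qN = ≤-trans n≤ (≤-trans (*-monoʳ-≤ q (+-monoˡ-≤ N 1≤N)) (≤-reflexive (e′ q N)))

  -- The denominators of γ and of its cofactor are cleared together by κ = k m; the values of the
  -- integral cofactor are then the quotients.
  integral-factor : ∀ f γ → γ ℚ[x].∣ toℚ[x] f → ∀ m G → m ≢ 0ℤ → map (τ m ℚ.*_) γ ≡ toℚ[x] G →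
    ∃[ κ ] (κ ≢ 0ℤ × (∀ x → ℤ[x].eval G x ℤ.∣ κ ℤ.* ℤ[x].eval f x))
  integral-factor f γ (δ , δγ≈f) m G m≢0 mγ≡G with integral-multiple δ
  ... | k , Δ , k≢0 , kδ≡Δ = k ℤ.* m , *≢0 k≢0 m≢0 , λ x → ℤ.divides (ℤ[x].eval Δ x) (τ-injective (begin
    τ (k ℤ.* m ℤ.* ℤ[x].eval f x)                                        ≡⟨ trans (τ-* (k ℤ.* m) (ℤ[x].eval f x)) (cong₂ ℚ._*_ (τ-* k m) (sym (eval-toℚ f x))) ⟩
    τ k ℚ.* τ m ℚ.* ℚ[x].eval (toℚ[x] f) (τ x)                           ≡⟨ cong (τ k ℚ.* τ m ℚ.*_) (trans (sym (Evalℚ.eval-cong (δ ℚ[x].*ₚ γ) (toℚ[x] f) (τ x) δγ≈f)) (Evalℚ.eval-* δ γ (τ x))) ⟩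
    τ k ℚ.* τ m ℚ.* (ℚ[x].eval δ (τ x) ℚ.* ℚ[x].eval γ (τ x))            ≡⟨ rearrange (τ k) (τ m) (ℚ[x].eval δ (τ x)) (ℚ[x].eval γ (τ x)) ⟩
    τ k ℚ.* ℚ[x].eval δ (τ x) ℚ.* (τ m ℚ.* ℚ[x].eval γ (τ x))            ≡⟨ cong₂ ℚ._*_ (scaled-eval k δ Δ kδ≡Δ x) (scaled-eval m γ G mγ≡G x) ⟨
    τ (ℤ[x].eval Δ x) ℚ.* τ (ℤ[x].eval G x)                              ≡⟨ τ-* (ℤ[x].eval Δ x) (ℤ[x].eval G x) ⟨
    τ (ℤ[x].eval Δ x ℤ.* ℤ[x].eval G x) ∎))
    where
    open ≡-Reasoning

  -- At the first few points f may vanish, and a zero value is left out of the lcm. The values of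
  -- `h` there are nonzero, and their product `Z` supplies the missing multiples.
  lower-bound : ∀ f n₀ → (∀ n → n₀ ≤ n → ∣ ℤ[x].eval f (ℤ.+ n) ∣ ≢ 0) → ∀ k .{{_ : NonZero k}} q .{{_ : NonZero q}} →
    ∀ {d} (h : Poly d) {b} → 1 ≤ d → lead h ≢ 0ℤ → Sifted h b → 28 * d ≤ b →
    (∀ n → H h n ∣ k * ∣ ℤ[x].eval f (ℤ.+ (q * n)) ∣) → ∃[ C ] ∃[ N₀ ] (∀ N → N₀ ≤ N → N ^ N ≤ L f N ^ C)
  lower-bound f n₀ f≢0 k {{k≢0}} q {d} h 1≤d l≢0 sifted 28d≤b h∣kf =
    rescale (L f) (L-mono f) (70 * d) (k * Z) q (proj₁ estimate) λ N K≤N →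
      proj₂ estimate N (k * Z * L f (q * N)) {{m*n≢0 (k * Z) (L f (q * N)) {{m*n≢0 k Z {{k≢0}} {{Z≢0}}}} {{L≢0 f (q * N)}}}} K≤N
        (λ i i<N → divides N i i<N (n₀ ≤? suc i))
    where
    estimate = N^N≤L^70d h 1≤d l≢0 sifted 28d≤b
    Z = Π< n₀ (λ i → H h (suc i))
    Z≢0 : NonZero Z
    Z≢0 = Π-nonZero n₀ (λ i _ → H≢0 h sifted (suc i))
    F : ℕ → ℕ
    F n = ∣ ℤ[x].eval f (ℤ.+ n) ∣
    F∣L : ∀ N n → n ≤ N → n₀ ≤ n → NonZero n → F n ∣ L f N
    F∣L N (suc n) n<N n₀≤n _ = value∣L f N n n<N (f≢0 (suc n) n₀≤n)
    rearrange′ : ∀ k l z → k * l * z ≡ k * z * l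
    rearrange′ = solve-∀
    divides : ∀ N i → i < N → Dec (n₀ ≤ suc i) → H h (suc i) ∣ k * Z * L f (q * N)
    divides N i i<N (no n₀≰1+i)  = ∣-trans (∣Π n₀ (λ i → H h (suc i)) i (<-trans (n<1+n i) (≰⇒> n₀≰1+i)))
      (∣-trans (n∣m*n k) (m∣m*n (L f (q * N))))
    divides N i i<N (yes n₀≤1+i) = ∣-trans (h∣kf (suc i)) (subst (k * F (q * suc i) ∣_) (rearrange′ k (L f (q * N)) Z)
      (∣-trans (*-monoʳ-∣ k (F∣L (q * N) (q * suc i) (*-monoʳ-≤ q i<N) (≤-trans n₀≤1+i (m≤n*m (suc i) q)) (m*n≢0 q (suc i)))) (m∣m*n Z)))

  integral-model : ∀ γ d → ℚ[x].HasDegree γ d →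
    ∃[ m ] ∃[ G ] Σ[ g ∈ Poly d ] (m ≢ 0ℤ × map (τ m ℚ.*_) γ ≡ toℚ[x] G × lead g ≢ 0ℤ × (∀ x → ev g x ≡ ℤ[x].eval G x))
  integral-model γ d (leading , above) = model (integral-multiple γ)
    where
    model : ∃[ m ] ∃[ P ] (m ≢ 0ℤ × map (τ m ℚ.*_) γ ≡ toℚ[x] P) → _
    model (m , G , m≢0 , mγ≡G) =
      let g , lead≡ , g≡G = truncate d G zero-above in m , G , g , m≢0 , mγ≡G , (λ l≡0 → lead≢0 (trans (sym lead≡) l≡0)) , g≡G
      where
      coeff-G : ∀ i → τ (ℤ[x].coeff G i) ≡ τ m ℚ.* ℚ[x].coeff γ i
      coeff-G i = trans (sym (coeff-toℚ G i)) (trans (cong (λ p → ℚ[x].coeff p i) (sym mγ≡G)) (Evalℚ.coeff-scale (τ m) γ i))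
      zero-above : ∀ i → d < i → ℤ[x].coeff G i ≡ 0ℤ
      zero-above i d<i = τ-injective (trans (coeff-G i) (trans (cong (τ m ℚ.*_) (above i d<i)) (ℚ.*-zeroʳ (τ m))))
      lead≢0 : ℤ[x].coeff G d ≢ 0ℤ
      lead≢0 l≡0 = leading (begin
        c                           ≡⟨ trans (cong (ℚ._* c) (ℚ.*-inverseˡ (τ m) {{τm≢0}})) (ℚ.*-identityˡ c) ⟨
        m⁻¹ ℚ.* τ m ℚ.* c           ≡⟨ ℚ.*-assoc m⁻¹ (τ m) c ⟩
        m⁻¹ ℚ.* (τ m ℚ.* c)         ≡⟨ cong (m⁻¹ ℚ.*_) (coeff-G d) ⟨
        m⁻¹ ℚ.* τ (ℤ[x].coeff G d)  ≡⟨ cong (λ a → m⁻¹ ℚ.* τ a) l≡0 ⟩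
        m⁻¹ ℚ.* ℚ.0ℚ                ≡⟨ ℚ.*-zeroʳ m⁻¹ ⟩
        ℚ.0ℚ ∎)
        where
        open ≡-Reasoning
        c = ℚ[x].coeff γ d
        τm≢0 : ℚ.NonZero (τ m)
        τm≢0 = ℚ.≢-nonZero (λ τm≡0 → m≢0 (τ-injective τm≡0))
        m⁻¹ = ℚ.1/_ (τ m) {{τm≢0}}

  lower : ∀ f → ¬ (f ℤ[x].≈ₚ ℤ[x].0ₚ) → ∀ γ → ℚ[x].Irreducible γ → γ ℚ[x].∣ toℚ[x] f → ∀ d → ℚ[x].HasDegree γ d → 2 ≤ d →
    ∃[ C ] ∃[ N₀ ] (∀ N → N₀ ≤ N → N ^ N ≤ L f N ^ C)
  lower f f≉0 γ irreducible γ∣f (suc (suc d)) degree _ =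
    let m , G , g , m≢0 , mγ≡G , l≢0 , g≡G = integral-model γ (suc (suc d)) degree
        h , b , q , q≢0 , 28d≤b , lh≢0 , sifted , h∣g =
          -- The sifting bound 28 times the degree is what `E≤` asks for.
          sieve g l≢0 (irreducible⇒noFactor g γ G m l≢0 irreducible m≢0 mγ≡G g≡G) (28 * suc (suc d))
        κ , κ≢0 , G∣κf = integral-factor f γ γ∣f m G m≢0 mγ≡G
        n₀ , f≢0 = eventually-nonzero f f≉0
    in lower-bound f n₀ f≢0 ∣ κ ∣ {{≢-nonZero (λ κ≡0 → κ≢0 (ℤ.∣i∣≡0⇒i≡0 κ≡0))}} q {{q≢0}} h (s≤s z≤n) lh≢0 sifted 28d≤b
         (λ n → subst (H h n ∣_) (ℤ.abs-* κ (ℤ[x].eval f (ℤ.+ (q * n)))) (ℤ.∣⇒∣ᵤ (ℤ.∣-trans (h∣g (ℤ.+ n))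
           (subst (ℤ._∣ κ ℤ.* ℤ[x].eval f (ℤ.+ (q * n))) (trans (sym (g≡G (ℤ.+ (q * n)))) (cong (ev g) (ℤ.pos-* q n)))
             (G∣κf (ℤ.+ (q * n)))))))
  lower _ _ _ _ _ (suc zero) _ (s≤s ())

-- Both bounds for the logarithm of the lcm.

open import Data.Nat using (ℕ; _≤_)
open LcmOfValues using (lower; L-upper)
open LogGrowth using (NlogN≪log; log≪NlogN)

corollary1p3 : (f : ℤ[x].Poly) →
    ¬ (f ℤ[x].≈ₚ ℤ[x].0ₚ) →
    (∃[ g ] (ℚ[x].Irreducible g × g ℚ[x].∣ toℚ[x] f × ∃[ d ] (ℚ[x].HasDegree g d × 2 ≤ d))) →
    (NlogN ≪ (λ N → log (L f N))) × ((λ N → log (L f N)) ≪ NlogN)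
corollary1p3 f f≉0 (g , irreducible , g∣f , d , degree , 2≤d) =
  let C  , N₀  , N^N≤L^C  = lower f f≉0 g irreducible g∣f d degree 2≤d
      C′ , N₀′ , L≤N^C′N = L-upper f
  in NlogN≪log (L f) C N₀ N^N≤L^C , log≪NlogN (L f) C′ N₀′ L≤N^C′N
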